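{- (1) Let $f \in \mathbb{Z}[x]$ be a monic polynomial of degree $d \ge 1$ with roots $\alpha_1, \dots, \alpha_d$, none of which is a root of unity, and let $\Delta_n(f) = \prod_{i=1}^d |\alpha_i^n - 1|$ for $n \ge 1$. Then the sequence $(\Delta_n(f))_{n\ge1}$ is everywhere locally realisable, and hence realisable. (2) Let $B_m$ denote the Bernoulli numbers, defined by $\frac{t}{e^t - 1} = \sum_{m=0}^\infty B_m \frac{t^m}{m!}$, and for $n \ge 1$ let $b_n$ be the denominator (in lowest terms, taken positive) of $B_{2n}$. Then $(b_n)_{n\ge1}$ is everywhere locally realisable, and hence realisable.
   Context: A sequence $(v_n)_{n\ge1}$ of non-negative integers is called realisable if there exist a set $X$ and a map $T: X \to X$ such that for every $n \ge 1$ the set $\mathrm{Per}_n(T) = \{x \in X : T^n(x) = x\}$ is finite and $|\mathrm{Per}_n(T)| = v_n$. For a prime $p$ and a positive integer $u$, the $p$-part $[u]_p$ is the largest power of $p$ dividing $u$. A sequence $(u_n)$ of positive integers is locally realisable at $p$ if $([u_n]_p)_{n\ge1}$ is realisable, and everywhere locally realisable if it is locally realisable at every prime $p$. -}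

module Defs where

open import Level using (Level; _⊔_)
open import Data.Nat as ℕ using (ℕ; zero; suc; _≤_; _^_)
open import Data.Nat.Divisibility using (_∣_)
open import Data.Nat.Primality using (Prime)
open import Data.Nat.Combinatorics using (_C_)
open import Data.Fin using (Fin)
import Data.Fin as Fin
open import Data.Integer as ℤ using (ℤ; +_; -[1+_])
open import Data.Rational as ℚ using (ℚ; ↧ₙ_)
open import Data.List using (List; []; _∷_; _++_; zipWith; upTo; foldr)
open import Data.Product using (Σ; _×_)
open import Function.Bundles using (_↔_)
open import Relation.Binary.PropositionalEquality using (_≡_)
open import Relation.Nullary using (¬_)
open import Algebra.Bundles using (CommutativeRing)

iter : {X : Set} → (X → X) → ℕ → X → X
iter T zero    x = x
iter T (suc n) x = T (iter T n x)

Per : {X : Set} → (X → X) → ℕ → Set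
Per {X} T n = Σ X (λ x → iter T n x ≡ x)

Realisable : (ℕ → ℕ) → Set₁
Realisable v = Σ Set (λ X → Σ (X → X) (λ T →
  (n : ℕ) → 1 ≤ n → Fin (v n) ↔ Per T n))

IsPPart : ℕ → ℕ → ℕ → Set
IsPPart p u e = (p ^ e ∣ u) × ¬ (p ^ suc e ∣ u)

LocallyRealisableAt : ℕ → (ℕ → ℕ) → Set₁
LocallyRealisableAt p u = Σ (ℕ → ℕ) (λ e →
  ((n : ℕ) → 1 ≤ n → IsPPart p (u n) (e n)) × Realisable (λ n → p ^ e n))

EverywhereLocallyRealisable : (ℕ → ℕ) → Set₁
EverywhereLocallyRealisable u = (p : ℕ) → Prime p → LocallyRealisableAt p u

module RingDefs {c ℓ : Level} (R : CommutativeRing c ℓ) where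
  open CommutativeRing R

  sumF : (n : ℕ) → (Fin n → Carrier) → Carrier
  sumF zero    f = 0#
  sumF (suc n) f = f Fin.zero + sumF n (λ i → f (Fin.suc i))

  prodF : (n : ℕ) → (Fin n → Carrier) → Carrier
  prodF zero    f = 1#
  prodF (suc n) f = f Fin.zero * prodF n (λ i → f (Fin.suc i))

  pow : Carrier → ℕ → Carrier
  pow x zero    = 1#
  pow x (suc n) = x * pow x n

  ιℕ : ℕ → Carrier
  ιℕ zero    = 0#
  ιℕ (suc n) = 1# + ιℕ n

  ι : ℤ → Carrier
  ι (+ n)      = ιℕ n
  ι -[1+ n ]   = - ιℕ (suc n)

  evalMonic : (d : ℕ) → (Fin d → ℤ) → Carrier → Carrier
  evalMonic d cs x = pow x d + sumF d (λ i → ι (cs i) * pow x (Fin.toℕ i))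

  IsIntegralDomain : Set (c ⊔ ℓ)
  IsIntegralDomain = (¬ (1# ≈ 0#)) × ((x y : Carrier) → x * y ≈ 0# → (x ≈ 0#) Data.Sum.⊎ (y ≈ 0#))
    where import Data.Sum

  CharZero : Set ℓ
  CharZero = (n : ℕ) → ιℕ (suc n) ≈ 0# → Data.Empty.⊥
    where import Data.Empty

  IsRootOfUnity : Carrier → Set ℓ
  IsRootOfUnity α = Σ ℕ (λ n → (1 ≤ n) × (pow α n ≈ 1#))

-- Bernoulli numbers, via the recurrence  Σ_{k=0}^{m} C(m+1,k) B_k = 0
-- (m ≥ 1), B_0 = 1, equivalent to t/(e^t - 1) = Σ B_m t^m / m!.

sumℚ : List ℚ → ℚ
sumℚ = foldr ℚ._+_ ℚ.0ℚ

bernUpTo : ℕ → List ℚ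
bernUpTo zero    = ℚ.1ℚ ∷ []
bernUpTo (suc m) = bs ++ (next ∷ [])
  where
  bs   = bernUpTo m
  next = ℚ.- ((ℤ.+ 1 ℚ./ suc (suc m)) ℚ.*
           sumℚ (zipWith (λ k b → (ℤ.+ (suc (suc m) C k) ℚ./ 1) ℚ.* b) (upTo (suc m)) bs))

lastOr : ℚ → List ℚ → ℚ
lastOr d []       = d
lastOr d (x ∷ xs) = lastOr x xs

bernoulli : ℕ → ℚ
bernoulli m = lastOr ℚ.0ℚ (bernUpTo m)

bernDenom : ℕ → ℕ
bernDenom n = ↧ₙ bernoulli (2 ℕ.* n)

{-# OPTIONS --safe #-}

-- (1) Let C be the companion matrix of f, acting on the torus (K/O)^d with K = ℚ. It realises n ↦ #ker(C^n - 1), and row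
-- reduction of C^n - 1 over ℤ turns this count into |det(C^n - 1)| = Δ_n when O = ℤ, and into its p-part when O is the
-- localisation of ℤ at p. The determinant is computed in R: the Newton basis ∏_{i<k} (x - α_i) of R[x]/(f) conjugates C,
-- by a unitriangular matrix, to an upper bidiagonal matrix with diagonal α, so det(C^n - 1) = ∏ (α_i^n - 1).
-- (2) B_m = Σ_k (-1)^k k! S(m,k) / (k + 1). For even m ≥ 2 the k-th term is an integer unless k + 1 is a prime with k | m,
-- and then its denominator is k + 1; so the denominator of B_m is the product of these primes (von Staudt–Clausen).
-- The factor k + 1 is realised by a fixed point together with the rotation by 2 on ℤ/k, which has all or none of its points
-- in Per_n according to k | 2n. The product of these systems over all k realises the whole sequence, since a given
-- Per_n has only finitely many nontrivial factors.
module Submission where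

open import Defs
open import Level using (0ℓ)
open import Algebra.Bundles using (CommutativeRing)
open import Algebra.Solver.Ring.AlmostCommutativeRing using (fromCommutativeRing; _-Raw-AlmostCommutative⟶_)
import Algebra.Solver.Ring
import Algebra.Properties.Ring
import Algebra.Properties.AbelianGroup
open import Axiom.UniquenessOfIdentityProofs using (module Decidable⇒UIP)
open import Data.Bool using (Bool; true; false)
open import Data.Empty using (⊥; ⊥-elim)
open import Data.Fin as Fin using (Fin)
import Data.Fin.Properties as Finₚ
open import Data.Integer as ℤ using (ℤ; +_; -[1+_])
import Data.Integer.DivMod as ℤD
open import Data.Integer.Divisibility.Signed as ℤ∣ using (_∣_; divides)
import Data.Integer.Properties as ℤₚ
open import Data.List using ([]; _∷_; _++_; zipWith; upTo; applyUpTo)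
import Data.List.Properties as Listₚ
open import Data.Maybe as Maybe using (Maybe; just; nothing)
import Data.Maybe.Properties as Maybeₚ
open import Data.Nat as ℕ using (ℕ; zero; suc; _≤_; _<_; s≤s; z≤n; _^_; _!)
open import Data.Nat.Combinatorics using (_C_; nCk+nC[k+1]≡[n+1]C[k+1]; nCn≡1; nC1≡n; nCk≡nC[n∸k])
open import Data.Nat.Combinatorics.Specification using (k>n⇒nCk≡0)
open import Data.Nat.Coprimality as Coprimality using (Coprime; coprime-Bézout; coprime-divisor)
import Data.Nat.Divisibility as ℕ∣
import Data.Nat.DivMod as ℕD
open import Data.Nat.GCD using (module Bézout)
open import Data.Nat.Induction using (<-wellFounded)
open import Data.Nat.Primality as Primality using (Prime; prime?)
import Data.Nat.Properties as ℕₚ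
open import Data.Product using (Σ; _×_; _,_; proj₁; proj₂; ∃)
import Data.Product.Properties as ×ₚ
open import Data.Rational as ℚ using (ℚ; ↧ₙ_; mkℚ)
import Data.Rational.Properties as ℚₚ
open import Data.Rational.Unnormalised as ℚᵘ using (mkℚᵘ; *≡*)
import Data.Rational.Unnormalised.Properties as ℚᵘₚ
open import Data.Sum using (_⊎_; inj₁; inj₂; [_,_])
open import Data.Unit using (⊤; tt)
open import Data.Vec using (Vec; []; _∷_; map; replicate)
open import Data.Vec.Relation.Unary.All using (All; []; _∷_)
open import Function.Bundles using (_↔_; mk↔ₛ′)
open import Induction.WellFounded using (Acc; acc)
open import Relation.Binary using (IsEquivalence; Tri; tri<; tri≈; tri>)
open import Relation.Binary.PropositionalEquality as ≡ using (_≡_; _≢_)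
import Relation.Binary.Reasoning.Setoid
open import Relation.Nullary using (¬_; yes; no; Dec)

-- `Realisable` asks for an exact bijection onto points compared by propositional equality, whereas
-- the natural systems live on a quotient (vectors modulo O) or on functions compared pointwise.
-- Points are therefore counted up to an equivalence, and a counted system is exchanged for one on
-- pairs (period, index), a set with decidable equality whose periodic points correspond to the
-- classes. The ring R of the roots is only a domain of characteristic zero up to `_≈_`, without
-- decidable equality, and f = ∏ (x - α_i) is given as an equality of values; coefficients are
-- recovered from the values at the integers. R enters through one determinant alone: all counting
-- takes place over ℚ and ℤ, and injectivity of `ι` brings the value of the determinant back to ℤ.
-- Determinants are volume forms in an exterior algebra, because multiplicativity and invariance
-- under row operations then both follow from the alternating law. The set of allowed denominators
-- is a parameter of the torus, so a single count of solutions serves Δ and each of its p-parts.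

-- Integer scalars and finite sums in a commutative ring

module IntegerScalars (R : CommutativeRing 0ℓ 0ℓ) where
  open CommutativeRing R hiding (zero) public
  open RingDefs R public
  open Algebra.Properties.Ring ring public using (-‿distribˡ-*; -‿distribʳ-*; -0#≈0#; -‿involutive)
  open Algebra.Properties.AbelianGroup +-abelianGroup using () renaming (⁻¹-∙-comm to -‿+-comm)
  open Relation.Binary.Reasoning.Setoid setoid

  ιℕ-+ : ∀ m n → ιℕ (m ℕ.+ n) ≈ ιℕ m + ιℕ n
  ιℕ-+ zero    n = sym (+-identityˡ _)
  ιℕ-+ (suc m) n = trans (+-congˡ (ιℕ-+ m n)) (sym (+-assoc _ _ _))

  cancel-1 : ∀ x y → (1# + x) + - (1# + y) ≈ x + - y
  cancel-1 x y = begin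
    (1# + x) + - (1# + y)     ≈⟨ +-cong (+-comm _ _) (sym (-‿+-comm 1# y)) ⟩
    (x + 1#) + (- 1# + - y)   ≈⟨ +-assoc _ _ _ ⟩
    x + (1# + (- 1# + - y))   ≈⟨ +-congˡ (sym (+-assoc _ _ _)) ⟩
    x + ((1# + - 1#) + - y)   ≈⟨ +-congˡ (+-congʳ (-‿inverseʳ 1#)) ⟩
    x + (0# + - y)            ≈⟨ +-congˡ (+-identityˡ _) ⟩
    x + - y                   ∎

  ι-neg : ∀ i → ι (ℤ.- i) ≈ - ι i
  ι-neg (+ zero)  = sym -0#≈0#
  ι-neg (+ suc n) = refl
  ι-neg -[1+ n ]  = sym (-‿involutive _)

  ι-⊖ : ∀ m n → ι (m ℤ.⊖ n) ≈ ιℕ m + - ιℕ n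
  ι-⊖ m zero = trans (sym (+-identityʳ _)) (+-congˡ (sym -0#≈0#))
  ι-⊖ zero (suc n) = sym (+-identityˡ _)
  ι-⊖ (suc m) (suc n) = begin
    ι (suc m ℤ.⊖ suc n)          ≡⟨ ≡.cong ι (ℤₚ.[1+m]⊖[1+n]≡m⊖n m n) ⟩
    ι (m ℤ.⊖ n)                  ≈⟨ ι-⊖ m n ⟩
    ιℕ m + - ιℕ n                ≈⟨ cancel-1 _ _ ⟨
    ιℕ (suc m) + - ιℕ (suc n)    ∎

  ι-+ : ∀ i j → ι (i ℤ.+ j) ≈ ι i + ι j
  ι-+ (+ m)    (+ n)    = ιℕ-+ m n
  ι-+ (+ m)    -[1+ n ] = ι-⊖ m (suc n)
  ι-+ -[1+ m ] (+ n)    = trans (ι-⊖ n (suc m)) (+-comm _ _)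
  ι-+ -[1+ m ] -[1+ n ] = begin
    - ιℕ (suc (suc (m ℕ.+ n)))          ≡⟨ ≡.cong (λ k → - ιℕ (suc k)) (ℕₚ.+-suc m n) ⟨
    - ιℕ (suc m ℕ.+ suc n)              ≈⟨ -‿cong (ιℕ-+ (suc m) (suc n)) ⟩
    - (ιℕ (suc m) + ιℕ (suc n))         ≈⟨ -‿+-comm _ _ ⟨
    - ιℕ (suc m) + - ιℕ (suc n)         ∎

  ι-*⁺ : ∀ m j → ι (+ m ℤ.* j) ≈ ιℕ m * ι j
  ι-*⁺ zero    j = sym (zeroˡ _)
  ι-*⁺ (suc m) j = begin
    ι (+ suc m ℤ.* j)        ≡⟨ ≡.cong ι (ℤₚ.suc-* (+ m) j) ⟩
    ι (j ℤ.+ + m ℤ.* j)      ≈⟨ ι-+ j (+ m ℤ.* j) ⟩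
    ι j + ι (+ m ℤ.* j)      ≈⟨ +-cong (sym (*-identityˡ _)) (ι-*⁺ m j) ⟩
    1# * ι j + ιℕ m * ι j    ≈⟨ distribʳ _ _ _ ⟨
    (1# + ιℕ m) * ι j        ∎

  ι-* : ∀ i j → ι (i ℤ.* j) ≈ ι i * ι j
  ι-* (+ m) j = ι-*⁺ m j
  ι-* -[1+ m ] j = begin
    ι (-[1+ m ] ℤ.* j)          ≡⟨ ≡.cong ι (ℤₚ.neg-distribˡ-* (+ suc m) j) ⟨
    ι (ℤ.- (+ suc m ℤ.* j))     ≈⟨ ι-neg (+ suc m ℤ.* j) ⟩
    - ι (+ suc m ℤ.* j)         ≈⟨ -‿cong (ι-*⁺ (suc m) j) ⟩
    - (ιℕ (suc m) * ι j)        ≈⟨ -‿distribˡ-* _ _ ⟩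
    - ιℕ (suc m) * ι j          ∎

  ι-1 : ι (+ 1) ≈ 1#
  ι-1 = +-identityʳ 1#

  ι-morphism : CommutativeRing.rawRing ℤₚ.+-*-commutativeRing -Raw-AlmostCommutative⟶ fromCommutativeRing R
  ι-morphism = record
    { ⟦_⟧ = ι ; +-homo = ι-+ ; *-homo = ι-* ; -‿homo = ι-neg ; 0-homo = refl ; 1-homo = ι-1 }

  -- The ring solver compares its coefficients in ℤ, so no decision procedure for `_≈_` is required.
  ι-≟ : ∀ i j → Maybe (ι i ≈ ι j)
  ι-≟ i j with i ℤ.≟ j
  ... | yes ≡.refl = just refl
  ... | no  _      = nothing

  module Solver = Algebra.Solver.Ring (CommutativeRing.rawRing ℤₚ.+-*-commutativeRing) (fromCommutativeRing R) ι-morphism ι-≟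
  open Solver using (solve; con; _:=_; _:+_; _:*_; _:-_; :-_) public

  x-y≈0⇒x≈y : ∀ {x y} → x - y ≈ 0# → x ≈ y
  x-y≈0⇒x≈y {x} {y} h = begin
    x            ≈⟨ solve 2 (λ x y → x := (x :- y) :+ y) refl x y ⟩
    (x - y) + y  ≈⟨ +-congʳ h ⟩
    0# + y       ≈⟨ +-identityˡ y ⟩
    y            ∎

  ι-injective : ¬ (1# ≈ 0#) → CharZero → ∀ {i j} → ι i ≈ ι j → i ≡ j
  ι-injective 1≉0 char0 {i} {j} h = ℤₚ.i-j≡0⇒i≡j i j (ι≈0 (i ℤ.- j) (begin
    ι (i ℤ.- j)      ≈⟨ ι-+ i (ℤ.- j) ⟩
    ι i + ι (ℤ.- j)  ≈⟨ +-cong h (ι-neg j) ⟩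
    ι j - ι j        ≈⟨ -‿inverseʳ _ ⟩
    0#               ∎))
    where
    ι≈0 : ∀ i → ι i ≈ 0# → i ≡ + 0
    ι≈0 (+ zero)  h = ≡.refl
    ι≈0 (+ suc n) h = ⊥-elim (char0 n h)
    ι≈0 -[1+ n ]  h = ⊥-elim (char0 n (trans (sym (-‿involutive _)) (trans (-‿cong h) -0#≈0#)))

  -- Indices are bounded naturals instead of elements of `Fin n`: vectors and matrices become total
  -- functions, and no index has to be transported along an equation between sizes.
  sumN prodN : ℕ → (ℕ → Carrier) → Carrier
  sumN zero    f = 0#
  sumN (suc n) f = f 0 + sumN n (λ k → f (suc k))
  prodN zero    f = 1#
  prodN (suc n) f = f 0 * prodN n (λ k → f (suc k))

  sumN-cong : ∀ n {f g} → (∀ k → k < n → f k ≈ g k) → sumN n f ≈ sumN n g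
  sumN-cong zero    h = refl
  sumN-cong (suc n) h = +-cong (h 0 (s≤s z≤n)) (sumN-cong n λ k k<n → h (suc k) (s≤s k<n))

  prodN-cong : ∀ n {f g} → (∀ k → k < n → f k ≈ g k) → prodN n f ≈ prodN n g
  prodN-cong zero    h = refl
  prodN-cong (suc n) h = *-cong (h 0 (s≤s z≤n)) (prodN-cong n λ k k<n → h (suc k) (s≤s k<n))

  sumN-last : ∀ n f → sumN (suc n) f ≈ sumN n f + f n
  sumN-last zero    f = +-comm _ _
  sumN-last (suc n) f = trans (+-congˡ (sumN-last n (λ k → f (suc k)))) (sym (+-assoc _ _ _))

  prodN-last : ∀ n f → prodN (suc n) f ≈ prodN n f * f n
  prodN-last zero    f = *-comm _ _
  prodN-last (suc n) f = trans (*-congˡ (prodN-last n (λ k → f (suc k)))) (sym (*-assoc _ _ _))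

  sumN-0 : ∀ n {f} → (∀ k → k < n → f k ≈ 0#) → sumN n f ≈ 0#
  sumN-0 zero    h = refl
  sumN-0 (suc n) h = trans (+-cong (h 0 (s≤s z≤n)) (sumN-0 n λ k k<n → h (suc k) (s≤s k<n))) (+-identityˡ _)

  sumN-+ : ∀ n f g → sumN n (λ k → f k + g k) ≈ sumN n f + sumN n g
  sumN-+ zero    f g = sym (+-identityˡ _)
  sumN-+ (suc n) f g = trans (+-congˡ (sumN-+ n _ _))
    (solve 4 (λ a b c d → (a :+ b) :+ (c :+ d) := (a :+ c) :+ (b :+ d)) refl _ _ _ _)

  sumN-*ˡ : ∀ n c f → sumN n (λ k → c * f k) ≈ c * sumN n f
  sumN-*ˡ zero    c f = sym (zeroʳ c)
  sumN-*ˡ (suc n) c f = trans (+-congˡ (sumN-*ˡ n c _)) (sym (distribˡ _ _ _))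

  sumN-neg : ∀ n f → sumN n (λ k → - f k) ≈ - sumN n f
  sumN-neg zero    f = sym -0#≈0#
  sumN-neg (suc n) f = trans (+-congˡ (sumN-neg n _)) (-‿+-comm _ _)

  sumN-comm : ∀ m n (f : ℕ → ℕ → Carrier) → sumN m (λ i → sumN n (f i)) ≈ sumN n (λ j → sumN m (λ i → f i j))
  sumN-comm zero    n f = sym (sumN-0 n λ _ _ → refl)
  sumN-comm (suc m) n f = trans (+-congˡ (sumN-comm m n (λ i → f (suc i)))) (sym (sumN-+ n _ _))

  δ : ℕ → ℕ → Carrier
  δ zero    zero    = 1#
  δ zero    (suc _) = 0#
  δ (suc _) zero    = 0#
  δ (suc i) (suc j) = δ i j

  δ-≡ : ∀ i → δ i i ≈ 1#
  δ-≡ zero    = refl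
  δ-≡ (suc i) = δ-≡ i

  δ-≢ : ∀ {i j} → i ≢ j → δ i j ≈ 0#
  δ-≢ {zero}  {zero}  h = ⊥-elim (h ≡.refl)
  δ-≢ {zero}  {suc j} h = refl
  δ-≢ {suc i} {zero}  h = refl
  δ-≢ {suc i} {suc j} h = δ-≢ (λ e → h (≡.cong suc e))

  δ-sym : ∀ i j → δ i j ≈ δ j i
  δ-sym zero    zero    = refl
  δ-sym zero    (suc j) = refl
  δ-sym (suc i) zero    = refl
  δ-sym (suc i) (suc j) = δ-sym i j

  sumN-δ : ∀ n i (f : ℕ → Carrier) → i < n → sumN n (λ k → δ i k * f k) ≈ f i
  sumN-δ (suc n) zero    f _         = trans (+-cong (*-identityˡ _) (sumN-0 n λ _ _ → zeroˡ _)) (+-identityʳ _)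
  sumN-δ (suc n) (suc i) f (s≤s i<n) = trans (+-cong (zeroˡ _) (sumN-δ n i (λ k → f (suc k)) i<n)) (+-identityˡ _)

module ℤΣ = IntegerScalars ℤₚ.+-*-commutativeRing

module ScalarMaps (R : CommutativeRing 0ℓ 0ℓ) where
  open IntegerScalars R

  ι-sumN : ∀ n f → ι (ℤΣ.sumN n f) ≈ sumN n (λ k → ι (f k))
  ι-sumN zero    f = refl
  ι-sumN (suc n) f = trans (ι-+ (f 0) _) (+-congˡ (ι-sumN n _))

  ι-δ : ∀ i j → ι (ℤΣ.δ i j) ≈ δ i j
  ι-δ zero    zero    = ι-1
  ι-δ zero    (suc j) = refl
  ι-δ (suc i) zero    = refl
  ι-δ (suc i) (suc j) = ι-δ i j

-- Exterior powers and determinants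

-- The exterior algebra of R^n in coordinates: S is the indicator of a subset of the basis, and wedge n v is exterior multiplication by v on the left.
module ExteriorAlgebra (R : CommutativeRing 0ℓ 0ℓ) where
  open IntegerScalars R
  open Relation.Binary.Reasoning.Setoid setoid

  Λ : ℕ → Set
  Λ n = Vec Bool n → Carrier

  unit : ∀ n → Λ n
  unit zero    []          = 1#
  unit (suc n) (false ∷ S) = unit n S
  unit (suc n) (true ∷ S)  = 0#

  -- With ω = ω₀ + e₀ ∧ ω₁ and v = v₀ e₀ + v′, the product is v′ ∧ ω₀ + e₀ ∧ (v₀ ω₀ - v′ ∧ ω₁); the
  -- sign comes from moving e₀ past v′.
  wedge : ∀ n → (ℕ → Carrier) → Λ n → Λ n
  wedge zero    v ω []          = 0#
  wedge (suc n) v ω (false ∷ S) = wedge n (λ k → v (suc k)) (λ S → ω (false ∷ S)) S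
  wedge (suc n) v ω (true ∷ S)  = v 0 * ω (false ∷ S) - wedge n (λ k → v (suc k)) (λ S → ω (true ∷ S)) S

  wedge-cong : ∀ n {u v ω ω′} → (∀ k → k < n → u k ≈ v k) → (∀ S → ω S ≈ ω′ S) →
               ∀ S → wedge n u ω S ≈ wedge n v ω′ S
  wedge-cong zero    h g []          = refl
  wedge-cong (suc n) h g (false ∷ S) = wedge-cong n (λ k k<n → h (suc k) (s≤s k<n)) (λ S → g (false ∷ S)) S
  wedge-cong (suc n) h g (true ∷ S)  = +-cong (*-cong (h 0 (s≤s z≤n)) (g (false ∷ S)))
    (-‿cong (wedge-cong n (λ k k<n → h (suc k) (s≤s k<n)) (λ S → g (true ∷ S)) S))

  wedge-congʳ : ∀ n v {ω ω′} → (∀ S → ω S ≈ ω′ S) → ∀ S → wedge n v ω S ≈ wedge n v ω′ S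
  wedge-congʳ n v = wedge-cong n (λ _ _ → refl)

  wedge-0ˡ : ∀ n {v} ω → (∀ k → k < n → v k ≈ 0#) → ∀ S → wedge n v ω S ≈ 0#
  wedge-0ˡ zero    ω h []          = refl
  wedge-0ˡ (suc n) ω h (false ∷ S) = wedge-0ˡ n _ (λ k k<n → h (suc k) (s≤s k<n)) S
  wedge-0ˡ (suc n) ω h (true ∷ S)  = trans
    (+-cong (trans (*-congʳ (h 0 (s≤s z≤n))) (zeroˡ _)) (-‿cong (wedge-0ˡ n _ (λ k k<n → h (suc k) (s≤s k<n)) S)))
    (-‿inverseʳ 0#)

  wedge-0ʳ : ∀ n v {ω} → (∀ S → ω S ≈ 0#) → ∀ S → wedge n v ω S ≈ 0#
  wedge-0ʳ zero    v h []          = refl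
  wedge-0ʳ (suc n) v h (false ∷ S) = wedge-0ʳ n _ (λ S → h (false ∷ S)) S
  wedge-0ʳ (suc n) v h (true ∷ S)  = trans
    (+-cong (trans (*-congˡ (h (false ∷ S))) (zeroʳ _)) (-‿cong (wedge-0ʳ n _ (λ S → h (true ∷ S)) S)))
    (-‿inverseʳ 0#)

  wedge-+ʳ : ∀ n v ω ω′ S → wedge n v (λ S → ω S + ω′ S) S ≈ wedge n v ω S + wedge n v ω′ S
  wedge-+ʳ zero    v ω ω′ []          = sym (+-identityˡ _)
  wedge-+ʳ (suc n) v ω ω′ (false ∷ S) = wedge-+ʳ n _ _ _ S
  wedge-+ʳ (suc n) v ω ω′ (true ∷ S)  = trans
    (+-congˡ (-‿cong (wedge-+ʳ n _ _ _ S)))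
    (solve 5 (λ v a b x y → v :* (a :+ b) :- (x :+ y) := (v :* a :- x) :+ (v :* b :- y)) refl _ _ _ _ _)

  wedge-*ʳ : ∀ n v c ω S → wedge n v (λ S → c * ω S) S ≈ c * wedge n v ω S
  wedge-*ʳ zero    v c ω []          = sym (zeroʳ c)
  wedge-*ʳ (suc n) v c ω (false ∷ S) = wedge-*ʳ n _ c _ S
  wedge-*ʳ (suc n) v c ω (true ∷ S)  = trans
    (+-congˡ (-‿cong (wedge-*ʳ n _ c _ S)))
    (solve 4 (λ v c a x → v :* (c :* a) :- c :* x := c :* (v :* a :- x)) refl _ _ _ _)

  wedge-negʳ : ∀ n v ω S → wedge n v (λ S → - ω S) S ≈ - wedge n v ω S
  wedge-negʳ zero    v ω []          = sym -0#≈0#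
  wedge-negʳ (suc n) v ω (false ∷ S) = wedge-negʳ n _ _ S
  wedge-negʳ (suc n) v ω (true ∷ S)  = trans
    (+-congˡ (-‿cong (wedge-negʳ n _ _ S)))
    (solve 3 (λ v a x → v :* (:- a) :- (:- x) := :- (v :* a :- x)) refl _ _ _)

  wedge-*-ʳ : ∀ n v c ω ω′ S → wedge n v (λ S → c * ω S - ω′ S) S ≈ c * wedge n v ω S - wedge n v ω′ S
  wedge-*-ʳ n v c ω ω′ S = trans (wedge-+ʳ n v (λ S → c * ω S) (λ S → - ω′ S) S)
    (+-cong (wedge-*ʳ n v c ω S) (wedge-negʳ n v ω′ S))

  wedge-*+ˡ : ∀ n c u v ω S → wedge n (λ k → c * u k + v k) ω S ≈ c * wedge n u ω S + wedge n v ω S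
  wedge-*+ˡ zero    c u v ω []          = sym (trans (+-congʳ (zeroʳ c)) (+-identityˡ _))
  wedge-*+ˡ (suc n) c u v ω (false ∷ S) = wedge-*+ˡ n c _ _ _ S
  wedge-*+ˡ (suc n) c u v ω (true ∷ S)  = trans
    (+-congˡ (-‿cong (wedge-*+ˡ n c _ _ _ S)))
    (solve 6 (λ c u v a x y → (c :* u :+ v) :* a :- (c :* x :+ y) := c :* (u :* a :- x) :+ (v :* a :- y)) refl _ _ _ _ _ _)

  -- Needs its own induction: anticommutativity only gives twice this, and 2 may be a zero divisor
  -- in R.
  wedge-self : ∀ n v ω S → wedge n v (wedge n v ω) S ≈ 0#
  wedge-self zero    v ω []          = refl
  wedge-self (suc n) v ω (false ∷ S) = wedge-self n _ _ S
  wedge-self (suc n) v ω (true ∷ S)  = begin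
    v 0 * wedge n v′ ω₀ S - wedge n v′ (λ S → v 0 * ω₀ S - wedge n v′ ω₁ S) S
      ≈⟨ +-congˡ (-‿cong (wedge-*-ʳ n v′ (v 0) ω₀ (wedge n v′ ω₁) S)) ⟩
    v 0 * wedge n v′ ω₀ S - (v 0 * wedge n v′ ω₀ S - wedge n v′ (wedge n v′ ω₁) S)
      ≈⟨ +-congˡ (-‿cong (+-congˡ (-‿cong (wedge-self n v′ ω₁ S)))) ⟩
    v 0 * wedge n v′ ω₀ S - (v 0 * wedge n v′ ω₀ S - 0#)
      ≈⟨ solve 1 (λ x → x :- (x :- con (ℤ.+ 0)) := con (ℤ.+ 0)) refl _ ⟩
    0# ∎
    where
    v′ = λ k → v (suc k)
    ω₀ = λ S → ω (false ∷ S)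
    ω₁ = λ S → ω (true ∷ S)

  wedge-anticomm : ∀ n u v ω S → wedge n u (wedge n v ω) S ≈ - wedge n v (wedge n u ω) S
  wedge-anticomm zero    u v ω []          = sym -0#≈0#
  wedge-anticomm (suc n) u v ω (false ∷ S) = wedge-anticomm n _ _ _ S
  wedge-anticomm (suc n) u v ω (true ∷ S)  = begin
    u 0 * wedge n v′ ω₀ S - wedge n u′ (λ S → v 0 * ω₀ S - wedge n v′ ω₁ S) S
      ≈⟨ +-congˡ (-‿cong (wedge-*-ʳ n u′ (v 0) ω₀ (wedge n v′ ω₁) S)) ⟩
    u 0 * wedge n v′ ω₀ S - (v 0 * wedge n u′ ω₀ S - wedge n u′ (wedge n v′ ω₁) S)
      ≈⟨ +-congˡ (-‿cong (+-congˡ (-‿cong (wedge-anticomm n u′ v′ ω₁ S)))) ⟩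
    u 0 * wedge n v′ ω₀ S - (v 0 * wedge n u′ ω₀ S - - wedge n v′ (wedge n u′ ω₁) S)
      ≈⟨ solve 3 (λ a b c → a :- (b :- :- c) := :- (b :- (a :- c))) refl _ _ _ ⟩
    - (v 0 * wedge n u′ ω₀ S - (u 0 * wedge n v′ ω₀ S - wedge n v′ (wedge n u′ ω₁) S))
      ≈⟨ -‿cong (+-congˡ (-‿cong (wedge-*-ʳ n v′ (u 0) ω₀ (wedge n u′ ω₁) S))) ⟨
    - (v 0 * wedge n u′ ω₀ S - wedge n v′ (λ S → u 0 * ω₀ S - wedge n u′ ω₁ S) S) ∎
    where
    u′ = λ k → u (suc k)
    v′ = λ k → v (suc k)
    ω₀ = λ S → ω (false ∷ S)
    ω₁ = λ S → ω (true ∷ S)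

  vol : ∀ n → ℕ → (ℕ → ℕ → Carrier) → Λ n
  vol n zero    M = unit n
  vol n (suc m) M = wedge n (M 0) (vol n m (λ i → M (suc i)))

  -- The wedge of the rows read off at the full set of basis vectors, so no sum over permutations
  -- appears.
  det : ∀ n → (ℕ → ℕ → Carrier) → Carrier
  det n M = vol n n M (replicate n true)

  vol-cong : ∀ n m {M N} → (∀ i j → i < m → j < n → M i j ≈ N i j) → ∀ S → vol n m M S ≈ vol n m N S
  vol-cong n zero    h S = refl
  vol-cong n (suc m) h S = wedge-cong n (λ k → h 0 k (s≤s z≤n))
    (vol-cong n m (λ i j i<m → h (suc i) j (s≤s i<m))) S

  det-cong : ∀ n {M N} → (∀ i j → i < n → j < n → M i j ≈ N i j) → det n M ≈ det n N
  det-cong n h = vol-cong n n h _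

  card : ∀ {n} → Vec Bool n → ℕ
  card []          = 0
  card (true ∷ S)  = suc (card S)
  card (false ∷ S) = card S

  card≤ : ∀ {n} (S : Vec Bool n) → card S ≤ n
  card≤ []          = z≤n
  card≤ (true ∷ S)  = s≤s (card≤ S)
  card≤ (false ∷ S) = ℕₚ.m≤n⇒m≤1+n (card≤ S)

  Homogeneous : ∀ n → ℕ → Λ n → Set
  Homogeneous n k ω = ∀ S → card S ≢ k → ω S ≈ 0#

  unit-homogeneous : ∀ n → Homogeneous n 0 (unit n)
  unit-homogeneous zero    []          h = ⊥-elim (h ≡.refl)
  unit-homogeneous (suc n) (true ∷ S)  h = refl
  unit-homogeneous (suc n) (false ∷ S) h = unit-homogeneous n S h

  wedge-homogeneous : ∀ n k v ω → Homogeneous n k ω → Homogeneous n (suc k) (wedge n v ω)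
  wedge-homogeneous zero    k v ω h []          g = refl
  wedge-homogeneous (suc n) k v ω h (false ∷ S) g = wedge-homogeneous n k _ _ (λ S → h (false ∷ S)) S g
  wedge-homogeneous (suc n) k v ω h (true ∷ S)  g = trans
    (+-cong (trans (*-congˡ (h (false ∷ S) (λ e → g (≡.cong suc e)))) (zeroʳ _)) (-‿cong (tail k h g)))
    (-‿inverseʳ 0#)
    where
    tail : ∀ k → Homogeneous (suc n) k ω → suc (card S) ≢ suc k →
           wedge n (λ i → v (suc i)) (λ S → ω (true ∷ S)) S ≈ 0#
    tail zero    h g = wedge-0ʳ n _ (λ S → h (true ∷ S) (λ ())) S
    tail (suc k) h g = wedge-homogeneous n k _ _ (λ S ne → h (true ∷ S) (λ e → ne (ℕₚ.suc-injective e))) S (λ e → g (≡.cong suc e))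

  vol-homogeneous : ∀ n m M → Homogeneous n m (vol n m M)
  vol-homogeneous n zero    M = unit-homogeneous n
  vol-homogeneous n (suc m) M = wedge-homogeneous n m _ _ (vol-homogeneous n m _)

  -- The homomorphism of exterior algebras that sends the basis vector e_i to row i of `N`, computed
  -- along ω = ω₀ + e₀ ∧ ω₁.
  Λmap : ∀ m n → (ℕ → ℕ → Carrier) → Λ m → Λ n
  Λmap zero    n N ω S = ω [] * unit n S
  Λmap (suc m) n N ω S = Λmap m n (λ i → N (suc i)) (λ S → ω (false ∷ S)) S
                       + wedge n (N 0) (Λmap m n (λ i → N (suc i)) (λ S → ω (true ∷ S))) S

  Λmap-0 : ∀ m n N {ω} → (∀ S → ω S ≈ 0#) → ∀ S → Λmap m n N ω S ≈ 0#
  Λmap-0 zero    n N h S = trans (*-congʳ (h [])) (zeroˡ _)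
  Λmap-0 (suc m) n N h S = trans (+-cong (Λmap-0 m n _ (λ S → h (false ∷ S)) S)
    (wedge-0ʳ n (N 0) (Λmap-0 m n _ (λ S → h (true ∷ S))) S)) (+-identityˡ _)

  Λmap-*- : ∀ m n N c ω ω′ S → Λmap m n N (λ S → c * ω S - ω′ S) S ≈ c * Λmap m n N ω S - Λmap m n N ω′ S
  Λmap-*- zero    n N c ω ω′ S =
    solve 4 (λ c a b u → (c :* a :- b) :* u := c :* (a :* u) :- b :* u) refl _ _ _ _
  Λmap-*- (suc m) n N c ω ω′ S = trans
    (+-cong (Λmap-*- m n _ c _ _ S) (trans (wedge-congʳ n (N 0) (Λmap-*- m n _ c _ _) S) (wedge-*-ʳ n (N 0) c _ _ S)))
    (solve 5 (λ c a b x y → (c :* a :- b) :+ (c :* x :- y) := c :* (a :+ x) :- (b :+ y)) refl _ _ _ _ _)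

  Λmap-wedge : ∀ m n N v ω S →
    Λmap m n N (wedge m v ω) S ≈ wedge n (λ j → sumN m (λ k → v k * N k j)) (Λmap m n N ω) S
  Λmap-wedge zero    n N v ω S = trans (zeroˡ _) (sym (wedge-0ˡ n _ (λ _ _ → refl) S))
  Λmap-wedge (suc m) n N v ω S = begin
    Λmap m n N′ (wedge m v′ ω₀) S + wedge n r (Λmap m n N′ (λ S → v 0 * ω₀ S - wedge m v′ ω₁ S)) S
      ≈⟨ +-cong (Λmap-wedge m n N′ v′ ω₀ S) (wedge-congʳ n r
           (λ S → trans (Λmap-*- m n N′ (v 0) ω₀ (wedge m v′ ω₁) S) (+-congˡ (-‿cong (Λmap-wedge m n N′ v′ ω₁ S)))) S) ⟩
    wedge n w A S + wedge n r (λ S → v 0 * A S - wedge n w B S) S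
      ≈⟨ +-congˡ (wedge-*-ʳ n r (v 0) A (wedge n w B) S) ⟩
    wedge n w A S + (v 0 * wedge n r A S - wedge n r (wedge n w B) S)
      ≈⟨ +-congˡ (+-congˡ (-‿cong (wedge-anticomm n r w B S))) ⟩
    wedge n w A S + (v 0 * wedge n r A S - - wedge n w (wedge n r B) S)
      -- The inserted `0#` stands for r ∧ r ∧ B; once it is present, `r` and `w` are both wedged
      -- with the same form `A+rB`.
      ≈⟨ solve 4 (λ a v b c → a :+ (v :* b :- :- c) := v :* (b :+ con (ℤ.+ 0)) :+ (a :+ c)) refl _ _ _ _ ⟩
    v 0 * (wedge n r A S + 0#) + (wedge n w A S + wedge n w (wedge n r B) S)
      ≈⟨ +-congʳ (*-congˡ (+-congˡ (wedge-self n r B S))) ⟨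
    v 0 * (wedge n r A S + wedge n r (wedge n r B) S) + (wedge n w A S + wedge n w (wedge n r B) S)
      ≈⟨ +-cong (*-congˡ (wedge-+ʳ n r A (wedge n r B) S)) (wedge-+ʳ n w A (wedge n r B) S) ⟨
    v 0 * wedge n r A+rB S + wedge n w A+rB S
      ≈⟨ wedge-*+ˡ n (v 0) r w A+rB S ⟨
    wedge n (λ j → v 0 * r j + w j) A+rB S ∎
    where
    r = N 0
    N′ = λ i → N (suc i)
    v′ = λ k → v (suc k)
    ω₀ = λ S → ω (false ∷ S)
    ω₁ = λ S → ω (true ∷ S)
    w = λ j → sumN m (λ k → v′ k * N′ k j)
    A = Λmap m n N′ ω₀
    B = Λmap m n N′ ω₁
    A+rB = λ S → A S + wedge n r B S

  Λmap-unit : ∀ m n N S → Λmap m n N (unit m) S ≈ unit n S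
  Λmap-unit zero    n N S = *-identityˡ _
  Λmap-unit (suc m) n N S = trans
    (+-cong (Λmap-unit m n _ S) (wedge-0ʳ n (N 0) (Λmap-0 m n _ (λ _ → refl)) S)) (+-identityʳ _)

  Λmap-vol : ∀ n l m M N S →
    vol n m (λ i j → sumN l (λ k → M i k * N k j)) S ≈ Λmap l n N (vol l m M) S
  Λmap-vol n l zero    M N S = sym (Λmap-unit l n N S)
  Λmap-vol n l (suc m) M N S = trans
    (wedge-congʳ n _ (Λmap-vol n l m (λ i → M (suc i)) N) S)
    (sym (Λmap-wedge l n N (M 0) (vol l m (λ i → M (suc i))) S))

  -- A form of top degree is a multiple of the wedge of all basis vectors, whose image is the volume
  -- form of the rows of `N`. For ω the volume form of a square matrix the multiple is its
  -- determinant, which gives `det-*`.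
  Λmap-top : ∀ m n N ω → Homogeneous m m ω → ∀ S → Λmap m n N ω S ≈ ω (replicate m true) * vol n m N S
  Λmap-top zero    n N ω h S = refl
  Λmap-top (suc m) n N ω h S = trans
    (+-cong
      (Λmap-0 m n _ (λ S → h (false ∷ S) (λ e → ℕₚ.<-irrefl e (s≤s (card≤ S)))) S)
      (trans
        (wedge-congʳ n (N 0) (Λmap-top m n _ _ (λ S ne → h (true ∷ S) (λ e → ne (ℕₚ.suc-injective e)))) S)
        (wedge-*ʳ n (N 0) _ _ S)))
    (+-identityˡ _)

  det-* : ∀ n M N → det n (λ i j → sumN n (λ k → M i k * N k j)) ≈ det n M * det n N
  det-* n M N = trans (Λmap-vol n n n M N _) (Λmap-top n n N (vol n n M) (vol-homogeneous n n M) _)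

  vol-false : ∀ n m M S → vol (suc n) m M (false ∷ S) ≈ vol n m (λ i j → M i (suc j)) S
  vol-false n zero    M S = refl
  vol-false n (suc m) M S = wedge-congʳ n _ (vol-false n m (λ i → M (suc i))) S

  vol-true : ∀ n m M → (∀ i → i < m → M i 0 ≈ 0#) → ∀ S → vol (suc n) m M (true ∷ S) ≈ 0#
  vol-true n zero    M h S = refl
  vol-true n (suc m) M h S = trans
    (+-cong (trans (*-congʳ (h 0 (s≤s z≤n))) (zeroˡ _))
            (-‿cong (wedge-0ʳ n _ (vol-true n m (λ i → M (suc i)) (λ i i<m → h (suc i) (s≤s i<m))) S)))
    (-‿inverseʳ 0#)

  a-0≈a : ∀ {a b} → b ≈ 0# → a - b ≈ a
  a-0≈a h = trans (+-congˡ (trans (-‿cong h) -0#≈0#)) (+-identityʳ _)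

  det-upper-suc : ∀ n M → (∀ i → i < n → M (suc i) 0 ≈ 0#) →
    det (suc n) M ≈ M 0 0 * det n (λ i j → M (suc i) (suc j))
  det-upper-suc n M h = trans
    (a-0≈a (wedge-0ʳ n _ (vol-true n n (λ i → M (suc i)) h) _))
    (*-congˡ (vol-false n n (λ i → M (suc i)) _))

  det-upper : ∀ n M → (∀ i j → i < n → j < i → M i j ≈ 0#) → det n M ≈ prodN n (λ i → M i i)
  det-upper zero    M h = refl
  det-upper (suc n) M h = trans (det-upper-suc n M (λ i i<n → h (suc i) 0 (s≤s i<n) (s≤s z≤n)))
    (*-congˡ (det-upper n _ (λ i j i<n j<i → h (suc i) (suc j) (s≤s i<n) (s≤s j<i))))

  det-lower : ∀ n M → (∀ i j → i < j → j < n → M i j ≈ 0#) → det n M ≈ prodN n (λ i → M i i)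
  det-lower zero    M h = refl
  det-lower (suc n) M h = trans
    (a-0≈a (wedge-0ˡ n _ (λ k k<n → h 0 (suc k) (s≤s z≤n) (s≤s k<n)) _))
    (*-congˡ (trans (vol-false n n (λ i → M (suc i)) _)
      (det-lower n _ (λ i j i<j j<n → h (suc i) (suc j) (s≤s i<j) (s≤s j<n)))))

-- Companion matrices and the Newton basis

-- Coefficients, in increasing degree, of the monic polynomial x^d + Σ cs_i x^i.
monic : ∀ d → (Fin d → ℤ) → ℕ → ℤ
monic zero    cs zero    = + 1
monic zero    cs (suc _) = + 0
monic (suc d) cs zero    = cs Fin.zero
monic (suc d) cs (suc j) = monic d (λ i → cs (Fin.suc i)) j

-- Row i holds the coordinates of x · x^i in the basis 1, x, ..., x^(d-1) of ℤ[x]/(f).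
companion : ℕ → (ℕ → ℤ) → ℕ → ℕ → ℤ
companion d c i j with suc i ℕ.≟ d
... | yes _ = ℤ.- c j
... | no  _ = ℤΣ.δ (suc i) j

companion^ : ℕ → (ℕ → ℤ) → ℕ → ℕ → ℕ → ℤ
companion^ d c zero    i j = ℤΣ.δ i j
companion^ d c (suc n) i j = ℤΣ.sumN d (λ k → companion d c i k ℤ.* companion^ d c n k j)

companion^-1 : ℕ → (ℕ → ℤ) → ℕ → ℕ → ℕ → ℤ
companion^-1 d c n i j = companion^ d c n i j ℤ.- ℤΣ.δ i j

module Polynomials (R : CommutativeRing 0ℓ 0ℓ) where
  open IntegerScalars R
  open ScalarMaps R
  open Relation.Binary.Reasoning.Setoid setoid

  ev : ℕ → (ℕ → Carrier) → Carrier → Carrier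
  ev zero    c x = 0#
  ev (suc n) c x = c 0 + x * ev n (λ j → c (suc j)) x

  ev-0 : ∀ n c x → (∀ j → j < n → c j ≈ 0#) → ev n c x ≈ 0#
  ev-0 zero    c x h = refl
  ev-0 (suc n) c x h = trans
    (+-cong (h 0 (s≤s z≤n)) (trans (*-congˡ (ev-0 n _ x (λ j j<n → h (suc j) (s≤s j<n)))) (zeroʳ x)))
    (+-identityˡ _)

  ev-lin : ∀ n a b c x → ev n (λ j → a j - c * b j) x ≈ ev n a x - c * ev n b x
  ev-lin zero    a b c x = solve 1 (λ c → con (+ 0) := con (+ 0) :- c :* con (+ 0)) refl c
  ev-lin (suc n) a b c x = trans (+-congˡ (*-congˡ (ev-lin n _ _ c x)))
    (solve 6 (λ a b c x y z → (a :- c :* b) :+ x :* (y :- c :* z) := (a :+ x :* y) :- c :* (b :+ x :* z)) refl _ _ _ _ _ _)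

  -- Synthetic division by x - r.
  quot : ℕ → (ℕ → Carrier) → Carrier → ℕ → Carrier
  quot zero    c r _       = 0#
  quot (suc n) c r zero    = ev (suc n) (λ j → c (suc j)) r
  quot (suc n) c r (suc j) = quot n (λ j → c (suc j)) r j

  ev-quot : ∀ n c r x → ev (suc n) c x - ev (suc n) c r ≈ (x - r) * ev n (quot n c r) x
  ev-quot zero    c r x = solve 3 (λ c x r → (c :+ x :* con (+ 0)) :- (c :+ r :* con (+ 0)) := (x :- r) :* con (+ 0)) refl _ _ _
  ev-quot (suc n) c r x = begin
    (c 0 + x * E x) - (c 0 + r * E r)
      ≈⟨ solve 5 (λ c x e r f → (c :+ x :* e) :- (c :+ r :* f) := (x :- r) :* f :+ x :* (e :- f)) refl _ _ _ _ _ ⟩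
    (x - r) * E r + x * (E x - E r)
      ≈⟨ +-congˡ (*-congˡ (ev-quot n (λ j → c (suc j)) r x)) ⟩
    (x - r) * E r + x * ((x - r) * Q)
      ≈⟨ solve 4 (λ x r f q → (x :- r) :* f :+ x :* ((x :- r) :* q) := (x :- r) :* (f :+ x :* q)) refl _ _ _ _ ⟩
    (x - r) * (E r + x * Q) ∎
    where
    E = ev (suc n) (λ j → c (suc j))
    Q = ev n (quot n (λ j → c (suc j)) r) x

  -- The coefficients of the quotient are unitriangular in the tail of `c`: q_j = c_(j+1) + r
  -- c_(j+2) + ..., solved from the top degree downwards.
  quot≈0⇒tail≈0 : ∀ n c r → (∀ j → j < n → quot n c r j ≈ 0#) → ∀ j → j < n → c (suc j) ≈ 0#
  quot≈0⇒tail≈0 (suc n) c r h j j<n = go j j<n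
    where
    ih : ∀ j → j < n → c (suc (suc j)) ≈ 0#
    ih = quot≈0⇒tail≈0 n (λ j → c (suc j)) r (λ j j<n → h (suc j) (s≤s j<n))
    go : ∀ j → j < suc n → c (suc j) ≈ 0#
    go zero    _         = begin
      c 1                                  ≈⟨ +-identityʳ _ ⟨
      c 1 + 0#                             ≈⟨ +-congˡ (trans (*-congˡ (ev-0 n _ r ih)) (zeroʳ r)) ⟨
      c 1 + r * ev n (λ j → c (suc (suc j))) r ≈⟨ h 0 (s≤s z≤n) ⟩
      0# ∎
    go (suc j) (s≤s j<n) = ih j j<n

  module _ (dom : IsIntegralDomain) (char0 : CharZero) where

    ι-cancel : ∀ N k x → (ιℕ (suc k ℕ.+ N) - ιℕ N) * x ≈ 0# → x ≈ 0#
    ι-cancel N k x h with proj₂ dom _ x h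
    ... | inj₂ e = e
    ... | inj₁ e = ⊥-elim (char0 k (begin
      ιℕ (suc k)                       ≈⟨ solve 2 (λ a b → a := (a :+ b) :- b) refl _ (ιℕ N) ⟩
      (ιℕ (suc k) + ιℕ N) - ιℕ N       ≈⟨ +-congʳ (ιℕ-+ (suc k) N) ⟨
      ιℕ (suc k ℕ.+ N) - ιℕ N          ≈⟨ e ⟩
      0# ∎))

    -- Dividing by x - N leaves a quotient that vanishes at all later integers, because differences
    -- of distinct integers are nonzero in a domain of characteristic zero. The variable starting
    -- point `N` lets the hypothesis pass to the quotient.
    vanishing : ∀ n c N → (∀ k → ev n c (ιℕ (k ℕ.+ N)) ≈ 0#) → ∀ j → j < n → c j ≈ 0#
    vanishing (suc n) c N h = coeffs
      where
      r = ιℕ N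
      quot-vanishes : ∀ k → ev n (quot n c r) (ιℕ (k ℕ.+ suc N)) ≈ 0#
      quot-vanishes k rewrite ℕₚ.+-suc k N = ι-cancel N k _ (begin
        (ιℕ (suc k ℕ.+ N) - r) * ev n (quot n c r) (ιℕ (suc k ℕ.+ N)) ≈⟨ ev-quot n c r _ ⟨
        ev (suc n) c (ιℕ (suc k ℕ.+ N)) - ev (suc n) c r              ≈⟨ +-cong (h (suc k)) (-‿cong (h 0)) ⟩
        0# - 0#                                                       ≈⟨ -‿inverseʳ 0# ⟩
        0# ∎)
      tail : ∀ j → j < n → c (suc j) ≈ 0#
      tail = quot≈0⇒tail≈0 n c r (vanishing n (quot n c r) (suc N) quot-vanishes)
      coeffs : ∀ j → j < suc n → c j ≈ 0#
      coeffs zero    _         = begin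
        c 0                          ≈⟨ +-identityʳ _ ⟨
        c 0 + 0#                     ≈⟨ +-congˡ (trans (*-congˡ (ev-0 n _ r tail)) (zeroʳ r)) ⟨
        ev (suc n) c r               ≈⟨ h 0 ⟩
        0# ∎
      coeffs (suc j) (s≤s j<n) = tail j j<n

  sumF-*ˡ : ∀ d x (f : Fin d → Carrier) (g : Fin d → Carrier) →
    sumF d (λ i → f i * (x * g i)) ≈ x * sumF d (λ i → f i * g i)
  sumF-*ˡ zero    x f g = sym (zeroʳ x)
  sumF-*ˡ (suc d) x f g = trans (+-congˡ (sumF-*ˡ d x _ _))
    (solve 4 (λ f x g s → f :* (x :* g) :+ x :* s := x :* (f :* g :+ s)) refl _ _ _ _)

  ev-monic : ∀ d cs x → ev (suc d) (λ j → ι (monic d cs j)) x ≈ evalMonic d cs x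
  ev-monic zero    cs x = +-cong ι-1 (zeroʳ x)
  ev-monic (suc d) cs x = begin
    ι (cs Fin.zero) + x * ev (suc d) (λ j → ι (monic d cs′ j)) x
      ≈⟨ +-congˡ (*-congˡ (ev-monic d cs′ x)) ⟩
    ι (cs Fin.zero) + x * (pow x d + sumF d (λ i → ι (cs′ i) * pow x (Fin.toℕ i)))
      ≈⟨ solve 4 (λ a x p s → a :+ x :* (p :+ s) := x :* p :+ (a :+ x :* s)) refl _ _ _ _ ⟩
    x * pow x d + (ι (cs Fin.zero) + x * sumF d (λ i → ι (cs′ i) * pow x (Fin.toℕ i)))
      ≈⟨ +-congˡ (+-cong (*-identityʳ _) (sumF-*ˡ d x _ _)) ⟨
    x * pow x d + (ι (cs Fin.zero) * 1# + sumF d (λ i → ι (cs′ i) * (x * pow x (Fin.toℕ i)))) ∎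
    where cs′ = λ i → cs (Fin.suc i)

  extend : ∀ {d} → (Fin d → Carrier) → ℕ → Carrier
  extend {zero}  α _       = 0#
  extend {suc d} α zero    = α Fin.zero
  extend {suc d} α (suc i) = extend (λ i → α (Fin.suc i)) i

  prodF-extend : ∀ d (α : Fin d → Carrier) (h : Carrier → Carrier) →
    prodN d (λ i → h (extend α i)) ≈ prodF d (λ i → h (α i))
  prodF-extend zero    α h = refl
  prodF-extend (suc d) α h = *-congˡ (prodF-extend d (λ i → α (Fin.suc i)) h)

  shift : (ℕ → Carrier) → ℕ → Carrier
  shift u zero    = 0#
  shift u (suc j) = u j

  module Newton (α : ℕ → Carrier) where

    newton : ℕ → ℕ → Carrier
    newton zero    j = δ 0 j
    newton (suc k) j = shift (newton k) j - α k * newton k j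

    newton-above : ∀ k j → k < j → newton k j ≈ 0#
    newton-above zero    (suc j) _         = refl
    newton-above (suc k) (suc j) (s≤s k<j) = trans
      (+-cong (newton-above k j k<j)
        (-‿cong (trans (*-congˡ (newton-above k (suc j) (ℕₚ.m≤n⇒m≤1+n k<j))) (zeroʳ _))))
      (-‿inverseʳ 0#)

    newton-lead : ∀ k → newton k k ≈ 1#
    newton-lead zero    = refl
    newton-lead (suc k) = trans
      (+-cong (newton-lead k) (trans (-‿cong (trans (*-congˡ (newton-above k (suc k) ℕₚ.≤-refl)) (zeroʳ _))) -0#≈0#))
      (+-identityʳ 1#)

    ev-newton : ∀ d k x → k ≤ d → ev (suc d) (newton k) x ≈ prodN k (λ i → x - α i)
    ev-newton d zero    x _   = trans (+-congˡ (trans (*-congˡ (ev-0 d _ x (λ _ _ → refl))) (zeroʳ x))) (+-identityʳ 1#)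
    ev-newton (suc d) (suc k) x k<d@(s≤s k≤d) = begin
      ev (suc (suc d)) (newton (suc k)) x
        ≈⟨ ev-lin (suc (suc d)) (shift g) g (α k) x ⟩
      ev (suc (suc d)) (shift g) x - α k * ev (suc (suc d)) g x
        ≈⟨ +-cong (trans (+-identityˡ _) (*-congˡ (ev-newton d k x k≤d)))
                  (-‿cong (*-congˡ (ev-newton (suc d) k x (ℕₚ.m≤n⇒m≤1+n k≤d)))) ⟩
      x * Π - α k * Π              ≈⟨ solve 3 (λ x a p → x :* p :- a :* p := p :* (x :- a)) refl _ _ _ ⟩
      Π * (x - α k)                ≈⟨ prodN-last k (λ i → x - α i) ⟨
      prodN (suc k) (λ i → x - α i) ∎
      where
      g = newton k
      Π = prodN k (λ i → x - α i)

    -- The powers of the bidiagonal matrix with diagonal α and ones above it.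
    bidiag^ : ℕ → ℕ → ℕ → Carrier
    bidiag^ zero    i j = δ i j
    bidiag^ (suc n) i j = α i * bidiag^ n i j + bidiag^ n (suc i) j

    bidiag^-lower : ∀ n i j → j < i → bidiag^ n i j ≈ 0#
    bidiag^-lower zero    i j j<i = δ-≢ (λ e → ℕₚ.<-irrefl (≡.sym e) j<i)
    bidiag^-lower (suc n) i j j<i = trans
      (+-cong (trans (*-congˡ (bidiag^-lower n i j j<i)) (zeroʳ _)) (bidiag^-lower n (suc i) j (ℕₚ.m≤n⇒m≤1+n j<i)))
      (+-identityˡ _)

    bidiag^-diag : ∀ n i → bidiag^ n i i ≈ pow (α i) n
    bidiag^-diag zero    i = δ-≡ i
    bidiag^-diag (suc n) i = trans (+-cong (*-congˡ (bidiag^-diag n i)) (bidiag^-lower n (suc i) i ℕₚ.≤-refl)) (+-identityʳ _)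

    module _ (d : ℕ) (c : ℕ → ℤ) (root : ∀ j → j < suc d → newton (suc d) j ≈ ι (c j)) where
      open ExteriorAlgebra R

      C : ℕ → ℕ → Carrier
      C i j = ι (companion (suc d) c i j)

      C-last : ∀ j → C d j ≈ - ι (c j)
      C-last j with suc d ℕ.≟ suc d
      ... | yes _ = ι-neg (c j)
      ... | no ne = ⊥-elim (ne ≡.refl)

      C-init : ∀ i j → i < d → C i j ≈ δ (suc i) j
      C-init i j i<d with suc i ℕ.≟ suc d
      ... | yes e = ⊥-elim (ℕₚ.<-irrefl (ℕₚ.suc-injective e) i<d)
      ... | no _  = ι-δ (suc i) j

      sum-shift : ∀ u j → j < suc d → sumN d (λ i → u i * δ (suc i) j) ≈ shift u j
      sum-shift u zero    _         = sumN-0 d (λ _ _ → zeroʳ _)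
      sum-shift u (suc j) (s≤s j<d) = trans
        (sumN-cong d {g = λ i → δ j i * u i} (λ i _ → trans (*-comm _ _) (*-congʳ (δ-sym i j)))) (sumN-δ d j u j<d)

      -- Multiplication by x modulo f: `shift` multiplies, and the overflowing coefficient at
      -- x^(d+1) is reduced by x^(d+1) = - Σ c_j x^j.
      newton-C : ∀ k j → j < suc d →
        sumN (suc d) (λ i → newton k i * C i j) ≈ shift (newton k) j - newton k d * ι (c j)
      newton-C k j j<d = begin
        sumN (suc d) (λ i → newton k i * C i j)
          ≈⟨ sumN-last d _ ⟩
        sumN d (λ i → newton k i * C i j) + newton k d * C d j
          ≈⟨ +-cong (trans (sumN-cong d (λ i i<d → *-congˡ (C-init i j i<d))) (sum-shift (newton k) j j<d))
                    (trans (*-congˡ (C-last j)) (sym (-‿distribʳ-* _ _))) ⟩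
        shift (newton k) j - newton k d * ι (c j) ∎

      newton-C-init : ∀ k j → k < d → j < suc d →
        sumN (suc d) (λ i → newton k i * C i j) ≈ α k * newton k j + newton (suc k) j
      newton-C-init k j k<d j<d = trans (newton-C k j j<d) (begin
        shift (newton k) j - newton k d * ι (c j)
          ≈⟨ +-congˡ (-‿cong (trans (*-congʳ (newton-above k d k<d)) (zeroˡ _))) ⟩
        shift (newton k) j - 0#
          ≈⟨ solve 2 (λ s a → s :- con (+ 0) := a :+ (s :- a)) refl _ _ ⟩
        α k * newton k j + newton (suc k) j ∎)

      -- By `root` the next Newton polynomial is f itself, hence zero modulo f, so the last row of
      -- the bidiagonal matrix has only its diagonal entry.
      newton-C-last : ∀ j → j < suc d →
        sumN (suc d) (λ i → newton d i * C i j) ≈ α d * newton d j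
      newton-C-last j j<d = trans (newton-C d j j<d) (begin
        shift (newton d) j - newton d d * ι (c j)
          ≈⟨ +-congˡ (-‿cong (trans (*-cong (newton-lead d) (sym (root j j<d))) (*-identityˡ _))) ⟩
        shift (newton d) j - (shift (newton d) j - α d * newton d j)
          ≈⟨ solve 2 (λ s a → s :- (s :- a) := a) refl _ _ ⟩
        α d * newton d j ∎)

      C^ : ℕ → ℕ → ℕ → Carrier
      C^ n i j = ι (companion^ (suc d) c n i j)

      C^-suc : ∀ n i j → C^ (suc n) i j ≈ sumN (suc d) (λ k → C i k * C^ n k j)
      C^-suc n i j = trans (ι-sumN (suc d) (λ k → companion (suc d) c i k ℤ.* companion^ (suc d) c n k j)) (sumN-cong (suc d) (λ k _ → ι-* (companion (suc d) c i k) (companion^ (suc d) c n k j)))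

      UC^ : ℕ → ℕ → ℕ → Carrier
      UC^ n k j = sumN (suc d) (λ i → newton k i * C^ n i j)

      UC^-suc : ∀ n k j → UC^ (suc n) k j ≈
        sumN (suc d) (λ l → sumN (suc d) (λ i → newton k i * C i l) * C^ n l j)
      UC^-suc n k j = begin
        sumN (suc d) (λ i → newton k i * C^ (suc n) i j)
          ≈⟨ sumN-cong (suc d) (λ i _ → trans (*-congˡ (C^-suc n i j)) (sym (sumN-*ˡ (suc d) (newton k i) (λ l → C i l * C^ n l j)))) ⟩
        sumN (suc d) (λ i → sumN (suc d) (λ l → newton k i * (C i l * C^ n l j)))
          ≈⟨ sumN-comm (suc d) (suc d) (λ i l → newton k i * (C i l * C^ n l j)) ⟩
        sumN (suc d) (λ l → sumN (suc d) (λ i → newton k i * (C i l * C^ n l j)))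
          ≈⟨ sumN-cong (suc d) (λ l _ → trans
               (sumN-cong (suc d) (λ i _ → solve 3 (λ u c p → u :* (c :* p) := p :* (u :* c)) refl (newton k i) (C i l) (C^ n l j)))
               (trans (sumN-*ˡ (suc d) (C^ n l j) (λ i → newton k i * C i l)) (*-comm _ _))) ⟩
        sumN (suc d) (λ l → sumN (suc d) (λ i → newton k i * C i l) * C^ n l j) ∎

      LU : ℕ → ℕ → ℕ → Carrier
      LU n k j = sumN (suc d) (λ i → bidiag^ n k i * newton i j)

      LU-suc : ∀ n k j → LU (suc n) k j ≈ α k * LU n k j + LU n (suc k) j
      LU-suc n k j = begin
        sumN (suc d) (λ i → (α k * bidiag^ n k i + bidiag^ n (suc k) i) * newton i j)
          ≈⟨ sumN-cong (suc d) (λ i _ → solve 4 (λ a x y u → (a :* x :+ y) :* u := a :* (x :* u) :+ y :* u) refl (α k) (bidiag^ n k i) (bidiag^ n (suc k) i) (newton i j)) ⟩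
        sumN (suc d) (λ i → α k * (bidiag^ n k i * newton i j) + bidiag^ n (suc k) i * newton i j)
          ≈⟨ sumN-+ (suc d) (λ i → α k * (bidiag^ n k i * newton i j)) (λ i → bidiag^ n (suc k) i * newton i j) ⟩
        sumN (suc d) (λ i → α k * (bidiag^ n k i * newton i j)) + LU n (suc k) j
          ≈⟨ +-congʳ (sumN-*ˡ (suc d) (α k) (λ i → bidiag^ n k i * newton i j)) ⟩
        α k * LU n k j + LU n (suc k) j ∎

      -- With U the matrix of `newton` and L the bidiagonal one, this iterates U C = L U to U C^n =
      -- L^n U.
      UC^≈LU : ∀ n k j → k < suc d → j < suc d → UC^ n k j ≈ LU n k j
      UC^≈LU zero k j k<d j<d = trans
        (trans (sumN-cong (suc d) {g = λ i → δ j i * newton k i} (λ i _ → trans (*-comm _ _) (*-congʳ (trans (ι-δ i j) (δ-sym i j))))) (sumN-δ (suc d) j (newton k) j<d))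
        (sym (sumN-δ (suc d) k (λ i → newton i j) k<d))
      UC^≈LU (suc n) k j k<d@(s≤s k≤d) j<d with ℕₚ.m≤n⇒m<n∨m≡n k≤d
      ... | inj₁ k<d′ = begin
        UC^ (suc n) k j
          ≈⟨ UC^-suc n k j ⟩
        sumN (suc d) (λ l → sumN (suc d) (λ i → newton k i * C i l) * C^ n l j)
          ≈⟨ sumN-cong (suc d) (λ l l<d → trans (*-congʳ (newton-C-init k l k<d′ l<d))
               (solve 4 (λ a x y u → (a :* x :+ y) :* u := a :* (x :* u) :+ y :* u) refl (α k) (newton k l) (newton (suc k) l) (C^ n l j))) ⟩
        sumN (suc d) (λ l → α k * (newton k l * C^ n l j) + newton (suc k) l * C^ n l j)
          ≈⟨ sumN-+ (suc d) (λ l → α k * (newton k l * C^ n l j)) (λ l → newton (suc k) l * C^ n l j) ⟩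
        sumN (suc d) (λ l → α k * (newton k l * C^ n l j)) + UC^ n (suc k) j
          ≈⟨ +-cong (trans (sumN-*ˡ (suc d) (α k) (λ l → newton k l * C^ n l j)) (*-congˡ (UC^≈LU n k j k<d j<d))) (UC^≈LU n (suc k) j (s≤s k<d′) j<d) ⟩
        α k * LU n k j + LU n (suc k) j
          ≈⟨ LU-suc n k j ⟨
        LU (suc n) k j ∎
      ... | inj₂ ≡.refl = begin
        UC^ (suc n) k j
          ≈⟨ UC^-suc n k j ⟩
        sumN (suc d) (λ l → sumN (suc d) (λ i → newton k i * C i l) * C^ n l j)
          ≈⟨ sumN-cong (suc d) (λ l l<d → trans (*-congʳ (newton-C-last l l<d)) (*-assoc (α k) (newton k l) (C^ n l j))) ⟩
        sumN (suc d) (λ l → α k * (newton k l * C^ n l j))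
          ≈⟨ trans (sumN-*ˡ (suc d) (α k) (λ l → newton k l * C^ n l j)) (*-congˡ (UC^≈LU n k j k<d j<d)) ⟩
        α k * LU n k j
          ≈⟨ +-identityʳ _ ⟨
        α k * LU n k j + 0#
          -- Row `suc d` of `bidiag^` lies outside the matrix, but vanishes on all summed columns;
          -- so the recursion of `LU` also holds in the last row.
          ≈⟨ +-congˡ (sumN-0 (suc d) (λ i i<d → trans (*-congʳ (bidiag^-lower n (suc k) i i<d)) (zeroˡ (newton i j)))) ⟨
        α k * LU n k j + LU n (suc k) j
          ≈⟨ LU-suc n k j ⟨
        LU (suc n) k j ∎

      C^-1 : ℕ → ℕ → ℕ → Carrier
      C^-1 n i j = ι (companion^-1 (suc d) c n i j)

      U[C^-1]≈[L-1]U : ∀ n k j → k < suc d → j < suc d →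
        sumN (suc d) (λ i → newton k i * C^-1 n i j) ≈ sumN (suc d) (λ i → (bidiag^ n k i - δ k i) * newton i j)
      U[C^-1]≈[L-1]U n k j k<d j<d = begin
        sumN (suc d) (λ i → newton k i * C^-1 n i j)
          ≈⟨ sumN-cong (suc d) (λ i _ → trans
               (*-congˡ (trans (ι-+ (companion^ (suc d) c n i j) (ℤ.- ℤΣ.δ i j)) (+-congˡ (ι-neg (ℤΣ.δ i j)))))
               (solve 3 (λ u p e → u :* (p :- e) := u :* p :+ :- (u :* e)) refl (newton k i) (C^ n i j) (ι (ℤΣ.δ i j)))) ⟩
        sumN (suc d) (λ i → newton k i * C^ n i j + - (newton k i * C^ 0 i j))
          ≈⟨ trans (sumN-+ (suc d) (λ i → newton k i * C^ n i j) (λ i → - (newton k i * C^ 0 i j)))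
               (+-congˡ (sumN-neg (suc d) (λ i → newton k i * C^ 0 i j))) ⟩
        UC^ n k j - UC^ 0 k j
          ≈⟨ +-cong (UC^≈LU n k j k<d j<d) (-‿cong (UC^≈LU 0 k j k<d j<d)) ⟩
        LU n k j - LU 0 k j
          ≈⟨ trans (sumN-+ (suc d) (λ i → bidiag^ n k i * newton i j) (λ i → - (δ k i * newton i j)))
               (+-congˡ (sumN-neg (suc d) (λ i → δ k i * newton i j))) ⟨
        sumN (suc d) (λ i → bidiag^ n k i * newton i j + - (δ k i * newton i j))
          ≈⟨ sumN-cong (suc d) (λ i _ → solve 3 (λ u p e → p :* u :+ :- (e :* u) := (p :- e) :* u) refl (newton i j) (bidiag^ n k i) (δ k i)) ⟩
        sumN (suc d) (λ i → (bidiag^ n k i - δ k i) * newton i j) ∎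

      det-newton : det (suc d) newton ≈ 1#
      det-newton = trans (det-lower (suc d) newton (λ i j i<j _ → newton-above i j i<j)) (prod-1 (suc d) newton-lead)
        where
        prod-1 : ∀ m {f} → (∀ i → f i ≈ 1#) → prodN m f ≈ 1#
        prod-1 zero    h = refl
        prod-1 (suc m) h = trans (*-cong (h 0) (prod-1 m (λ i → h (suc i)))) (*-identityˡ 1#)

      -- Since det U = 1, the identity U (C^n - 1) = (L^n - 1) U compares the two determinants
      -- without an inverse of U.
      det-companion^-1 : ∀ n → det (suc d) (C^-1 n) ≈ prodN (suc d) (λ i → pow (α i) n - 1#)
      det-companion^-1 n = begin
        det D (C^-1 n)
          ≈⟨ trans (*-congʳ det-newton) (*-identityˡ _) ⟨
        det D newton * det D (C^-1 n)
          ≈⟨ det-* D newton (C^-1 n) ⟨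
        det D (λ k j → sumN D (λ i → newton k i * C^-1 n i j))
          ≈⟨ det-cong D (U[C^-1]≈[L-1]U n) ⟩
        det D (λ k j → sumN D (λ i → (bidiag^ n k i - δ k i) * newton i j))
          ≈⟨ det-* D (λ k i → bidiag^ n k i - δ k i) newton ⟩
        det D (λ k i → bidiag^ n k i - δ k i) * det D newton
          ≈⟨ trans (*-congˡ det-newton) (*-identityʳ _) ⟩
        det D (λ k i → bidiag^ n k i - δ k i)
          ≈⟨ det-upper D _ (λ i j _ j<i → trans
               (+-cong (bidiag^-lower n i j j<i) (-‿cong (δ-≢ (λ e → ℕₚ.<-irrefl (≡.sym e) j<i)))) (-‿inverseʳ 0#)) ⟩
        prodN D (λ i → bidiag^ n i i - δ i i)
          ≈⟨ prodN-cong D (λ i _ → +-cong (bidiag^-diag n i) (-‿cong (δ-≡ i))) ⟩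
        prodN D (λ i → pow (α i) n - 1#) ∎
        where D = suc d

  module _ (dom : IsIntegralDomain) (char0 : CharZero) where

    -- The splitting hypothesis only equates values. The difference of the two coefficient sequences
    -- evaluates to zero at every natural number, and `vanishing` makes it zero.
    newton≈monic : ∀ d cs (α : Fin d → Carrier) →
      ((x : Carrier) → evalMonic d cs x ≈ prodF d (λ i → x - α i)) →
      ∀ j → j < suc d → Newton.newton (extend α) d j ≈ ι (monic d cs j)
    newton≈monic d cs α split j j<d = x-y≈0⇒x≈y (begin
      g j - f j           ≈⟨ +-congˡ (-‿cong (*-identityˡ _)) ⟨
      g j - 1# * f j      ≈⟨ vanishing dom char0 (suc d) (λ j → g j - 1# * f j) 0 vanishes j j<d ⟩
      0#                  ∎)
      where
      open Newton (extend α)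
      g = newton d
      f = λ j → ι (monic d cs j)
      vanishes : ∀ k → ev (suc d) (λ j → g j - 1# * f j) (ιℕ (k ℕ.+ 0)) ≈ 0#
      vanishes k = begin
        ev (suc d) (λ j → g j - 1# * f j) x     ≈⟨ ev-lin (suc d) g f 1# x ⟩
        ev (suc d) g x - 1# * ev (suc d) f x
          ≈⟨ +-cong (trans (ev-newton d d x ℕₚ.≤-refl) (prodF-extend d α (λ a → x - a)))
                    (-‿cong (trans (*-identityˡ _) (trans (ev-monic d cs x) (split x)))) ⟩
        prodF d (λ i → x - α i) - prodF d (λ i → x - α i)  ≈⟨ -‿inverseʳ _ ⟩
        0# ∎
        where x = ιℕ (k ℕ.+ 0)

-- Row reduction over the integers

Rows : ℕ → Set
Rows m = Vec (ℕ → ℤ) m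

infix 4 _⟶_

data _⟶_ : ∀ {m} → Rows m → Rows m → Set where
  done     : ∀ {m} {A : Rows m} → A ⟶ A
  then     : ∀ {m} {A B C : Rows m} → A ⟶ B → B ⟶ C → A ⟶ C
  below    : ∀ {m} {A B : Rows m} r → A ⟶ B → r ∷ A ⟶ r ∷ B
  rename   : ∀ {m} {A : Rows m} {r r′} → (∀ k → r k ≡ r′ k) → r ∷ A ⟶ r′ ∷ A
  add-up   : ∀ {m} {A : Rows m} c r s → r ∷ s ∷ A ⟶ (λ k → c ℤ.* s k ℤ.+ r k) ∷ s ∷ A
  add-down : ∀ {m} {A : Rows m} c r s → r ∷ s ∷ A ⟶ r ∷ (λ k → c ℤ.* r k ℤ.+ s k) ∷ A

tail : (ℕ → ℤ) → ℕ → ℤ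
tail r k = r (suc k)

0∷_ : (ℕ → ℤ) → ℕ → ℤ
(0∷ r) zero    = + 0
(0∷ r) (suc k) = r k

Upper : ∀ n → Rows n → Set
Upper zero    []      = ⊤
Upper (suc n) (r ∷ A) = All (λ s → s 0 ≡ + 0) A × Upper n (map tail A)

diagonal : ∀ n → Rows n → ℤ
diagonal zero    []      = + 1
diagonal (suc n) (r ∷ A) = r 0 ℤ.* diagonal n (map tail A)

euclid : ∀ {m} (A : Rows m) r s → Acc _<_ ℤ.∣ s 0 ∣ →
  ∃ λ r′ → ∃ λ s′ → (r ∷ s ∷ A ⟶ r′ ∷ s′ ∷ A) × s′ 0 ≡ + 0
euclid A r s (acc smaller) with s 0 ℤ.≟ + 0
... | yes s₀≡0 = r , s , done , s₀≡0
... | no  s₀≢0 = step (euclid A r₂ s₁ (smaller ∣s₁∣<∣s₀∣))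
  where
  instance nz : ℤ.NonZero (s 0)
           nz = ℤ.≢-nonZero s₀≢0
  q = ℤ.- (r 0 ℤD./ s 0)
  r₁ : ℕ → ℤ
  r₁ k = q ℤ.* s k ℤ.+ r k
  -- A swap up to sign, made of two shears: (r₁, s) becomes (s + r₁, - r₁), which puts the remainder
  -- of the division into the second row.
  r₂ : ℕ → ℤ
  r₂ k = + 1 ℤ.* s k ℤ.+ r₁ k
  s₁ : ℕ → ℤ
  s₁ k = ℤ.- (+ 1) ℤ.* r₂ k ℤ.+ s k
  open ≡.≡-Reasoning
  s₁₀ : s₁ 0 ≡ ℤ.- (+ (r 0 ℤD.% s 0))
  s₁₀ = begin
    s₁ 0                                 ≡⟨ ℤΣ.solve 3 (λ q s r → ℤΣ.con (ℤ.- (+ 1)) ℤΣ.:* (ℤΣ.con (+ 1) ℤΣ.:* s ℤΣ.:+ (ℤΣ.:- q ℤΣ.:* s ℤΣ.:+ r)) ℤΣ.:+ s ℤΣ.:= q ℤΣ.:* s ℤΣ.:- r) ≡.refl (r 0 ℤD./ s 0) (s 0) (r 0) ⟩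
    x ℤ.* s 0 ℤ.- r 0                    ≡⟨ ≡.cong (λ z → x ℤ.* s 0 ℤ.- z) (ℤD.a≡a%n+[a/n]*n (r 0) (s 0)) ⟩
    x ℤ.* s 0 ℤ.- (+ ρ ℤ.+ x ℤ.* s 0)    ≡⟨ ℤΣ.solve 2 (λ y ρ → y ℤΣ.:- (ρ ℤΣ.:+ y) ℤΣ.:= ℤΣ.:- ρ) ≡.refl (x ℤ.* s 0) (+ ρ) ⟩
    ℤ.- (+ ρ)                            ∎
    where
    x = r 0 ℤD./ s 0
    ρ = r 0 ℤD.% s 0
  ∣s₁∣<∣s₀∣ : ℤ.∣ s₁ 0 ∣ < ℤ.∣ s 0 ∣
  ∣s₁∣<∣s₀∣ = ≡.subst (_< ℤ.∣ s 0 ∣)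
    (≡.sym (≡.trans (≡.cong ℤ.∣_∣ s₁₀) (ℤₚ.∣-i∣≡∣i∣ (+ (r 0 ℤD.% s 0))))) (ℤD.n%d<d (r 0) (s 0))
  step : (∃ λ r′ → ∃ λ s′ → (r₂ ∷ s₁ ∷ A ⟶ r′ ∷ s′ ∷ A) × s′ 0 ≡ + 0) →
         ∃ λ r′ → ∃ λ s′ → (r ∷ s ∷ A ⟶ r′ ∷ s′ ∷ A) × s′ 0 ≡ + 0
  step (r′ , s′ , red , s′₀≡0) = r′ , s′ ,
    then (add-up q r s) (then (add-up (+ 1) r₁ s) (then (add-down (ℤ.- (+ 1)) r₂ s) red)) , s′₀≡0

-- The pivot travels upwards from the last row, so every Euclidean step involves adjacent rows only.
clear-column : ∀ {m} (A : Rows (suc m)) →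
  ∃ λ r → ∃ λ (B : Rows m) → (A ⟶ r ∷ B) × All (λ s → s 0 ≡ + 0) B
clear-column (r ∷ [])        = r , [] , done , []
clear-column (r ∷ A@(_ ∷ _)) with clear-column A
... | r₁ , B , red , zeros with euclid B r r₁ (<-wellFounded _)
...   | r₂ , s , red′ , s₀≡0 = r₂ , s ∷ B , then (below r red) red′ , s₀≡0 ∷ zeros

-- Lets the reduction of a minor run inside the larger matrix: a zero first column survives every
-- operation, up to renaming c · 0 + 0 to 0.
prepend : ∀ {m} {A B : Rows m} → A ⟶ B → map 0∷_ A ⟶ map 0∷_ B
prepend done             = done
prepend (then p q)       = then (prepend p) (prepend q)
prepend (below r p)      = below (0∷ r) (prepend p)
prepend (rename h)       = rename (λ { zero → ≡.refl ; (suc k) → h k })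
prepend (add-up c r s)   = then (add-up c (0∷ r) (0∷ s))
  (rename (λ { zero → ≡.cong (ℤ._+ + 0) (ℤₚ.*-zeroʳ c) ; (suc k) → ≡.refl }))
prepend (add-down c r s) = then (add-down c (0∷ r) (0∷ s))
  (below (0∷ r) (rename (λ { zero → ≡.cong (ℤ._+ + 0) (ℤₚ.*-zeroʳ c) ; (suc k) → ≡.refl })))

prepend-tail : ∀ {m} {B : Rows m} → All (λ s → s 0 ≡ + 0) B → B ⟶ map 0∷_ (map tail B)
prepend-tail []            = done
prepend-tail (s₀≡0 ∷ zeros) = then (rename (λ { zero → s₀≡0 ; (suc k) → ≡.refl })) (below _ (prepend-tail zeros))

triangularise : ∀ n (A : Rows n) → ∃ λ H → (A ⟶ H) × Upper n H
triangularise zero    [] = [] , done , tt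
triangularise (suc n) A with clear-column A
... | r , B , red , zeros with triangularise n (map tail B)
...   | H , red′ , upper = r ∷ map 0∷_ H , then red (below r (then (prepend-tail zeros) (prepend red′))) ,
        zero-heads H , ≡.subst (Upper n) (≡.sym (tail-prepend H)) upper
  where
  zero-heads : ∀ {m} (H : Rows m) → All (λ s → s 0 ≡ + 0) (map 0∷_ H)
  zero-heads []      = []
  zero-heads (h ∷ H) = ≡.refl ∷ zero-heads H
  tail-prepend : ∀ {m} (H : Rows m) → map tail (map 0∷_ H) ≡ H
  tail-prepend []      = ≡.refl
  tail-prepend (h ∷ H) = ≡.cong (h ∷_) (tail-prepend H)

rows : ∀ m → (ℕ → ℕ → ℤ) → Rows m
rows zero    M = []
rows (suc m) M = M 0 ∷ rows m (λ i → M (suc i))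

-- Junk value 0 beyond the last row.
matrix : ∀ {m} → Rows m → ℕ → ℕ → ℤ
matrix []      _       _ = + 0
matrix (r ∷ A) zero      = r
matrix (r ∷ A) (suc i)   = matrix A i

matrix-rows : ∀ m M i j → i < m → matrix (rows m M) i j ≡ M i j
matrix-rows (suc m) M zero    j _         = ≡.refl
matrix-rows (suc m) M (suc i) j (s≤s i<m) = matrix-rows m (λ i → M (suc i)) i j i<m

matrix-tail : ∀ {m} (A : Rows m) i j → matrix (map tail A) i j ≡ matrix A i (suc j)
matrix-tail []      i       j = ≡.refl
matrix-tail (r ∷ A) zero    j = ≡.refl
matrix-tail (r ∷ A) (suc i) j = matrix-tail A i j

matrix-zeros : ∀ {m} {A : Rows m} → All (λ s → s 0 ≡ + 0) A → ∀ i → matrix A i 0 ≡ + 0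
matrix-zeros []             i       = ≡.refl
matrix-zeros (s₀≡0 ∷ zeros) zero    = s₀≡0
matrix-zeros (s₀≡0 ∷ zeros) (suc i) = matrix-zeros zeros i

module RowDeterminant (R : CommutativeRing 0ℓ 0ℓ) where
  open IntegerScalars R
  open ExteriorAlgebra R
  open Relation.Binary.Reasoning.Setoid setoid

  volume : ∀ n {m} → Rows m → Λ n
  volume n {m} A = vol n m (λ i j → ι (matrix A i j))

  wedge-ι : ∀ n c (u v : ℕ → ℤ) ω S →
    wedge n (λ k → ι (c ℤ.* u k ℤ.+ v k)) ω S ≈ ι c * wedge n (λ k → ι (u k)) ω S + wedge n (λ k → ι (v k)) ω S
  wedge-ι n c u v ω S = trans
    (wedge-cong n (λ k _ → trans (ι-+ (c ℤ.* u k) (v k)) (+-congʳ (ι-* c (u k)))) (λ _ → refl) S)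
    (wedge-*+ˡ n (ι c) (λ k → ι (u k)) (λ k → ι (v k)) ω S)

  -- In both shears the added multiple of the neighbouring row is killed by `wedge-self`.
  volume-invariant : ∀ n {m} {A B : Rows m} → A ⟶ B → ∀ S → volume n A S ≈ volume n B S
  volume-invariant n done        S = refl
  volume-invariant n (then p q)  S = trans (volume-invariant n p S) (volume-invariant n q S)
  volume-invariant n (below r p) S = wedge-congʳ n _ (volume-invariant n p) S
  volume-invariant n (rename h)  S = wedge-cong n (λ k _ → reflexive (≡.cong ι (h k))) (λ _ → refl) S
  volume-invariant n (add-up {A = A} c r s) S = sym (begin
    wedge n (λ k → ι (c ℤ.* s k ℤ.+ r k)) sω S
      ≈⟨ wedge-ι n c s r sω S ⟩
    ι c * wedge n (λ k → ι (s k)) sω S + wedge n (λ k → ι (r k)) sω S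
      ≈⟨ +-congʳ (trans (*-congˡ (wedge-self n _ (volume n A) S)) (zeroʳ _)) ⟩
    0# + wedge n (λ k → ι (r k)) sω S
      ≈⟨ +-identityˡ _ ⟩
    wedge n (λ k → ι (r k)) sω S ∎)
    where sω = wedge n (λ k → ι (s k)) (volume n A)
  volume-invariant n (add-down {A = A} c r s) S = sym (begin
    wedge n ρ (wedge n (λ k → ι (c ℤ.* r k ℤ.+ s k)) ω) S
      ≈⟨ wedge-congʳ n ρ (wedge-ι n c r s ω) S ⟩
    wedge n ρ (λ S → ι c * wedge n ρ ω S + wedge n σ ω S) S
      ≈⟨ wedge-+ʳ n ρ _ _ S ⟩
    wedge n ρ (λ S → ι c * wedge n ρ ω S) S + wedge n ρ (wedge n σ ω) S
      ≈⟨ +-congʳ (trans (wedge-*ʳ n ρ (ι c) _ S) (trans (*-congˡ (wedge-self n ρ ω S)) (zeroʳ _))) ⟩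
    0# + wedge n ρ (wedge n σ ω) S
      ≈⟨ +-identityˡ _ ⟩
    wedge n ρ (wedge n σ ω) S ∎)
    where
    ω = volume n A
    ρ = λ k → ι (r k)
    σ = λ k → ι (s k)

  det-Upper : ∀ n (H : Rows n) → Upper n H → det n (λ i j → ι (matrix H i j)) ≈ ι (diagonal n H)
  det-Upper zero    []      _               = sym ι-1
  det-Upper (suc n) (r ∷ A) (zeros , upper) = begin
    det (suc n) (λ i j → ι (matrix (r ∷ A) i j))
      ≈⟨ det-upper-suc n (λ i j → ι (matrix (r ∷ A) i j)) (λ i _ → reflexive (≡.cong ι (matrix-zeros zeros i))) ⟩
    ι (r 0) * det n (λ i j → ι (matrix A i (suc j)))
      ≈⟨ *-congˡ (trans (det-cong n (λ i j _ _ → reflexive (≡.cong ι (≡.sym (matrix-tail A i j))))) (det-Upper n (map tail A) upper)) ⟩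
    ι (r 0) * ι (diagonal n (map tail A))
      ≈⟨ ι-* (r 0) (diagonal n (map tail A)) ⟨
    ι (diagonal (suc n) (r ∷ A)) ∎

  -- The reduction is integral while the determinant is taken in R; as `ι` respects the row
  -- operations, no determinant over ℤ has to be compared with it.
  det-reduced : ∀ n M (H : Rows n) → rows n M ⟶ H → Upper n H → det n (λ i j → ι (M i j)) ≈ ι (diagonal n H)
  det-reduced n M H red upper = begin
    det n (λ i j → ι (M i j))
      ≈⟨ det-cong n (λ i j i<n _ → reflexive (≡.cong ι (≡.sym (matrix-rows n M i j i<n)))) ⟩
    det n (λ i j → ι (matrix (rows n M) i j))
      ≈⟨ volume-invariant n red _ ⟩
    det n (λ i j → ι (matrix H i j))
      ≈⟨ det-Upper n H upper ⟩
    ι (diagonal n H) ∎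

-- Counting periodic points up to an equivalence

-- Stands in for a bijection between `Fin N` and the quotient of P by `_~_`, with chosen
-- representatives instead of a quotient type.
record Counted {Q : Set} (_~_ : Q → Q → Set) (P : Q → Set) (N : ℕ) : Set where
  field
    enum      : Fin N → Q
    sound     : ∀ i → P (enum i)
    injective : ∀ {i j} → enum i ~ enum j → i ≡ j
    index     : ∀ x → P x → Σ (Fin N) (λ i → x ~ enum i)

count-pairs : ∀ {Q : Set} {_~_ : Q → Q → Set} {P : Q → Set} {M N} (pair : Fin M → Fin N → Q) →
  (∀ i j → P (pair i j)) →
  (∀ i j k l → pair i j ~ pair k l → i ≡ k × j ≡ l) →
  (∀ x → P x → Σ (Fin M) λ i → Σ (Fin N) λ j → x ~ pair i j) →
  Counted _~_ P (M ℕ.* N)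
count-pairs {_~_ = _~_} {M = M} {N} pair sound injective index = record
  { enum      = λ ij → pair (π₁ ij) (π₂ ij)
  ; sound     = λ ij → sound (π₁ ij) (π₂ ij)
  ; injective = λ {ij} {kl} h → let (e , f) = injective (π₁ ij) (π₂ ij) (π₁ kl) (π₂ kl) h in
      ≡.trans (≡.sym (Finₚ.combine-remQuot {M} N ij)) (≡.trans (≡.cong₂ Fin.combine e f) (Finₚ.combine-remQuot {M} N kl))
  ; index     = λ x p → let (i , j , h) = index x p in
      Fin.combine i j , ≡.subst (λ ij → x ~ pair (proj₁ ij) (proj₂ ij)) (≡.sym (Finₚ.remQuot-combine i j)) h
  }
  where
  π₁ : Fin (M ℕ.* N) → Fin M
  π₁ ij = proj₁ (Fin.remQuot N ij)
  π₂ : Fin (M ℕ.* N) → Fin N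
  π₂ ij = proj₂ (Fin.remQuot {M} N ij)

-- A periodic point, up to ~, is coded by its least period together with its index among the points of that period.
module _ {Q : Set} (_~_ : Q → Q → Set) (~-equiv : IsEquivalence _~_)
         (T : Q → Q) (T-cong : ∀ {x y} → x ~ y → T x ~ T y) (v : ℕ → ℕ)
         (counted : ∀ n → Counted _~_ (λ x → iter T (suc n) x ~ x) (v (suc n))) where
  private
    open IsEquivalence ~-equiv renaming (refl to ~-refl; sym to ~-sym; trans to ~-trans)
    open module C n = Counted (counted n)

    -- Shifted by one, so that exactly the positive periods occur.
    P : ℕ → Q → Set
    P n x = iter T (suc n) x ~ x

    Code : Set
    Code = Σ ℕ (λ n → Fin (v (suc n)))

    point : Code → Q
    point (n , i) = enum n i

    iter-cong : ∀ n {x y} → x ~ y → iter T n x ~ iter T n y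
    iter-cong zero    h = h
    iter-cong (suc n) h = T-cong (iter-cong n h)

    iter-T : ∀ n x → iter T n (T x) ≡ T (iter T n x)
    iter-T zero    x = ≡.refl
    iter-T (suc n) x = ≡.cong T (iter-T n x)

    iter-comm : ∀ m n x → iter T m (iter T n x) ≡ iter T n (iter T m x)
    iter-comm m zero    x = ≡.refl
    iter-comm m (suc n) x = ≡.trans (iter-T m (iter T n x)) (≡.cong T (iter-comm m n x))

    P-cong : ∀ n {x y} → x ~ y → P n x → P n y
    P-cong n h p = ~-trans (iter-cong (suc n) (~-sym h)) (~-trans p h)

    P-iter : ∀ m n {x} → P n x → P n (iter T m x)
    P-iter m n {x} p = ≡.subst (_~ iter T m x) (iter-comm m (suc n) x) (iter-cong m p)

    -- `_~_` itself need not be decidable. But if x has period n + 1, so has its iterate, and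
    -- comparing the indices of the two in one finite enumeration decides whether they are
    -- equivalent.
    P? : ∀ m n {x} → P n x → Dec (P m x)
    P? m n {x} p with index n (iter T (suc m) x) (P-iter (suc m) n p) | index n x p
    ... | i , x′~i | j , x~j with i Finₚ.≟ j
    ...   | yes ≡.refl = yes (~-trans x′~i (~-sym x~j))
    ...   | no  i≢j    = no λ h → i≢j (injective n (~-trans (~-sym x′~i) (~-trans h x~j)))

    Least : ℕ → Q → Set
    Least m x = P m x × (∀ l → l < m → ¬ P l x)

    least : ∀ n {x} → P n x → ∃ λ m → Least m x
    least n {x} p = go n 0 (ℕₚ.+-identityʳ n) (λ _ ())
      where
      go : ∀ fuel m → fuel ℕ.+ m ≡ n → (∀ l → l < m → ¬ P l x) → ∃ λ m → Least m x
      go zero       m ≡.refl none = m , p , none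
      go (suc fuel) m e      none with P? m n p
      ... | yes q = m , q , none
      ... | no ¬q = go fuel (suc m) (≡.trans (ℕₚ.+-suc fuel m) e) none′
        where
        none′ : ∀ l → l < suc m → ¬ P l x
        none′ l (s≤s l≤m) with ℕₚ.m≤n⇒m<n∨m≡n l≤m
        ... | inj₁ l<m    = none l l<m
        ... | inj₂ ≡.refl = ¬q

    least-unique : ∀ {m m′ x y} → Least m x → Least m′ y → x ~ y → m ≡ m′
    least-unique {m} {m′} (p , least-m) (p′ , least-m′) h with ℕₚ.<-cmp m m′
    ... | tri< lt _ _ = ⊥-elim (least-m′ m lt (P-cong m h p))
    ... | tri≈ _ e _  = e
    ... | tri> _ _ gt = ⊥-elim (least-m m′ gt (P-cong m′ (~-sym h) p′))

    Codes : Q → Code → Set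
    Codes x c = Least (proj₁ c) x × x ~ point c

    code : ∀ n {x} → P n x → ∃ λ c → Codes x c
    code n {x} p with least n p
    ... | m , q@(pm , _) with index m x pm
    ...   | i , x~i = (m , i) , q , x~i

    code-unique : ∀ {x y c c′} → Codes x c → Codes y c′ → x ~ y → c ≡ c′
    code-unique {c = m , i} {m′ , j} (q , x~i) (q′ , y~j) h with least-unique q q′ h
    ... | ≡.refl = ≡.cong (m ,_) (injective m (~-trans (~-sym x~i) (~-trans h y~j)))

    T̂-code : ∀ c → ∃ λ c′ → Codes (T (point c)) c′
    T̂-code (n , i) = code n (P-iter 1 n (sound n i))

    -- Codes whose first component is not the least period of their point are not excluded. They are
    -- harmless: every value of `T̂` carries a least period, so they lie on no cycle.
    T̂ : Code → Code
    T̂ c = proj₁ (T̂-code c)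

    Codes-cong : ∀ {x y c} → x ~ y → Codes x c → Codes y c
    Codes-cong {c = m , i} h ((p , none) , x~i) =
      (P-cong m h p , λ l l<m q → none l l<m (P-cong l (~-sym h) q)) , ~-trans (~-sym h) x~i

    -- Restricted to positive iterates, because an arbitrary `c` need not be the code of its own
    -- point.
    iter-T̂ : ∀ n c → Codes (iter T (suc n) (point c)) (iter T̂ (suc n) c)
    iter-T̂ zero    c = proj₂ (T̂-code c)
    iter-T̂ (suc n) c = Codes-cong (T-cong (~-sym (proj₂ (iter-T̂ n c)))) (proj₂ (T̂-code (iter T̂ (suc n) c)))

    UIP : ∀ {c c′ : Code} (p q : c ≡ c′) → p ≡ q
    UIP = Decidable⇒UIP.≡-irrelevant (×ₚ.≡-dec ℕ._≟_ Finₚ._≟_)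

    Per-≡ : ∀ {n} {x y : Per T̂ n} → proj₁ x ≡ proj₁ y → x ≡ y
    Per-≡ {x = c , p} {.c , q} ≡.refl = ≡.cong (c ,_) (UIP p q)

    to : ∀ n → Fin (v (suc n)) → Per T̂ (suc n)
    to n i with code n (sound n i)
    ... | c , q@(_ , i~c) = c , code-unique (iter-T̂ n c) q (~-trans (iter-cong (suc n) (~-sym i~c)) (sound n i))

    periodic : ∀ n ((c , _) : Per T̂ (suc n)) → P n (point c)
    periodic n (c , e) = ≡.subst (λ c′ → iter T (suc n) (point c) ~ point c′) e (proj₂ (iter-T̂ n c))

    from : ∀ n → Per T̂ (suc n) → Fin (v (suc n))
    from n x = proj₁ (index n (point (proj₁ x)) (periodic n x))

    to-Codes : ∀ n i → Codes (enum n i) (proj₁ (to n i))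
    to-Codes n i = proj₂ (code n (sound n i))

    fixed-Codes : ∀ n (x : Per T̂ (suc n)) → Codes (point (proj₁ x)) (proj₁ x)
    fixed-Codes n x@(c , e) = Codes-cong (periodic n x) (≡.subst (Codes (iter T (suc n) (point c))) e (iter-T̂ n c))

    to∘from : ∀ n x → to n (from n x) ≡ x
    to∘from n x = Per-≡ {suc n} (code-unique (to-Codes n (from n x)) (fixed-Codes n x)
      (~-sym (proj₂ (index n (point (proj₁ x)) (periodic n x)))))

    from∘to : ∀ n i → from n (to n i) ≡ i
    from∘to n i = injective n (~-trans (~-sym (proj₂ (index n (point (proj₁ (to n i))) (periodic n (to n i)))))
      (~-sym (proj₂ (to-Codes n i))))

  realise : Realisable v
  realise = Code , T̂ , λ { (suc n) _ → mk↔ₛ′ (to n) (from n) (to∘from n) (from∘to n) }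

realisable-cong : ∀ {v w} → (∀ n → 1 ≤ n → v n ≡ w n) → Realisable v → Realisable w
realisable-cong h (X , T , per) = X , T , λ n 1≤n → ≡.subst (λ k → Fin k ↔ Per T n) (h n 1≤n) (per n 1≤n)

-- Torus endomorphisms

bézout-ℤ : ∀ {s c} → Coprime s c → ∃ λ t → ∃ λ k → + s ℤ.* t ≡ + 1 ℤ.+ k ℤ.* + c
bézout-ℤ {s} {c} cop with coprime-Bézout cop
... | Bézout.+- x y eq = + x , + y , (begin
  + s ℤ.* + x               ≡⟨ ℤₚ.*-comm (+ s) (+ x) ⟩
  + x ℤ.* + s               ≡⟨ ℤₚ.pos-* x s ⟨
  + (x ℕ.* s)               ≡⟨ ≡.cong +_ eq ⟨
  + 1 ℤ.+ + (y ℕ.* c)       ≡⟨ ≡.cong (λ z → + 1 ℤ.+ z) (ℤₚ.pos-* y c) ⟩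
  + 1 ℤ.+ + y ℤ.* + c       ∎)
  where open ≡.≡-Reasoning
... | Bézout.-+ x y eq = ℤ.- + x , ℤ.- + y , (begin
  + s ℤ.* (ℤ.- + x)                     ≡⟨ ℤΣ.solve 2 (λ s x → s ℤΣ.:* (ℤΣ.:- x) ℤΣ.:= ℤΣ.con (+ 1) ℤΣ.:- (ℤΣ.con (+ 1) ℤΣ.:+ x ℤΣ.:* s)) ≡.refl (+ s) (+ x) ⟩
  + 1 ℤ.- (+ 1 ℤ.+ + x ℤ.* + s)         ≡⟨ ≡.cong (λ z → + 1 ℤ.- (+ 1 ℤ.+ z)) (ℤₚ.pos-* x s) ⟨
  + 1 ℤ.- + (1 ℕ.+ x ℕ.* s)             ≡⟨ ≡.cong (λ n → + 1 ℤ.- + n) eq ⟩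
  + 1 ℤ.- + (y ℕ.* c)                   ≡⟨ ≡.cong (λ z → + 1 ℤ.- z) (ℤₚ.pos-* y c) ⟩
  + 1 ℤ.- + y ℤ.* + c                   ≡⟨ ≡.cong (λ z → + 1 ℤ.+ z) (ℤₚ.neg-distribˡ-* (+ y) (+ c)) ⟩
  + 1 ℤ.+ (ℤ.- + y) ℤ.* + c             ∎)
  where open ≡.≡-Reasoning

solve-congruence : ∀ {s c} .{{_ : ℕ.NonZero c}} → Coprime s c → ∀ z →
  Σ (Fin c) λ j → ∃ λ w → z ℤ.- + s ℤ.* + Fin.toℕ j ≡ + c ℤ.* w
solve-congruence {s} {c} cop z with bézout-ℤ cop
-- As t inverts s modulo c, the residue sought is that of t z.
... | t , k , st≡1+kc = Fin.fromℕ< r<c , + s ℤ.* q ℤ.- k ℤ.* z , (begin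
  z ℤ.- + s ℤ.* + Fin.toℕ (Fin.fromℕ< r<c)
    ≡⟨ ≡.cong (λ n → z ℤ.- + s ℤ.* + n) (Finₚ.toℕ-fromℕ< r<c) ⟩
  z ℤ.- + s ℤ.* + r
    ≡⟨ ℤΣ.solve 6 (λ z s r k c q → z ℤΣ.:- s ℤΣ.:* r ℤΣ.:= ((ℤΣ.con (+ 1) ℤΣ.:+ k ℤΣ.:* c) ℤΣ.:* z ℤΣ.:- s ℤΣ.:* (r ℤΣ.:+ q ℤΣ.:* c)) ℤΣ.:+ c ℤΣ.:* (s ℤΣ.:* q ℤΣ.:- k ℤΣ.:* z)) ≡.refl z (+ s) (+ r) k (+ c) q ⟩
  ((+ 1 ℤ.+ k ℤ.* + c) ℤ.* z ℤ.- + s ℤ.* (+ r ℤ.+ q ℤ.* + c)) ℤ.+ + c ℤ.* (+ s ℤ.* q ℤ.- k ℤ.* z)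
    ≡⟨ ≡.cong₂ (λ a b → (a ℤ.* z ℤ.- + s ℤ.* b) ℤ.+ + c ℤ.* (+ s ℤ.* q ℤ.- k ℤ.* z)) st≡1+kc (ℤD.a≡a%ℕn+[a/ℕn]*n (t ℤ.* z) c) ⟨
  (+ s ℤ.* t ℤ.* z ℤ.- + s ℤ.* (t ℤ.* z)) ℤ.+ + c ℤ.* (+ s ℤ.* q ℤ.- k ℤ.* z)
    ≡⟨ ℤΣ.solve 4 (λ s t z x → (s ℤΣ.:* t ℤΣ.:* z ℤΣ.:- s ℤΣ.:* (t ℤΣ.:* z)) ℤΣ.:+ x ℤΣ.:= x) ≡.refl (+ s) t z (+ c ℤ.* (+ s ℤ.* q ℤ.- k ℤ.* z)) ⟩
  + c ℤ.* (+ s ℤ.* q ℤ.- k ℤ.* z) ∎)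
  where
  open ≡.≡-Reasoning
  r = (t ℤ.* z) ℤD.%ℕ c
  q = (t ℤ.* z) ℤD./ℕ c
  r<c = ℤD.n%ℕd<d (t ℤ.* z) c

residues-distinct : ∀ {c} (i j : Fin c) → c ℕ∣.∣ ℤ.∣ + Fin.toℕ i ℤ.- + Fin.toℕ j ∣ → i ≡ j
residues-distinct {c} i j div = Finₚ.toℕ-injective (nat (Finₚ.toℕ<n i) (Finₚ.toℕ<n j) (≡.subst (c ℕ∣.∣_) (≡.cong ℤ.∣_∣ (ℤₚ.m-n≡m⊖n (Fin.toℕ i) (Fin.toℕ j))) div))
  where
  ordered : ∀ {a b} → b ≤ a → a < c → c ℕ∣.∣ ℤ.∣ a ℤ.⊖ b ∣ → a ≡ b
  ordered {a} {b} b≤a a<c div with a ℕ.∸ b in e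
  ... | zero  = ℕₚ.≤-antisym (ℕₚ.m∸n≡0⇒m≤n e) b≤a
  ... | suc k = ⊥-elim (ℕₚ.<⇒≱ (ℕₚ.≤-<-trans (ℕₚ.≤-trans (ℕₚ.≤-reflexive (≡.sym e)) (ℕₚ.m∸n≤m a b)) a<c)
        (ℕ∣.∣⇒≤ (≡.subst (c ℕ∣.∣_) (≡.trans (≡.cong ℤ.∣_∣ (ℤₚ.⊖-≥ b≤a)) e) div)))
  nat : ∀ {a b} → a < c → b < c → c ℕ∣.∣ ℤ.∣ a ℤ.⊖ b ∣ → a ≡ b
  nat {a} {b} a<c b<c div with ℕₚ.≤-total b a
  ... | inj₁ b≤a = ordered b≤a a<c div
  ... | inj₂ a≤b = ≡.sym (ordered a≤b b<c (≡.subst (c ℕ∣.∣_) (ℤₚ.∣m⊖n∣≡∣n⊖m∣ a b) div))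

-- A multiplicative set S of allowed denominators; part h is the cofactor in h of its largest divisor from S.
record Denominators : Set₁ where
  field
    S       : ℕ → Set
    part    : ℕ → ℕ
    1∈S     : S 1
    *∈S     : ∀ {a b} → S a → S b → S (a ℕ.* b)
    factor  : ∀ h → 1 ≤ h → ∃ λ u → S u × h ≡ part h ℕ.* u
    coprime : ∀ {s h} → S s → 1 ≤ h → Coprime s (part h)
    part-1  : part 1 ≡ 1
    part-*  : ∀ {a b} → 1 ≤ a → 1 ≤ b → part (a ℕ.* b) ≡ part a ℕ.* part b

1≤∣i∣ : ∀ i → i ≢ + 0 → 1 ≤ ℤ.∣ i ∣
1≤∣i∣ (+ zero)  i≢0 = ⊥-elim (i≢0 ≡.refl)
1≤∣i∣ (+ suc n) i≢0 = s≤s z≤n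
1≤∣i∣ -[1+ n ]  i≢0 = s≤s z≤n

∣i∣*w≡i*w′ : ∀ i w → ∃ λ w′ → + ℤ.∣ i ∣ ℤ.* w ≡ i ℤ.* w′
∣i∣*w≡i*w′ (+ n)    w = w , ≡.refl
∣i∣*w≡i*w′ -[1+ n ] w = ℤ.- w , (ℤΣ.solve 2 (λ a w → a ℤΣ.:* w ℤΣ.:= (ℤΣ.:- a) ℤΣ.:* (ℤΣ.:- w)) ≡.refl (+ suc n) w)

-- The torus (K/O)^n, where O is the subring of fractions with denominators in S.
module Torus (K : CommutativeRing 0ℓ 0ℓ)
             (nontrivial : ¬ (CommutativeRing._≈_ K (CommutativeRing.1# K) (CommutativeRing.0# K)))
             (inverse : (n : ℕ) → Σ (CommutativeRing.Carrier K) (λ y → CommutativeRing._≈_ K (CommutativeRing._*_ K (RingDefs.ιℕ K (suc n)) y) (CommutativeRing.1# K)))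
             (𝒟 : Denominators) where
  open IntegerScalars K
  open ScalarMaps K
  open Denominators 𝒟
  open Relation.Binary.Reasoning.Setoid setoid

  char0 : CharZero
  char0 n h = nontrivial (trans (sym (proj₂ (inverse n))) (trans (*-congʳ h) (zeroˡ _)))

  ι-inverse : ∀ h → h ≢ + 0 → ∃ λ y → ι h * y ≈ 1#
  ι-inverse (+ zero)  h≢0 = ⊥-elim (h≢0 ≡.refl)
  ι-inverse (+ suc n) h≢0 = inverse n
  ι-inverse -[1+ n ]  h≢0 with inverse n
  ... | y , e = - y , trans (solve 2 (λ a y → (:- a) :* (:- y) := a :* y) refl _ _) e

  cancel : ∀ h → h ≢ + 0 → ∀ {x y} → ι h * x ≈ ι h * y → x ≈ y
  cancel h h≢0 {x} {y} e with ι-inverse h h≢0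
  ... | h⁻¹ , hh⁻¹≈1 = begin
    x                  ≈⟨ undo x ⟨
    h⁻¹ * (ι h * x)    ≈⟨ *-congˡ e ⟩
    h⁻¹ * (ι h * y)    ≈⟨ undo y ⟩
    y                  ∎
    where
    undo : ∀ x → h⁻¹ * (ι h * x) ≈ x
    undo x = trans (solve 3 (λ a b x → a :* (b :* x) := (b :* a) :* x) refl h⁻¹ (ι h) x) (trans (*-congʳ hh⁻¹≈1) (*-identityˡ x))

  O : Carrier → Set
  O q = ∃ λ s → S s × ∃ λ z → ι (+ s) * q ≈ ι z

  O-≈ : ∀ {p q} → p ≈ q → O p → O q
  O-≈ p≈q (s , s∈ , z , e) = s , s∈ , z , trans (*-congˡ (sym p≈q)) e

  O-0 : ∀ {q} → q ≈ 0# → O q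
  O-0 q≈0 = 1 , 1∈S , + 0 , trans (*-congˡ q≈0) (zeroʳ _)

  O-ιℕ : ∀ n → O (ιℕ n)
  O-ιℕ n = 1 , 1∈S , + n , trans (*-congʳ ι-1) (*-identityˡ _)

  O-+ : ∀ {p q} → O p → O q → O (p + q)
  O-+ {p} {q} (s , s∈ , z , e) (t , t∈ , w , f) = s ℕ.* t , *∈S s∈ t∈ , + t ℤ.* z ℤ.+ + s ℤ.* w , (begin
    ι (+ (s ℕ.* t)) * (p + q)                     ≡⟨ ≡.cong (λ i → ι i * (p + q)) (ℤₚ.pos-* s t) ⟩
    ι (+ s ℤ.* + t) * (p + q)                     ≈⟨ *-congʳ (ι-* (+ s) (+ t)) ⟩
    (ι (+ s) * ι (+ t)) * (p + q)                 ≈⟨ solve 4 (λ s t p q → (s :* t) :* (p :+ q) := t :* (s :* p) :+ s :* (t :* q)) refl _ _ _ _ ⟩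
    ι (+ t) * (ι (+ s) * p) + ι (+ s) * (ι (+ t) * q) ≈⟨ +-cong (*-congˡ e) (*-congˡ f) ⟩
    ι (+ t) * ι z + ι (+ s) * ι w                 ≈⟨ +-cong (ι-* (+ t) z) (ι-* (+ s) w) ⟨
    ι (+ t ℤ.* z) + ι (+ s ℤ.* w)                 ≈⟨ ι-+ (+ t ℤ.* z) (+ s ℤ.* w) ⟨
    ι (+ t ℤ.* z ℤ.+ + s ℤ.* w)                   ∎)

  O-ι* : ∀ c {q} → O q → O (ι c * q)
  O-ι* c {q} (s , s∈ , z , e) = s , s∈ , c ℤ.* z , (begin
    ι (+ s) * (ι c * q)   ≈⟨ solve 3 (λ s c q → s :* (c :* q) := c :* (s :* q)) refl _ _ _ ⟩
    ι c * (ι (+ s) * q)   ≈⟨ *-congˡ e ⟩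
    ι c * ι z             ≈⟨ ι-* c z ⟨
    ι (c ℤ.* z)           ∎)

  O-neg : ∀ {q} → O q → O (- q)
  O-neg {q} h = O-≈ (solve 1 (λ q → con (ℤ.- + 1) :* q := :- q) refl q) (O-ι* (ℤ.- + 1) h)

  O-- : ∀ {p q} → O p → O q → O (p - q)
  O-- h g = O-+ h (O-neg g)

  module _ (h : ℤ) (h≢0 : h ≢ + 0) (y : Carrier) where
    private
      c = part ℤ.∣ h ∣
      1≤∣h∣ = 1≤∣i∣ h h≢0
      h⁻¹ = proj₁ (ι-inverse h h≢0)
      hh⁻¹≈1 = proj₂ (ι-inverse h h≢0)
      u = proj₁ (factor ℤ.∣ h ∣ 1≤∣h∣)
      u∈S = proj₁ (proj₂ (factor ℤ.∣ h ∣ 1≤∣h∣))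
      ∣h∣≡cu = proj₂ (proj₂ (factor ℤ.∣ h ∣ 1≤∣h∣))

      instance c-nonZero : ℕ.NonZero c
               c-nonZero = ℕ.≢-nonZero (λ c≡0 → ℕₚ.<-irrefl (≡.sym (≡.trans ∣h∣≡cu (≡.cong (ℕ._* u) c≡0))) 1≤∣h∣)

      num : Fin c → Carrier
      num j = ιℕ (Fin.toℕ j)

      -- The map x ↦ h x + y identifies the solutions modulo O with O/hO. Since h = ± c u with u
      -- invertible in O, the integers 0, ..., c - 1 represent O/hO, and (j - y)/h are their
      -- preimages.
      solution : Fin c → Carrier
      solution j = h⁻¹ * (num j - y)

      h*solution : ∀ j → ι h * solution j ≈ num j - y
      h*solution j = trans (sym (*-assoc _ _ _)) (trans (*-congʳ hh⁻¹≈1) (*-identityˡ _))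

      solution-sound : ∀ j → O (ι h * solution j + y)
      solution-sound j = O-≈ (sym (trans (+-congʳ (h*solution j)) (solve 2 (λ n y → (n :- y) :+ y := n) refl (num j) y))) (O-ιℕ (Fin.toℕ j))

      solution-injective : ∀ {i j} → O (solution i - solution j) → i ≡ j
      solution-injective {i} {j} (s , s∈ , z , e) = residues-distinct i j
        (coprime-divisor {n = s} (Coprimality.sym (coprime s∈ 1≤∣h∣)) c∣s∣i-j∣)
        where
        i-j = + Fin.toℕ i ℤ.- + Fin.toℕ j
        s*[i-j]≡h*z : + s ℤ.* i-j ≡ h ℤ.* z
        s*[i-j]≡h*z = ι-injective nontrivial char0 (begin
          ι (+ s ℤ.* i-j)                          ≈⟨ trans (ι-* (+ s) i-j) (*-congˡ (trans (ι-+ (+ Fin.toℕ i) (ℤ.- + Fin.toℕ j)) (+-congˡ (ι-neg (+ Fin.toℕ j))))) ⟩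
          ι (+ s) * (num i - num j)                ≈⟨ *-congˡ (solve 3 (λ a b y → a :- b := (a :- y) :- (b :- y)) refl (num i) (num j) y) ⟩
          ι (+ s) * ((num i - y) - (num j - y))    ≈⟨ *-congˡ (+-cong (h*solution i) (-‿cong (h*solution j))) ⟨
          ι (+ s) * (ι h * solution i - ι h * solution j) ≈⟨ solve 4 (λ s h a b → s :* (h :* a :- h :* b) := h :* (s :* (a :- b))) refl (ι (+ s)) (ι h) (solution i) (solution j) ⟩
          ι h * (ι (+ s) * (solution i - solution j)) ≈⟨ *-congˡ e ⟩
          ι h * ι z                                ≈⟨ ι-* h z ⟨
          ι (h ℤ.* z)                              ∎)
        c∣s∣i-j∣ : c ℕ∣.∣ s ℕ.* ℤ.∣ i-j ∣
        c∣s∣i-j∣ = ≡.subst (c ℕ∣.∣_) (≡.trans (≡.sym (ℤₚ.abs-* h z)) (≡.trans (≡.sym (≡.cong ℤ.∣_∣ s*[i-j]≡h*z)) (ℤₚ.abs-* (+ s) i-j)))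
          (ℕ∣.∣m⇒∣m*n ℤ.∣ z ∣ (ℕ∣.divides u (≡.trans ∣h∣≡cu (ℕₚ.*-comm c u))))

      solution-near : ∀ x s → S s → ∀ z → ι (+ s) * (ι h * x + y) ≈ ι z →
        (Σ (Fin c) λ j → ∃ λ w → z ℤ.- + s ℤ.* + Fin.toℕ j ≡ + c ℤ.* w) → Σ (Fin c) λ j → O (x - solution j)
      -- Why the denominator is u s: h (x - (j - y)/h) = z/s - j = c w / s, and multiplying by u s
      -- gives c u w = ∣h∣ w, a multiple of h.
      solution-near x s s∈ z e (j , w , z-sj≡cw) = j , u ℕ.* s , *∈S u∈S s∈ , w′ , cancel h h≢0 (begin
        ι h * (ι (+ (u ℕ.* s)) * (x - solution j))
          ≡⟨ ≡.cong (λ i → ι h * (ι i * (x - solution j))) (ℤₚ.pos-* u s) ⟩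
        ι h * (ι (+ u ℤ.* + s) * (x - solution j))
          ≈⟨ *-congˡ (*-congʳ (ι-* (+ u) (+ s))) ⟩
        ι h * ((ι (+ u) * ι (+ s)) * (x - solution j))
          ≈⟨ solve 4 (λ h u s d → h :* ((u :* s) :* d) := u :* (s :* (h :* d))) refl (ι h) (ι (+ u)) (ι (+ s)) (x - solution j) ⟩
        ι (+ u) * (ι (+ s) * (ι h * (x - solution j)))
          ≈⟨ *-congˡ (*-congˡ (solve 4 (λ h x o y → h :* (x :- o) := (h :* x :+ y) :- (h :* o :+ y)) refl (ι h) x (solution j) y)) ⟩
        ι (+ u) * (ι (+ s) * ((ι h * x + y) - (ι h * solution j + y)))
          ≈⟨ *-congˡ (solve 3 (λ s a b → s :* (a :- b) := s :* a :- s :* b) refl (ι (+ s)) (ι h * x + y) (ι h * solution j + y)) ⟩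
        ι (+ u) * (ι (+ s) * (ι h * x + y) - ι (+ s) * (ι h * solution j + y))
          ≈⟨ *-congˡ (+-cong e (-‿cong (*-congˡ (trans (+-congʳ (h*solution j)) (solve 2 (λ n y → (n :- y) :+ y := n) refl (num j) y))))) ⟩
        ι (+ u) * (ι z - ι (+ s) * num j)
          ≈⟨ *-congˡ (trans (ι-+ z _) (+-congˡ (trans (ι-neg (+ s ℤ.* + Fin.toℕ j)) (-‿cong (ι-* (+ s) (+ Fin.toℕ j)))))) ⟨
        ι (+ u) * ι (z ℤ.- + s ℤ.* + Fin.toℕ j)
          ≈⟨ ι-* (+ u) (z ℤ.- + s ℤ.* + Fin.toℕ j) ⟨
        ι (+ u ℤ.* (z ℤ.- + s ℤ.* + Fin.toℕ j))
          ≡⟨ ≡.cong ι u[z-sj]≡hw′ ⟩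
        ι (h ℤ.* w′)
          ≈⟨ ι-* h w′ ⟩
        ι h * ι w′ ∎)
        where
        w′ = proj₁ (∣i∣*w≡i*w′ h w)
        ∣h∣w≡hw′ = proj₂ (∣i∣*w≡i*w′ h w)
        u[z-sj]≡hw′ : + u ℤ.* (z ℤ.- + s ℤ.* + Fin.toℕ j) ≡ h ℤ.* w′
        u[z-sj]≡hw′ = ≡.trans (≡.cong (+ u ℤ.*_) z-sj≡cw) (≡.trans
          (ℤΣ.solve 3 (λ u c w → u ℤΣ.:* (c ℤΣ.:* w) ℤΣ.:= (c ℤΣ.:* u) ℤΣ.:* w) ≡.refl (+ u) (+ c) w)
          (≡.trans (≡.cong (ℤ._* w) (≡.trans (≡.sym (ℤₚ.pos-* c u)) (≡.cong +_ (≡.sym ∣h∣≡cu)))) ∣h∣w≡hw′))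

      solution-index : ∀ x → O (ι h * x + y) → Σ (Fin c) λ j → O (x - solution j)
      solution-index x (s , s∈ , z , e) = solution-near x s s∈ z e (solve-congruence (coprime s∈ 1≤∣h∣) z)

    abstract
     count-linear : Counted (λ x x′ → O (x - x′)) (λ x → O (ι h * x + y)) (part ℤ.∣ h ∣)
     count-linear = record { enum = solution ; sound = solution-sound ; injective = solution-injective ; index = solution-index }

  dot : ℕ → (ℕ → ℤ) → (ℕ → Carrier) → Carrier
  dot n r x = sumN n (λ k → ι (r k) * x k)

  infix 4 _≋[_]_
  _≋[_]_ : (ℕ → Carrier) → ℕ → (ℕ → Carrier) → Set
  x ≋[ n ] y = ∀ k → k < n → O (x k - y k)

  ≋-isEquivalence : ∀ n → IsEquivalence (_≋[ n ]_)
  ≋-isEquivalence n = record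
    { refl  = λ k _ → O-0 (-‿inverseʳ _)
    ; sym   = λ h k k<n → O-≈ (solve 2 (λ a b → :- (a :- b) := b :- a) refl _ _) (O-neg (h k k<n))
    ; trans = λ h g k k<n → O-≈ (solve 3 (λ a b c → (a :- b) :+ (b :- c) := a :- c) refl _ _ _) (O-+ (h k k<n) (g k k<n))
    }

  dot-cong : ∀ n r {x y} → x ≋[ n ] y → O (dot n r x - dot n r y)
  dot-cong zero    r h = O-0 (-‿inverseʳ _)
  dot-cong (suc n) r {x} {y} h = O-≈
    (solve 5 (λ r a b s t → r :* (a :- b) :+ (s :- t) := (r :* a :+ s) :- (r :* b :+ t)) refl (ι (r 0)) (x 0) (y 0) _ _)
    (O-+ (O-ι* (r 0) (h 0 (s≤s z≤n))) (dot-cong n (tail r) (λ k k<n → h (suc k) (s≤s k<n))))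

  dot-lin : ∀ n c r s x → dot n (λ k → c ℤ.* r k ℤ.+ s k) x ≈ ι c * dot n r x + dot n s x
  dot-lin n c r s x = begin
    sumN n (λ k → ι (c ℤ.* r k ℤ.+ s k) * x k)
      ≈⟨ sumN-cong n (λ k _ → trans (*-congʳ (trans (ι-+ (c ℤ.* r k) (s k)) (+-congʳ (ι-* c (r k)))))
           (solve 4 (λ c r s x → (c :* r :+ s) :* x := c :* (r :* x) :+ s :* x) refl (ι c) (ι (r k)) (ι (s k)) (x k))) ⟩
    sumN n (λ k → ι c * (ι (r k) * x k) + ι (s k) * x k)
      ≈⟨ sumN-+ n (λ k → ι c * (ι (r k) * x k)) (λ k → ι (s k) * x k) ⟩
    sumN n (λ k → ι c * (ι (r k) * x k)) + dot n s x
      ≈⟨ +-congʳ (sumN-*ˡ n (ι c) (λ k → ι (r k) * x k)) ⟩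
    ι c * dot n r x + dot n s x ∎

  Solution : ∀ n {m} → Rows m → (ℕ → Carrier) → Set
  Solution n A x = All (λ r → O (dot n r x)) A

  solution⇒ : ∀ n {m} {A B : Rows m} {x} → A ⟶ B → Solution n A x → Solution n B x
  solution⇒ n done             h             = h
  solution⇒ n (then p q)       h             = solution⇒ n q (solution⇒ n p h)
  solution⇒ n (below r p)      (o ∷ h)       = o ∷ solution⇒ n p h
  solution⇒ n (rename e)       (o ∷ h)       = O-≈ (sumN-cong n (λ k _ → *-congʳ (reflexive (≡.cong ι (e k))))) o ∷ h
  solution⇒ n {x = x} (add-up c r s)   (o ∷ o′ ∷ h)  = O-≈ (sym (dot-lin n c s r x)) (O-+ (O-ι* c o′) o) ∷ o′ ∷ h
  solution⇒ n {x = x} (add-down c r s) (o ∷ o′ ∷ h)  = o ∷ O-≈ (sym (dot-lin n c r s x)) (O-+ (O-ι* c o) o′) ∷ h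

  solution⇐ : ∀ n {m} {A B : Rows m} {x} → A ⟶ B → Solution n B x → Solution n A x
  solution⇐ n done             h             = h
  solution⇐ n (then p q)       h             = solution⇐ n p (solution⇐ n q h)
  solution⇐ n (below r p)      (o ∷ h)       = o ∷ solution⇐ n p h
  solution⇐ n (rename e)       (o ∷ h)       = O-≈ (sumN-cong n (λ k _ → *-congʳ (reflexive (≡.cong ι (≡.sym (e k)))))) o ∷ h
  solution⇐ n {x = x} (add-up c r s) (o ∷ o′ ∷ h) = O-≈
    (trans (+-congʳ (dot-lin n c s r x)) (solve 2 (λ a b → (a :+ b) :- a := b) refl _ _))
    (O-- o (O-ι* c o′)) ∷ o′ ∷ h
  solution⇐ n {x = x} (add-down c r s) (o ∷ o′ ∷ h) = o ∷ O-≈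
    (trans (+-congʳ (dot-lin n c r s x)) (solve 2 (λ a b → (a :+ b) :- a := b) refl _ _))
    (O-- o′ (O-ι* c o)) ∷ h

  drop-zero : ∀ n s x → s 0 ≡ + 0 → dot (suc n) s x ≈ dot n (tail s) (λ k → x (suc k))
  drop-zero n s x e = trans (+-congʳ (trans (*-congʳ (reflexive (≡.cong ι e))) (zeroˡ _))) (+-identityˡ _)

  solution-tail : ∀ n {m} {A : Rows m} {x} → All (λ s → s 0 ≡ + 0) A →
    Solution (suc n) A x → Solution n (map tail A) (λ k → x (suc k))
  solution-tail n []       []      = []
  solution-tail n {A = s ∷ _} {x} (e ∷ es) (o ∷ h) = O-≈ (drop-zero n s x e) o ∷ solution-tail n {x = x} es h

  solution-untail : ∀ n {m} {A : Rows m} {x} → All (λ s → s 0 ≡ + 0) A →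
    Solution n (map tail A) (λ k → x (suc k)) → Solution (suc n) A x
  solution-untail n []       []      = []
  solution-untail n {A = s ∷ _} {x} (e ∷ es) (o ∷ h) = O-≈ (sym (drop-zero n s x e)) o ∷ solution-untail n {x = x} es h

  cons : Carrier → (ℕ → Carrier) → ℕ → Carrier
  cons a x zero    = a
  cons a x (suc k) = x k

  -- Back substitution: every solution of the lower equations extends in part |r₀| ways.
  count-upper : ∀ n (H : Rows n) → Upper n H → diagonal n H ≢ + 0 →
    Counted (_≋[ n ]_) (Solution n H) (part ℤ.∣ diagonal n H ∣)
  count-upper zero [] _ _ = record
    { enum      = λ _ _ → 0#
    ; sound     = λ _ → []
    ; injective = λ {i} {j} _ → ≡.trans (only i) (≡.sym (only j))
    ; index     = λ x _ → ≡.subst Fin (≡.sym part-1) Fin.zero , λ k ()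
    }
    where
    only′ : ∀ {m} → m ≡ 1 → (i j : Fin m) → i ≡ j
    only′ ≡.refl Fin.zero Fin.zero = ≡.refl
    only : ∀ i → i ≡ ≡.subst Fin (≡.sym part-1) Fin.zero
    only i = only′ part-1 i _
  count-upper (suc n) (r ∷ A) (zeros , upper) D≢0 = ≡.subst (Counted (_≋[ suc n ]_) (Solution (suc n) (r ∷ A))) (≡.sym size)
    (count-pairs pair
      (λ i j → Head.sound (Tail.enum j) i ∷ solution-untail n {x = pair i j} zeros (Tail.sound j))
      pair-injective pair-index)
    where
    D′ = diagonal n (map tail A)
    r₀≢0 : r 0 ≢ + 0
    r₀≢0 e = D≢0 (≡.cong (ℤ._* D′) e)
    D′≢0 : D′ ≢ + 0
    D′≢0 e = D≢0 (≡.trans (≡.cong (r 0 ℤ.*_) e) (ℤₚ.*-zeroʳ (r 0)))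
    size : part ℤ.∣ diagonal (suc n) (r ∷ A) ∣ ≡ part ℤ.∣ r 0 ∣ ℕ.* part ℤ.∣ D′ ∣
    size = ≡.trans (≡.cong part (ℤₚ.abs-* (r 0) D′)) (part-* (1≤∣i∣ (r 0) r₀≢0) (1≤∣i∣ D′ D′≢0))
    module Tail = Counted (count-upper n (map tail A) upper D′≢0)
    module Head x = Counted (count-linear (r 0) r₀≢0 (dot n (tail r) x))
    pair : Fin (part ℤ.∣ r 0 ∣) → Fin (part ℤ.∣ D′ ∣) → ℕ → Carrier
    pair i j = cons (Head.enum (Tail.enum j) i) (Tail.enum j)
    heads : ∀ i j k l → j ≡ l → O (Head.enum (Tail.enum j) i - Head.enum (Tail.enum l) k) → i ≡ k
    heads i j k .j ≡.refl o = Head.injective (Tail.enum j) o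
    pair-injective : ∀ i j k l → pair i j ≋[ suc n ] pair k l → i ≡ k × j ≡ l
    pair-injective i j k l h = heads i j k l j≡l (h 0 (s≤s z≤n)) , j≡l
      where
      j≡l : j ≡ l
      j≡l = Tail.injective (λ m m<n → h (suc m) (s≤s m<n))
    head-equation : ∀ x y → O (dot (suc n) r x) → (λ k → x (suc k)) ≋[ n ] y → O (ι (r 0) * x 0 + dot n (tail r) y)
    head-equation x y o h = O-≈
      (solve 3 (λ a b c → (a :+ b) :- (b :- c) := a :+ c) refl (ι (r 0) * x 0) (dot n (tail r) (λ k → x (suc k))) (dot n (tail r) y))
      (O-- o (dot-cong n (tail r) h))
    close : ∀ x i j → O (x 0 - Head.enum (Tail.enum j) i) → (λ k → x (suc k)) ≋[ n ] Tail.enum j → x ≋[ suc n ] pair i j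
    close x i j o h zero    _         = o
    close x i j o h (suc k) (s≤s k<n) = h k k<n
    pair-index : ∀ x → Solution (suc n) (r ∷ A) x →
      Σ (Fin (part ℤ.∣ r 0 ∣)) λ i → Σ (Fin (part ℤ.∣ D′ ∣)) λ j → x ≋[ suc n ] pair i j
    pair-index x (o ∷ h) =
      let (j , xt≋) = Tail.index (λ k → x (suc k)) (solution-tail n {x = x} zeros h)
          (i , x₀≈) = Head.index (Tail.enum j) (x 0) (head-equation x (Tail.enum j) o xt≋)
      in i , j , close x i j x₀≈ xt≋

  module _ (d : ℕ) (c : ℕ → ℤ) where
    T : (ℕ → Carrier) → ℕ → Carrier
    T x i = dot d (companion d c i) x

    T-cong : ∀ {x y} → x ≋[ d ] y → T x ≋[ d ] T y
    T-cong h i _ = dot-cong d (companion d c i) h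

    iter-T : ∀ n x i → i < d → iter T n x i ≈ dot d (companion^ d c n i) x
    iter-T zero    x i i<d = sym (trans (sumN-cong d (λ k _ → *-congʳ (ι-δ i k))) (sumN-δ d i x i<d))
    iter-T (suc n) x i i<d = begin
      sumN d (λ k → ι (C k) * iter T n x k)
        ≈⟨ sumN-cong d (λ k k<d → *-congˡ (iter-T n x k k<d)) ⟩
      sumN d (λ k → ι (C k) * sumN d (λ j → ι (P k j) * x j))
        ≈⟨ sumN-cong d (λ k _ → sym (sumN-*ˡ d (ι (C k)) (λ j → ι (P k j) * x j))) ⟩
      sumN d (λ k → sumN d (λ j → ι (C k) * (ι (P k j) * x j)))
        ≈⟨ sumN-comm d d (λ k j → ι (C k) * (ι (P k j) * x j)) ⟩
      sumN d (λ j → sumN d (λ k → ι (C k) * (ι (P k j) * x j)))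
        ≈⟨ sumN-cong d (λ j _ → begin
             sumN d (λ k → ι (C k) * (ι (P k j) * x j))
               ≈⟨ sumN-cong d (λ k _ → trans (solve 3 (λ a b x → a :* (b :* x) := x :* (a :* b)) refl (ι (C k)) (ι (P k j)) (x j)) (*-congˡ (sym (ι-* (C k) (P k j))))) ⟩
             sumN d (λ k → x j * ι (C k ℤ.* P k j))
               ≈⟨ sumN-*ˡ d (x j) (λ k → ι (C k ℤ.* P k j)) ⟩
             x j * sumN d (λ k → ι (C k ℤ.* P k j))
               ≈⟨ trans (*-congˡ (sym (ι-sumN d (λ k → C k ℤ.* P k j)))) (*-comm _ _) ⟩
             ι (companion^ d c (suc n) i j) * x j ∎) ⟩
      dot d (companion^ d c (suc n) i) x ∎
      where
      C = companion d c i
      P = companion^ d c n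

    dot-^-1 : ∀ n x i → i < d → dot d (companion^-1 d c n i) x ≈ iter T n x i - x i
    dot-^-1 n x i i<d = begin
      sumN d (λ k → ι (P k ℤ.- E k) * x k)
        ≈⟨ sumN-cong d (λ k _ → trans (*-congʳ (trans (ι-+ (P k) (ℤ.- E k)) (+-congˡ (ι-neg (E k)))))
             (solve 3 (λ p e x → (p :- e) :* x := p :* x :+ :- (e :* x)) refl (ι (P k)) (ι (E k)) (x k))) ⟩
      sumN d (λ k → ι (P k) * x k + - (ι (E k) * x k))
        ≈⟨ trans (sumN-+ d (λ k → ι (P k) * x k) (λ k → - (ι (E k) * x k))) (+-congˡ (sumN-neg d (λ k → ι (E k) * x k))) ⟩
      dot d P x - dot d E x
        ≈⟨ +-cong (iter-T n x i i<d) (-‿cong (iter-T 0 x i i<d)) ⟨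
      iter T n x i - x i ∎
      where
      P = companion^ d c n i
      E = ℤΣ.δ i

    all-rows⇒ : ∀ m M x → Solution d (rows m M) x → ∀ i → i < m → O (dot d (M i) x)
    all-rows⇒ (suc m) M x (o ∷ h) zero    _         = o
    all-rows⇒ (suc m) M x (o ∷ h) (suc i) (s≤s i<m) = all-rows⇒ m (λ i → M (suc i)) x h i i<m

    all-rows⇐ : ∀ m M x → (∀ i → i < m → O (dot d (M i) x)) → Solution d (rows m M) x
    all-rows⇐ zero    M x h = []
    all-rows⇐ (suc m) M x h = h 0 (s≤s z≤n) ∷ all-rows⇐ m (λ i → M (suc i)) x (λ i i<m → h (suc i) (s≤s i<m))

    count-periodic : ∀ n H → rows d (companion^-1 d c n) ⟶ H → Upper d H → diagonal d H ≢ + 0 →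
      Counted (_≋[ d ]_) (λ x → iter T n x ≋[ d ] x) (part ℤ.∣ diagonal d H ∣)
    count-periodic n H red upper D≢0 = record
      { enum      = enum
      ; sound     = λ ij i i<d → O-≈ (dot-^-1 n (enum ij) i i<d) (all-rows⇒ d _ _ (solution⇐ d red (sound ij)) i i<d)
      ; injective = injective
      ; index     = λ x h → index x (solution⇒ d red (all-rows⇐ d _ x (λ i i<d → O-≈ (sym (dot-^-1 n x i i<d)) (h i i<d))))
      }
      where open Counted (count-upper d H upper D≢0)

    torus-realisable : (Δ : ℕ → ℕ) → (∀ n → ∃ λ H → (rows d (companion^-1 d c (suc n)) ⟶ H) × Upper d H ×
      diagonal d H ≢ + 0 × ℤ.∣ diagonal d H ∣ ≡ Δ (suc n)) → Realisable (λ n → part (Δ n))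
    torus-realisable Δ reduced = realise (_≋[ d ]_) (≋-isEquivalence d) T T-cong (λ n → part (Δ n)) counted
      where
      counted : ∀ n → Counted (_≋[ d ]_) (λ x → iter T (suc n) x ≋[ d ] x) (part (Δ (suc n)))
      counted n with reduced n
      ... | H , red , upper , D≢0 , e = ≡.subst (λ m → Counted (_≋[ d ]_) (λ x → iter T (suc n) x ≋[ d ] x) (part m)) e
              (count-periodic (suc n) H red upper D≢0)

-- Companion matrices acting on ℚ/ℤ and on its p-primary part

module ℚΣ = IntegerScalars ℚₚ.+-*-commutativeRing

fromℚᵘ-+ : ∀ p q → ℚ.fromℚᵘ p ℚ.+ ℚ.fromℚᵘ q ≡ ℚ.fromℚᵘ (p ℚᵘ.+ q)
fromℚᵘ-+ p q = ℚₚ.toℚᵘ-injective (ℚᵘₚ.≃-trans (ℚₚ.toℚᵘ-homo-+ (ℚ.fromℚᵘ p) (ℚ.fromℚᵘ q))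
  (ℚᵘₚ.≃-trans (ℚᵘₚ.+-cong (ℚₚ.toℚᵘ-fromℚᵘ p) (ℚₚ.toℚᵘ-fromℚᵘ q)) (ℚᵘₚ.≃-sym (ℚₚ.toℚᵘ-fromℚᵘ (p ℚᵘ.+ q)))))

fromℚᵘ-* : ∀ p q → ℚ.fromℚᵘ p ℚ.* ℚ.fromℚᵘ q ≡ ℚ.fromℚᵘ (p ℚᵘ.* q)
fromℚᵘ-* p q = ℚₚ.toℚᵘ-injective (ℚᵘₚ.≃-trans (ℚₚ.toℚᵘ-homo-* (ℚ.fromℚᵘ p) (ℚ.fromℚᵘ q))
  (ℚᵘₚ.≃-trans (ℚᵘₚ.*-cong (ℚₚ.toℚᵘ-fromℚᵘ p) (ℚₚ.toℚᵘ-fromℚᵘ q)) (ℚᵘₚ.≃-sym (ℚₚ.toℚᵘ-fromℚᵘ (p ℚᵘ.* q)))))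

ιℕ≡/1 : ∀ n → ℚΣ.ιℕ n ≡ + n ℚ./ 1
ιℕ≡/1 zero    = ≡.refl
ιℕ≡/1 (suc n) = ≡.trans (≡.cong (ℚ.1ℚ ℚ.+_) (ιℕ≡/1 n))
  (≡.trans (fromℚᵘ-+ (mkℚᵘ (+ 1) 0) (mkℚᵘ (+ n) 0))
    (≡.cong (λ m → ℚ.fromℚᵘ (mkℚᵘ (+ 1 ℤ.+ m) 0)) (ℤₚ.*-identityʳ (+ n))))

ι-inverse-ℚ : ∀ n → ℚΣ.ιℕ (suc n) ℚ.* (+ 1 ℚ./ suc n) ≡ ℚ.1ℚ
ι-inverse-ℚ n = ≡.trans (≡.cong (ℚ._* (+ 1 ℚ./ suc n)) (ιℕ≡/1 (suc n)))
  (≡.trans (fromℚᵘ-* (mkℚᵘ (+ suc n) 0) (mkℚᵘ (+ 1) n))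
    (ℚₚ.fromℚᵘ-cong {mkℚᵘ (+ suc n) 0 ℚᵘ.* mkℚᵘ (+ 1) n} {mkℚᵘ (+ 1) 0}
      (*≡* (≡.cong +_ (≡.trans (ℕₚ.*-identityʳ _) (≡.trans (ℕₚ.*-identityʳ (suc n))
        (≡.sym (≡.trans (ℕₚ.*-identityˡ (suc (n ℕ.+ 0))) (≡.cong suc (ℕₚ.+-identityʳ n))))))))))

integers : Denominators
integers = record
  { S       = _≡ 1
  ; part    = λ h → h
  ; 1∈S     = ≡.refl
  ; *∈S     = λ { ≡.refl ≡.refl → ≡.refl }
  ; factor  = λ h _ → 1 , ≡.refl , ≡.sym (ℕₚ.*-identityʳ h)
  ; coprime = λ { {h = h} ≡.refl _ → Coprimality.1-coprimeTo h }
  ; part-1  = ≡.refl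
  ; part-*  = λ _ _ → ≡.refl
  }

coprime-* : ∀ {s a b} → Coprime s a → Coprime s b → Coprime s (a ℕ.* b)
coprime-* {s} {a} {b} s⊥a s⊥b {d} (d∣s , d∣ab) = s⊥b (d∣s , coprime-divisor {n = a} (λ (e∣d , e∣a) → s⊥a (ℕ∣.∣-trans e∣d d∣s , e∣a)) d∣ab)

module _ (p : ℕ) (p-prime : Prime p) where
  private
    instance
      p≢0 : ℕ.NonZero p
      p≢0 = Primality.prime⇒nonZero p-prime
      p-nontrivial : ℕ.NonTrivial p
      p-nontrivial = Primality.prime⇒nonTrivial p-prime

  ∤⇒coprime : ∀ {s} → ¬ p ℕ∣.∣ s → Coprime s p
  ∤⇒coprime p∤s {d} (d∣s , d∣p) with Primality.prime⇒irreducible p-prime d∣p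
  ... | inj₁ d≡1    = d≡1
  ... | inj₂ ≡.refl = ⊥-elim (p∤s d∣s)

  coprime-^ : ∀ {s} e → ¬ p ℕ∣.∣ s → Coprime s (p ^ e)
  coprime-^ {s} zero    p∤s = Coprimality.sym (Coprimality.1-coprimeTo s)
  coprime-^ {s} (suc e) p∤s = coprime-* (∤⇒coprime p∤s) (coprime-^ e p∤s)

  factorise : ∀ h → 1 ≤ h → Acc _<_ h → ∃ λ v → ∃ λ u → ¬ p ℕ∣.∣ u × h ≡ p ^ v ℕ.* u
  factorise h 1≤h (acc smaller) with p ℕ∣.∣? h
  ... | no p∤h = 0 , h , p∤h , ≡.sym (ℕₚ.*-identityˡ h)
  ... | yes (ℕ∣.divides q h≡qp) with q
  ...   | zero   = ⊥-elim (ℕₚ.<-irrefl (≡.sym h≡qp) 1≤h)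
  ...   | suc q′ with factorise (suc q′) (s≤s z≤n) (smaller (≡.subst (suc q′ <_) (≡.sym h≡qp) (ℕₚ.m<m*n (suc q′) p (ℕ.nonTrivial⇒n>1 p))))
  ...     | v , u , p∤u , q≡ = suc v , u , p∤u , ≡.trans h≡qp (≡.trans (ℕₚ.*-comm (suc q′) p)
              (≡.trans (≡.cong (p ℕ.*_) q≡) (≡.sym (ℕₚ.*-assoc p (p ^ v) u))))

  -- Junk value: the valuation of 0 is 0.
  valuation : ℕ → ℕ
  valuation zero    = 0
  valuation (suc h) = proj₁ (factorise (suc h) (s≤s z≤n) (<-wellFounded (suc h)))

  valuation-factor : ∀ h → 1 ≤ h → ∃ λ u → ¬ p ℕ∣.∣ u × h ≡ p ^ valuation h ℕ.* u
  valuation-factor (suc h) _ = proj₂ (factorise (suc h) (s≤s z≤n) (<-wellFounded (suc h)))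

  exponent-unique : ∀ a b {u v} → ¬ p ℕ∣.∣ u → ¬ p ℕ∣.∣ v → p ^ a ℕ.* u ≡ p ^ b ℕ.* v → a ≡ b
  exponent-unique zero    zero    p∤u p∤v e = ≡.refl
  exponent-unique zero    (suc b) {u} {v} p∤u p∤v e = ⊥-elim (p∤u (ℕ∣.divides (p ^ b ℕ.* v)
    (≡.trans (≡.sym (ℕₚ.*-identityˡ u)) (≡.trans e (≡.trans (ℕₚ.*-assoc p (p ^ b) v) (ℕₚ.*-comm p _))))))
  exponent-unique (suc a) zero    {u} {v} p∤u p∤v e = ⊥-elim (p∤v (ℕ∣.divides (p ^ a ℕ.* u)
    (≡.trans (≡.sym (ℕₚ.*-identityˡ v)) (≡.trans (≡.sym e) (≡.trans (ℕₚ.*-assoc p (p ^ a) u) (ℕₚ.*-comm p _))))))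
  exponent-unique (suc a) (suc b) {u} {v} p∤u p∤v e = ≡.cong suc (exponent-unique a b p∤u p∤v
    (ℕₚ.*-cancelˡ-≡ _ _ p (≡.trans (≡.sym (ℕₚ.*-assoc p (p ^ a) u)) (≡.trans e (ℕₚ.*-assoc p (p ^ b) v)))))

  valuation-unique : ∀ e {u h} → ¬ p ℕ∣.∣ u → h ≡ p ^ e ℕ.* u → 1 ≤ h → valuation h ≡ e
  valuation-unique e {h = h} p∤u h≡ 1≤h =
    let (u′ , p∤u′ , h≡′) = valuation-factor h 1≤h in exponent-unique (valuation h) e p∤u′ p∤u (≡.trans (≡.sym h≡′) h≡)

  p-part : ℕ → ℕ
  p-part h = p ^ valuation h

  p-part-1 : p-part 1 ≡ 1
  p-part-1 = ≡.cong (p ^_) (valuation-unique 0 (λ p∣1 → Primality.¬prime[1] (≡.subst Prime (ℕ∣.∣1⇒≡1 p∣1) p-prime)) ≡.refl (s≤s z≤n))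

  p-part-* : ∀ {a b} → 1 ≤ a → 1 ≤ b → p-part (a ℕ.* b) ≡ p-part a ℕ.* p-part b
  p-part-* {a} {b} 1≤a 1≤b with valuation-factor a 1≤a | valuation-factor b 1≤b
  ... | u , p∤u , a≡ | v , p∤v , b≡ = ≡.trans
    (≡.cong (p ^_) (valuation-unique (valuation a ℕ.+ valuation b) p∤uv ab≡ (ℕₚ.*-mono-≤ 1≤a 1≤b)))
    (ℕₚ.^-distribˡ-+-* p (valuation a) (valuation b))
    where
    p∤uv : ¬ p ℕ∣.∣ u ℕ.* v
    p∤uv d with Primality.euclidsLemma u v p-prime d
    ... | inj₁ p∣u = p∤u p∣u
    ... | inj₂ p∣v = p∤v p∣v
    ab≡ : a ℕ.* b ≡ p ^ (valuation a ℕ.+ valuation b) ℕ.* (u ℕ.* v)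
    ab≡ = ≡.trans (≡.cong₂ ℕ._*_ a≡ b≡) (≡.trans
      (ℕₚ.[m*n]*[o*p]≡[m*o]*[n*p] (p-part a) u (p-part b) v)
      (≡.cong (ℕ._* (u ℕ.* v)) (≡.sym (ℕₚ.^-distribˡ-+-* p (valuation a) (valuation b)))))

  isPPart-valuation : ∀ h → 1 ≤ h → IsPPart p h (valuation h)
  isPPart-valuation h 1≤h with valuation-factor h 1≤h
  ... | u , p∤u , h≡ = ℕ∣.divides u (≡.trans h≡ (ℕₚ.*-comm (p-part h) u)) , λ d →
    p∤u (ℕ∣.*-cancelˡ-∣ (p-part h) {{ℕₚ.m^n≢0 p (valuation h)}}
      (≡.subst₂ ℕ∣._∣_ (ℕₚ.*-comm p (p-part h)) h≡ d))

  localised : Denominators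
  localised = record
    { S       = λ s → ¬ p ℕ∣.∣ s
    ; part    = p-part
    ; 1∈S     = λ p∣1 → Primality.¬prime[1] (≡.subst Prime (ℕ∣.∣1⇒≡1 p∣1) p-prime)
    ; *∈S     = λ {a} {b} p∤a p∤b d → [ p∤a , p∤b ] (Primality.euclidsLemma a b p-prime d)
    ; factor  = valuation-factor
    ; coprime = λ {s} {h} p∤s _ → coprime-^ (valuation h) p∤s
    ; part-1  = p-part-1
    ; part-*  = p-part-*
    }

module ℚ/O = Torus ℚₚ.+-*-commutativeRing (λ ()) (λ n → + 1 ℚ./ suc n , ι-inverse-ℚ n)

module CompanionSystem (d : ℕ) (cs : Fin (suc d) → ℤ) (R : CommutativeRing 0ℓ 0ℓ) where
  open IntegerScalars R
  open Polynomials R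
  open ExteriorAlgebra R
  open RowDeterminant R
  open Relation.Binary.Reasoning.Setoid setoid

  module _ (dom : IsIntegralDomain) (char0 : CharZero) (α : Fin (suc d) → Carrier)
           (split : (x : Carrier) → evalMonic (suc d) cs x ≈ prodF (suc d) (λ i → x - α i))
           (no-roots-of-unity : (i : Fin (suc d)) → ¬ IsRootOfUnity (α i))
           (Δ : ℕ → ℕ)
           (Δ-product : (n : ℕ) → 1 ≤ n →
             (ι (+ Δ n) ≈ prodF (suc d) (λ i → pow (α i) n - 1#)) ⊎ (- ι (+ Δ n) ≈ prodF (suc d) (λ i → pow (α i) n - 1#))) where

    c : ℕ → ℤ
    c = monic (suc d) cs

    root-product : ℕ → Carrier
    root-product n = prodF (suc d) (λ i → pow (α i) n - 1#)

    root-product≢0 : ∀ n → 1 ≤ n → ¬ root-product n ≈ 0#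
    root-product≢0 n 1≤n = go (suc d) α no-roots-of-unity
      where
      go : ∀ m (β : Fin m → Carrier) → (∀ i → ¬ IsRootOfUnity (β i)) → ¬ prodF m (λ i → pow (β i) n - 1#) ≈ 0#
      go zero    β h e = proj₁ dom e
      go (suc m) β h e with proj₂ dom _ _ e
      ... | inj₁ f = h Fin.zero (n , 1≤n , x-y≈0⇒x≈y f)
      ... | inj₂ f = go m (λ i → β (Fin.suc i)) (λ i → h (Fin.suc i)) f

    det≈root-product : ∀ n → det (suc d) (λ i j → ι (companion^-1 (suc d) c n i j)) ≈ root-product n
    det≈root-product n = trans
      (Newton.det-companion^-1 (extend α) d c (λ j j<d → newton≈monic dom char0 (suc d) cs α split j (ℕₚ.m≤n⇒m≤1+n j<d)) n)
      (prodF-extend (suc d) α (λ a → pow a n - 1#))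

    -- The diagonal is known to be ± Δ only after applying `ι`, which is injective in characteristic
    -- zero. It is nonzero because in a domain a vanishing root product has a vanishing factor,
    -- which makes some α_i a root of unity.
    reduced : ∀ n → ∃ λ H → (rows (suc d) (companion^-1 (suc d) c (suc n)) ⟶ H) × Upper (suc d) H ×
      diagonal (suc d) H ≢ + 0 × ℤ.∣ diagonal (suc d) H ∣ ≡ Δ (suc n)
    reduced n =
      let (H , red , upper) = triangularise (suc d) (rows (suc d) (companion^-1 (suc d) c (suc n)))
      in H , red , upper , diagonal≢0 H red upper , ∣diagonal∣ H red upper
      where
      module _ (H : Rows (suc d)) (red : rows (suc d) (companion^-1 (suc d) c (suc n)) ⟶ H) (upper : Upper (suc d) H) where
        D = diagonal (suc d) H
        ιD≈root-product : ι D ≈ root-product (suc n)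
        ιD≈root-product = trans (sym (det-reduced (suc d) (companion^-1 (suc d) c (suc n)) H red upper)) (det≈root-product (suc n))
        diagonal≢0 : D ≢ + 0
        diagonal≢0 e = root-product≢0 (suc n) (s≤s z≤n) (trans (sym ιD≈root-product) (reflexive (≡.cong ι e)))
        ∣diagonal∣ : ℤ.∣ D ∣ ≡ Δ (suc n)
        ∣diagonal∣ with Δ-product (suc n) (s≤s z≤n)
        ... | inj₁ e = ≡.cong ℤ.∣_∣ (ι-injective (proj₁ dom) char0 {D} {+ Δ (suc n)} (trans ιD≈root-product (sym e)))
        ... | inj₂ e = ≡.trans
          (≡.cong ℤ.∣_∣ (ι-injective (proj₁ dom) char0 {D} {ℤ.- + Δ (suc n)} (trans ιD≈root-product (trans (sym e) (sym (ι-neg (+ Δ (suc n))))))))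
          (ℤₚ.∣-i∣≡∣i∣ (+ Δ (suc n)))

    1≤Δ : ∀ n → 1 ≤ n → 1 ≤ Δ n
    1≤Δ (suc n) _ =
      let (H , _ , _ , D≢0 , e) = reduced n in ≡.subst (1 ≤_) e (1≤∣i∣ (diagonal (suc d) H) D≢0)

    Δ-realisable : Realisable Δ
    Δ-realisable = ℚ/O.torus-realisable integers (suc d) c Δ reduced

    Δ-locally-realisable : EverywhereLocallyRealisable Δ
    Δ-locally-realisable p p-prime = (λ n → valuation p p-prime (Δ n)) ,
      (λ n 1≤n → isPPart-valuation p p-prime (Δ n) (1≤Δ n 1≤n)) ,
      ℚ/O.torus-realisable (localised p p-prime) (suc d) c Δ reduced

-- Signed surjection numbers

module SignedSurjections where
  open ≡.≡-Reasoning

  -- stirling m k = (-1)^k k! S(m,k), with S(m,k) the Stirling numbers of the second kind.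
  stirling : ℕ → ℕ → ℤ
  stirling zero    zero    = + 1
  stirling zero    (suc k) = + 0
  stirling (suc m) zero    = + 0
  stirling (suc m) (suc k) = + suc k ℤ.* (stirling m (suc k) ℤ.- stirling m k)

  stirling-above : ∀ m k → m < k → stirling m k ≡ + 0
  stirling-above zero    (suc k) _         = ≡.refl
  stirling-above (suc m) (suc k) (s≤s m<k) = ≡.trans
    (≡.cong₂ (λ a b → + suc k ℤ.* (a ℤ.- b)) (stirling-above m (suc k) (ℕₚ.m≤n⇒m≤1+n m<k)) (stirling-above m k m<k))
    (ℤₚ.*-zeroʳ (+ suc k))

  ∣stirling-diagonal∣ : ∀ k → ℤ.∣ stirling k k ∣ ≡ k !
  ∣stirling-diagonal∣ zero    = ≡.refl
  ∣stirling-diagonal∣ (suc k) = begin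
    ℤ.∣ + suc k ℤ.* (stirling k (suc k) ℤ.- stirling k k) ∣
      ≡⟨ ℤₚ.abs-* (+ suc k) (stirling k (suc k) ℤ.- stirling k k) ⟩
    suc k ℕ.* ℤ.∣ stirling k (suc k) ℤ.- stirling k k ∣
      ≡⟨ ≡.cong (λ z → suc k ℕ.* ℤ.∣ z ℤ.- stirling k k ∣) (stirling-above k (suc k) ℕₚ.≤-refl) ⟩
    suc k ℕ.* ℤ.∣ + 0 ℤ.- stirling k k ∣
      ≡⟨ ≡.cong (λ z → suc k ℕ.* ℤ.∣ z ∣) (ℤₚ.+-identityˡ (ℤ.- stirling k k)) ⟩
    suc k ℕ.* ℤ.∣ ℤ.- stirling k k ∣
      ≡⟨ ≡.cong (suc k ℕ.*_) (≡.trans (ℤₚ.∣-i∣≡∣i∣ (stirling k k)) (∣stirling-diagonal∣ k)) ⟩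
    suc k ℕ.* k ! ∎

  k!∣stirling : ∀ m k → + (k !) ∣ stirling m k
  k!∣stirling zero    zero    = ℤ∣.∣-refl
  k!∣stirling zero    (suc k) = divides (+ 0) ≡.refl
  k!∣stirling (suc m) zero    = divides (+ 0) ≡.refl
  k!∣stirling (suc m) (suc k) with k!∣stirling m (suc k) | k!∣stirling m k
  ... | divides a e | divides b f = divides (+ suc k ℤ.* a ℤ.- b) (begin
    + suc k ℤ.* (stirling m (suc k) ℤ.- stirling m k)
      ≡⟨ ≡.cong₂ (λ x y → + suc k ℤ.* (x ℤ.- y)) (≡.trans e (≡.cong (a ℤ.*_) (ℤₚ.pos-* (suc k) (k !)))) f ⟩
    + suc k ℤ.* (a ℤ.* (+ suc k ℤ.* + (k !)) ℤ.- b ℤ.* + (k !))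
      ≡⟨ ℤΣ.solve 4 (λ s a b x → s ℤΣ.:* (a ℤΣ.:* (s ℤΣ.:* x) ℤΣ.:- b ℤΣ.:* x) ℤΣ.:= (s ℤΣ.:* a ℤΣ.:- b) ℤΣ.:* (s ℤΣ.:* x)) ≡.refl (+ suc k) a b (+ (k !)) ⟩
    (+ suc k ℤ.* a ℤ.- b) ℤ.* (+ suc k ℤ.* + (k !))
      ≡⟨ ≡.cong ((+ suc k ℤ.* a ℤ.- b) ℤ.*_) (ℤₚ.pos-* (suc k) (k !)) ⟨
    (+ suc k ℤ.* a ℤ.- b) ℤ.* + (suc k !) ∎)

  -- Backward differences: diff k g x = Σ_j (-1)^j C(k,j) g (x + j).
  diff : ℕ → (ℕ → ℤ) → ℕ → ℤ
  diff zero    g x = g x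
  diff (suc k) g x = diff k g x ℤ.- diff k g (suc x)

  power : ℕ → ℕ → ℤ
  power zero    x = + 1
  power (suc m) x = + x ℤ.* power m x

  -- A discrete product rule for multiplication by x. At x = 0 the first term drops out and what
  -- remains is the recursion of `stirling`.
  diff-leibniz : ∀ k h x →
    diff (suc k) (λ x → + x ℤ.* h x) x ≡ + x ℤ.* diff (suc k) h x ℤ.- + suc k ℤ.* diff k h (suc x)
  diff-leibniz zero h x = begin
    + x ℤ.* h x ℤ.- + suc x ℤ.* h (suc x)
      ≡⟨ ≡.cong (λ y → + x ℤ.* h x ℤ.- y ℤ.* h (suc x)) (ℤₚ.pos-+ 1 x) ⟩
    + x ℤ.* h x ℤ.- (+ 1 ℤ.+ + x) ℤ.* h (suc x)
      ≡⟨ ℤΣ.solve 3 (λ x a b → x ℤΣ.:* a ℤΣ.:- (ℤΣ.con (+ 1) ℤΣ.:+ x) ℤΣ.:* b ℤΣ.:= x ℤΣ.:* (a ℤΣ.:- b) ℤΣ.:- ℤΣ.con (+ 1) ℤΣ.:* b) ≡.refl (+ x) (h x) (h (suc x)) ⟩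
    + x ℤ.* (h x ℤ.- h (suc x)) ℤ.- + 1 ℤ.* h (suc x) ∎
  diff-leibniz (suc k) h x = begin
    diff (suc k) xh x ℤ.- diff (suc k) xh (suc x)
      ≡⟨ ≡.cong₂ ℤ._-_ (diff-leibniz k h x) (diff-leibniz k h (suc x)) ⟩
    (+ x ℤ.* (d ℤ.- a) ℤ.- + suc k ℤ.* a) ℤ.- (+ suc x ℤ.* (a ℤ.- b) ℤ.- + suc k ℤ.* b)
      ≡⟨ ≡.cong (λ y → (+ x ℤ.* (d ℤ.- a) ℤ.- + suc k ℤ.* a) ℤ.- (y ℤ.* (a ℤ.- b) ℤ.- + suc k ℤ.* b)) (ℤₚ.pos-+ 1 x) ⟩
    (+ x ℤ.* (d ℤ.- a) ℤ.- + suc k ℤ.* a) ℤ.- ((+ 1 ℤ.+ + x) ℤ.* (a ℤ.- b) ℤ.- + suc k ℤ.* b)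
      ≡⟨ ℤΣ.solve 5 (λ x s d a b → (x ℤΣ.:* (d ℤΣ.:- a) ℤΣ.:- s ℤΣ.:* a) ℤΣ.:- ((ℤΣ.con (+ 1) ℤΣ.:+ x) ℤΣ.:* (a ℤΣ.:- b) ℤΣ.:- s ℤΣ.:* b)
           ℤΣ.:= x ℤΣ.:* ((d ℤΣ.:- a) ℤΣ.:- (a ℤΣ.:- b)) ℤΣ.:- (ℤΣ.con (+ 1) ℤΣ.:+ s) ℤΣ.:* (a ℤΣ.:- b)) ≡.refl (+ x) (+ suc k) d a b ⟩
    + x ℤ.* ((d ℤ.- a) ℤ.- (a ℤ.- b)) ℤ.- (+ 1 ℤ.+ + suc k) ℤ.* (a ℤ.- b)
      ≡⟨ ≡.cong (λ y → + x ℤ.* ((d ℤ.- a) ℤ.- (a ℤ.- b)) ℤ.- y ℤ.* (a ℤ.- b)) (ℤₚ.pos-+ 1 (suc k)) ⟨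
    + x ℤ.* ((d ℤ.- a) ℤ.- (a ℤ.- b)) ℤ.- + suc (suc k) ℤ.* (a ℤ.- b) ∎
    where
    xh = λ x → + x ℤ.* h x
    d = diff k h x
    a = diff k h (suc x)
    b = diff k h (suc (suc x))

  diff-const : ∀ k z x → diff (suc k) (λ _ → z) x ≡ + 0
  diff-const zero    z x = ℤₚ.+-inverseʳ z
  diff-const (suc k) z x = ≡.cong₂ ℤ._-_ (diff-const k z x) (diff-const k z (suc x))

  -- Inclusion-exclusion for surjections: (-1)^k k! S(m,k) = Σ_j (-1)^j C(k,j) j^m, with 0^0 = 1.
  -- Facts about powers, such as the binomial theorem and Fermat's theorem, thereby pass to
  -- `stirling`.
  stirling≡diff : ∀ m k → stirling m k ≡ diff k (power m) 0
  stirling≡diff zero    zero    = ≡.refl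
  stirling≡diff zero    (suc k) = ≡.sym (diff-const k (+ 1) 0)
  stirling≡diff (suc m) zero    = ≡.refl
  stirling≡diff (suc m) (suc k) = begin
    + suc k ℤ.* (stirling m (suc k) ℤ.- stirling m k)
      ≡⟨ ≡.cong₂ (λ a b → + suc k ℤ.* (a ℤ.- b)) (stirling≡diff m (suc k)) (stirling≡diff m k) ⟩
    + suc k ℤ.* ((d ℤ.- a) ℤ.- d)
      ≡⟨ ℤΣ.solve 3 (λ s d a → s ℤΣ.:* ((d ℤΣ.:- a) ℤΣ.:- d) ℤΣ.:= ℤΣ.con (+ 0) ℤΣ.:* (d ℤΣ.:- a) ℤΣ.:- s ℤΣ.:* a) ≡.refl (+ suc k) d a ⟩
    + 0 ℤ.* (d ℤ.- a) ℤ.- + suc k ℤ.* a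
      ≡⟨ diff-leibniz k (power m) 0 ⟨
    diff (suc k) (power (suc m)) 0 ∎
    where
    d = diff k (power m) 0
    a = diff k (power m) 1

  diff-cong : ∀ k {g h} → (∀ x → g x ≡ h x) → ∀ x → diff k g x ≡ diff k h x
  diff-cong zero    e x = e x
  diff-cong (suc k) e x = ≡.cong₂ ℤ._-_ (diff-cong k e x) (diff-cong k e (suc x))

  diff-shift : ∀ k g x → diff k (λ x → g (suc x)) x ≡ diff k g (suc x)
  diff-shift zero    g x = ≡.refl
  diff-shift (suc k) g x = ≡.cong₂ ℤ._-_ (diff-shift k g x) (diff-shift k g (suc x))

  diff-- : ∀ k g h x → diff k (λ x → g x ℤ.- h x) x ≡ diff k g x ℤ.- diff k h x
  diff-- zero    g h x = ≡.refl
  diff-- (suc k) g h x = ≡.trans (≡.cong₂ ℤ._-_ (diff-- k g h x) (diff-- k g h (suc x)))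
    (ℤΣ.solve 4 (λ a b c d → (a ℤΣ.:- b) ℤΣ.:- (c ℤΣ.:- d) ℤΣ.:= (a ℤΣ.:- c) ℤΣ.:- (b ℤΣ.:- d)) ≡.refl
      (diff k g x) (diff k h x) (diff k g (suc x)) (diff k h (suc x)))

  diff-sum : ∀ k n (c : ℕ → ℤ) (f : ℕ → ℕ → ℤ) x →
    diff k (λ x → ℤΣ.sumN n (λ i → c i ℤ.* f i x)) x ≡ ℤΣ.sumN n (λ i → c i ℤ.* diff k (f i) x)
  diff-sum zero    n c f x = ≡.refl
  diff-sum (suc k) n c f x = begin
    diff k g x ℤ.- diff k g (suc x)
      ≡⟨ ≡.cong₂ ℤ._-_ (diff-sum k n c f x) (diff-sum k n c f (suc x)) ⟩
    ℤΣ.sumN n (λ i → c i ℤ.* diff k (f i) x) ℤ.- ℤΣ.sumN n (λ i → c i ℤ.* diff k (f i) (suc x))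
      ≡⟨ ≡.trans (ℤΣ.sumN-+ n (λ i → c i ℤ.* diff k (f i) x) (λ i → ℤ.- (c i ℤ.* diff k (f i) (suc x))))
           (≡.cong (ℤ._+_ (ℤΣ.sumN n (λ i → c i ℤ.* diff k (f i) x))) (ℤΣ.sumN-neg n (λ i → c i ℤ.* diff k (f i) (suc x)))) ⟨
    ℤΣ.sumN n (λ i → c i ℤ.* diff k (f i) x ℤ.- c i ℤ.* diff k (f i) (suc x))
      ≡⟨ ℤΣ.sumN-cong n (λ i _ → ℤΣ.solve 3 (λ c a b → c ℤΣ.:* a ℤΣ.:- c ℤΣ.:* b ℤΣ.:= c ℤΣ.:* (a ℤΣ.:- b)) ≡.refl (c i) (diff k (f i) x) (diff k (f i) (suc x))) ⟩
    ℤΣ.sumN n (λ i → c i ℤ.* diff (suc k) (f i) x) ∎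
    where g = λ x → ℤΣ.sumN n (λ i → c i ℤ.* f i x)

  binomial : ∀ n x → power n (suc x) ≡ ℤΣ.sumN (suc n) (λ i → + (n C i) ℤ.* power i x)
  binomial zero    x = ≡.refl
  binomial (suc n) x = begin
    + suc x ℤ.* power n (suc x)
      ≡⟨ ≡.cong₂ ℤ._*_ (ℤₚ.pos-+ 1 x) (binomial n x) ⟩
    (+ 1 ℤ.+ + x) ℤ.* Σn
      ≡⟨ ℤΣ.solve 2 (λ x s → (ℤΣ.con (+ 1) ℤΣ.:+ x) ℤΣ.:* s ℤΣ.:= s ℤΣ.:+ x ℤΣ.:* s) ≡.refl (+ x) Σn ⟩
    Σn ℤ.+ + x ℤ.* Σn
      ≡⟨ ≡.cong₂ ℤ._+_ (≡.sym drop-last) (≡.sym (ℤΣ.sumN-*ˡ (suc n) (+ x) term)) ⟩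
    (term 0 ℤ.+ ℤΣ.sumN (suc n) (λ i → term (suc i))) ℤ.+ ℤΣ.sumN (suc n) (λ i → + x ℤ.* term i)
      ≡⟨ ℤₚ.+-assoc (term 0) (ℤΣ.sumN (suc n) (λ i → term (suc i))) (ℤΣ.sumN (suc n) (λ i → + x ℤ.* term i)) ⟩
    term 0 ℤ.+ (ℤΣ.sumN (suc n) (λ i → term (suc i)) ℤ.+ ℤΣ.sumN (suc n) (λ i → + x ℤ.* term i))
      ≡⟨ ≡.cong (ℤ._+_ (term 0)) (ℤΣ.sumN-+ (suc n) (λ i → term (suc i)) (λ i → + x ℤ.* term i)) ⟨
    term 0 ℤ.+ ℤΣ.sumN (suc n) (λ i → term (suc i) ℤ.+ + x ℤ.* term i)
      ≡⟨ ≡.cong (ℤ._+_ (term 0)) (ℤΣ.sumN-cong (suc n) (λ i _ → pascal i)) ⟩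
    term 0 ℤ.+ ℤΣ.sumN (suc n) (λ i → + (suc n C suc i) ℤ.* power (suc i) x) ∎
    where
    term : ℕ → ℤ
    term i = + (n C i) ℤ.* power i x
    Σn = ℤΣ.sumN (suc n) term
    drop-last : term 0 ℤ.+ ℤΣ.sumN (suc n) (λ i → term (suc i)) ≡ Σn
    drop-last = ≡.trans (ℤΣ.sumN-last (suc n) term)
      (≡.trans (≡.cong (λ b → Σn ℤ.+ + b ℤ.* power (suc n) x) (k>n⇒nCk≡0 (ℕₚ.n<1+n n))) (ℤₚ.+-identityʳ Σn))
    pascal : ∀ i → term (suc i) ℤ.+ + x ℤ.* term i ≡ + (suc n C suc i) ℤ.* power (suc i) x
    pascal i = begin
      + (n C suc i) ℤ.* (+ x ℤ.* power i x) ℤ.+ + x ℤ.* (+ (n C i) ℤ.* power i x)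
        ≡⟨ ℤΣ.solve 4 (λ a b x p → a ℤΣ.:* (x ℤΣ.:* p) ℤΣ.:+ x ℤΣ.:* (b ℤΣ.:* p) ℤΣ.:= (b ℤΣ.:+ a) ℤΣ.:* (x ℤΣ.:* p)) ≡.refl (+ (n C suc i)) (+ (n C i)) (+ x) (power i x) ⟩
      + (n C i ℕ.+ n C suc i) ℤ.* power (suc i) x
        ≡⟨ ≡.cong (λ b → + b ℤ.* power (suc i) x) (nCk+nC[k+1]≡[n+1]C[k+1] n i) ⟩
      + (suc n C suc i) ℤ.* power (suc i) x ∎

  -- By the binomial theorem Σ_{i<n} C(n,i) x^i = (x+1)^n - x^n, and `diff k` of this is minus
  -- `diff (suc k)` of x^n. The sum has the shape of the Bernoulli recurrence.
  stirling-convolution : ∀ n k → ℤΣ.sumN n (λ i → + (n C i) ℤ.* stirling i k) ≡ ℤ.- stirling n (suc k)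
  stirling-convolution n k = begin
    ℤΣ.sumN n (λ i → + (n C i) ℤ.* stirling i k)
      ≡⟨ ℤΣ.sumN-cong n (λ i _ → ≡.cong (+ (n C i) ℤ.*_) (stirling≡diff i k)) ⟩
    ℤΣ.sumN n (λ i → + (n C i) ℤ.* diff k (power i) 0)
      ≡⟨ diff-sum k n (λ i → + (n C i)) power 0 ⟨
    diff k (λ x → ℤΣ.sumN n (λ i → + (n C i) ℤ.* power i x)) 0
      ≡⟨ diff-cong k increment 0 ⟩
    diff k (λ x → power n (suc x) ℤ.- power n x) 0
      ≡⟨ diff-- k (λ x → power n (suc x)) (power n) 0 ⟩
    diff k (λ x → power n (suc x)) 0 ℤ.- diff k (power n) 0
      ≡⟨ ≡.cong (ℤ._- diff k (power n) 0) (diff-shift k (power n) 0) ⟩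
    diff k (power n) 1 ℤ.- diff k (power n) 0
      ≡⟨ ℤΣ.solve 2 (λ a b → a ℤΣ.:- b ℤΣ.:= ℤΣ.:- (b ℤΣ.:- a)) ≡.refl (diff k (power n) 1) (diff k (power n) 0) ⟩
    ℤ.- diff (suc k) (power n) 0
      ≡⟨ ≡.cong ℤ.-_ (stirling≡diff n (suc k)) ⟨
    ℤ.- stirling n (suc k) ∎
    where
    increment : ∀ x → ℤΣ.sumN n (λ i → + (n C i) ℤ.* power i x) ≡ power n (suc x) ℤ.- power n x
    increment x = begin
      S                                              ≡⟨ ℤΣ.solve 2 (λ s p → s ℤΣ.:= (s ℤΣ.:+ ℤΣ.con (+ 1) ℤΣ.:* p) ℤΣ.:- p) ≡.refl S (power n x) ⟩
      (S ℤ.+ + 1 ℤ.* power n x) ℤ.- power n x        ≡⟨ ≡.cong (λ b → (S ℤ.+ + b ℤ.* power n x) ℤ.- power n x) (nCn≡1 n) ⟨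
      (S ℤ.+ + (n C n) ℤ.* power n x) ℤ.- power n x  ≡⟨ ≡.cong (ℤ._- power n x) (ℤΣ.sumN-last n (λ i → + (n C i) ℤ.* power i x)) ⟨
      ℤΣ.sumN (suc n) (λ i → + (n C i) ℤ.* power i x) ℤ.- power n x ≡⟨ ≡.cong (ℤ._- power n x) (binomial n x) ⟨
      power n (suc x) ℤ.- power n x ∎
      where S = ℤΣ.sumN n (λ i → + (n C i) ℤ.* power i x)

  absorption : ∀ n k → suc k ℕ.* (suc n C suc k) ≡ suc n ℕ.* (n C k)
  absorption zero    zero    = ≡.refl
  absorption zero    (suc k) = ≡.trans
    (≡.cong (suc (suc k) ℕ.*_) (k>n⇒nCk≡0 {1} {suc (suc k)} (s≤s (s≤s z≤n))))
    (≡.trans (ℕₚ.*-zeroʳ (suc (suc k))) (≡.sym (≡.trans (ℕₚ.*-identityˡ (0 C suc k)) (k>n⇒nCk≡0 {0} {suc k} (s≤s z≤n)))))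
  absorption (suc n) zero    = ≡.trans (ℕₚ.*-identityˡ _) (≡.trans (nC1≡n (suc (suc n))) (≡.sym (ℕₚ.*-identityʳ (suc (suc n)))))
  absorption (suc n) (suc k) = begin
    suc (suc k) ℕ.* (suc (suc n) C suc (suc k))
      ≡⟨ ≡.cong (suc (suc k) ℕ.*_) (nCk+nC[k+1]≡[n+1]C[k+1] (suc n) (suc k)) ⟨
    suc (suc k) ℕ.* (c ℕ.+ suc n C suc (suc k))
      ≡⟨ ℕₚ.*-distribˡ-+ (suc (suc k)) c _ ⟩
    (c ℕ.+ suc k ℕ.* c) ℕ.+ suc (suc k) ℕ.* (suc n C suc (suc k))
      ≡⟨ ≡.cong₂ (λ a b → (c ℕ.+ a) ℕ.+ b) (absorption n k) (absorption n (suc k)) ⟩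
    (c ℕ.+ suc n ℕ.* (n C k)) ℕ.+ suc n ℕ.* (n C suc k)
      ≡⟨ ≡.trans (ℕₚ.+-assoc c _ _) (≡.cong (c ℕ.+_) (≡.sym (ℕₚ.*-distribˡ-+ (suc n) (n C k) (n C suc k)))) ⟩
    c ℕ.+ suc n ℕ.* (n C k ℕ.+ n C suc k)
      ≡⟨ ≡.cong (λ a → c ℕ.+ suc n ℕ.* a) (nCk+nC[k+1]≡[n+1]C[k+1] n k) ⟩
    suc (suc n) ℕ.* c ∎
    where c = suc n C suc k

  module _ (k : ℕ) (p-prime : Prime (suc k)) where
    private p = suc k

    prime∣binomial : ∀ i → suc i < p → p ℕ∣.∣ p C suc i
    prime∣binomial i i<p with Primality.euclidsLemma (suc i) (p C suc i) p-prime (ℕ∣.divides (k C i) (≡.trans (absorption k i) (ℕₚ.*-comm p (k C i))))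
    ... | inj₁ p∣i = ⊥-elim (ℕₚ.<⇒≱ i<p (ℕ∣.∣⇒≤ p∣i))
    ... | inj₂ p∣C = p∣C

    ∣-sumN : ∀ n {f} → (∀ i → i < n → + p ∣ f i) → + p ∣ ℤΣ.sumN n f
    ∣-sumN zero    h = divides (+ 0) ≡.refl
    ∣-sumN (suc n) h = ℤ∣.∣m∣n⇒∣m+n (h 0 (s≤s z≤n)) (∣-sumN n (λ i i<n → h (suc i) (s≤s i<n)))

    fermat : ∀ x → + p ∣ power p x ℤ.- + x
    fermat zero    = divides (+ 0) ≡.refl
    fermat (suc x) = ≡.subst (+ p ∣_) (≡.sym split) (ℤ∣.∣m∣n⇒∣m+n (∣-sumN k middle) (fermat x))
      where
      term : ℕ → ℤ
      term i = + (p C i) ℤ.* power i x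
      middle : ∀ i → i < k → + p ∣ term (suc i)
      middle i i<k = ℤ∣.∣m⇒∣m*n {m = + (p C suc i)} (power (suc i) x) (ℤ∣.∣ᵤ⇒∣ (prime∣binomial i (s≤s i<k)))
      M = ℤΣ.sumN k (λ i → term (suc i))
      split : power p (suc x) ℤ.- + suc x ≡ M ℤ.+ (power p x ℤ.- + x)
      split = begin
        power p (suc x) ℤ.- + suc x
          ≡⟨ ≡.cong₂ ℤ._-_ (binomial p x) (ℤₚ.pos-+ 1 x) ⟩
        (+ 1 ℤ.+ ℤΣ.sumN (suc k) (λ i → term (suc i))) ℤ.- (+ 1 ℤ.+ + x)
          ≡⟨ ≡.cong (λ s → (+ 1 ℤ.+ s) ℤ.- (+ 1 ℤ.+ + x)) (ℤΣ.sumN-last k (λ i → term (suc i))) ⟩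
        (+ 1 ℤ.+ (M ℤ.+ + (p C p) ℤ.* power p x)) ℤ.- (+ 1 ℤ.+ + x)
          ≡⟨ ≡.cong (λ b → (+ 1 ℤ.+ (M ℤ.+ + b ℤ.* power p x)) ℤ.- (+ 1 ℤ.+ + x)) (nCn≡1 p) ⟩
        (+ 1 ℤ.+ (M ℤ.+ + 1 ℤ.* power p x)) ℤ.- (+ 1 ℤ.+ + x)
          ≡⟨ ℤΣ.solve 3 (λ m q x → (ℤΣ.con (+ 1) ℤΣ.:+ (m ℤΣ.:+ ℤΣ.con (+ 1) ℤΣ.:* q)) ℤΣ.:- (ℤΣ.con (+ 1) ℤΣ.:+ x) ℤΣ.:= m ℤΣ.:+ (q ℤΣ.:- x)) ≡.refl M (power p x) (+ x) ⟩
        M ℤ.+ (power p x ℤ.- + x) ∎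

    power-periodic : ∀ m x → + p ∣ power (m ℕ.+ p) x ℤ.- power (suc m) x
    power-periodic zero    x = ≡.subst (λ y → + p ∣ power p x ℤ.- y) (≡.sym (ℤₚ.*-identityʳ (+ x))) (fermat x)
    power-periodic (suc m) x = ≡.subst (+ p ∣_)
      (ℤΣ.solve 3 (λ x a b → x ℤΣ.:* (a ℤΣ.:- b) ℤΣ.:= x ℤΣ.:* a ℤΣ.:- x ℤΣ.:* b) ≡.refl (+ x) (power (m ℕ.+ p) x) (power (suc m) x))
      (ℤ∣.∣n⇒∣m*n (+ x) (power-periodic m x))

    ∣-diff : ∀ j {g} → (∀ x → + p ∣ g x) → ∀ x → + p ∣ diff j g x
    ∣-diff zero    h x = h x
    ∣-diff (suc j) h x = ℤ∣.∣m∣n⇒∣m-n (∣-diff j h x) (∣-diff j h (suc x))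

    -- Fermat's theorem passes through the differences: for positive exponents x^m modulo p depends
    -- only on m modulo p - 1 = k.
    stirling-periodic : ∀ m j → + p ∣ stirling (suc m ℕ.+ k) j ℤ.- stirling (suc m) j
    stirling-periodic m j = ≡.subst (+ p ∣_) (begin
      diff j (λ x → power (m ℕ.+ p) x ℤ.- power (suc m) x) 0
        ≡⟨ diff-- j (power (m ℕ.+ p)) (power (suc m)) 0 ⟩
      diff j (power (m ℕ.+ p)) 0 ℤ.- diff j (power (suc m)) 0
        ≡⟨ ≡.cong₂ ℤ._-_ (stirling≡diff (m ℕ.+ p) j) (stirling≡diff (suc m) j) ⟨
      stirling (m ℕ.+ p) j ℤ.- stirling (suc m) j
        ≡⟨ ≡.cong (λ l → stirling l j ℤ.- stirling (suc m) j) (ℕₚ.+-suc m k) ⟩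
      stirling (suc m ℕ.+ k) j ℤ.- stirling (suc m) j ∎) (∣-diff j (power-periodic m) 0)

    stirling-residue : ∀ a b → + p ∣ stirling (suc a ℕ.+ b ℕ.* k) k ℤ.- stirling (suc a) k
    stirling-residue a zero    = ≡.subst (λ l → + p ∣ stirling l k ℤ.- stirling (suc a) k) (≡.sym (ℕₚ.+-identityʳ (suc a)))
      (divides (+ 0) (ℤₚ.+-inverseʳ (stirling (suc a) k)))
    stirling-residue a (suc b) = ≡.subst (+ p ∣_) e
      (ℤ∣.∣m∣n⇒∣m+n (stirling-periodic (a ℕ.+ b ℕ.* k) k) (stirling-residue a b))
      where
      l = suc a ℕ.+ b ℕ.* k
      index : l ℕ.+ k ≡ suc a ℕ.+ (k ℕ.+ b ℕ.* k)
      index = ≡.trans (ℕₚ.+-assoc (suc a) (b ℕ.* k) k) (≡.cong (suc a ℕ.+_) (ℕₚ.+-comm (b ℕ.* k) k))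
      e : (stirling (l ℕ.+ k) k ℤ.- stirling l k) ℤ.+ (stirling l k ℤ.- stirling (suc a) k)
        ≡ stirling (suc a ℕ.+ (k ℕ.+ b ℕ.* k)) k ℤ.- stirling (suc a) k
      e = ≡.trans (ℤΣ.solve 3 (λ x y z → (x ℤΣ.:- y) ℤΣ.:+ (y ℤΣ.:- z) ℤΣ.:= x ℤΣ.:- z) ≡.refl (stirling (l ℕ.+ k) k) (stirling l k) (stirling (suc a) k))
        (≡.cong (λ i → stirling i k ℤ.- stirling (suc a) k) index)

    prime∤! : ∀ j → j < p → ¬ p ℕ∣.∣ j !
    prime∤! zero    _   p∣1 = Primality.¬prime[1] (≡.subst Prime (ℕ∣.∣1⇒≡1 p∣1) p-prime)
    prime∤! (suc j) j<p d with Primality.euclidsLemma (suc j) (j !) p-prime d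
    ... | inj₁ p∣j = ℕₚ.<⇒≱ j<p (ℕ∣.∣⇒≤ p∣j)
    ... | inj₂ p∣j! = prime∤! j (ℕₚ.<⇒≤ j<p) p∣j!

    -- Periodicity reduces m to k itself, where the value is ± k!, prime to p = k + 1.
    prime∤stirling : ∀ m → 1 ≤ m → k ℕ∣.∣ m → ¬ + p ∣ stirling m k
    prime∤stirling m 1≤m (ℕ∣.divides zero    e) d = ℕₚ.<-irrefl (≡.sym e) 1≤m
    prime∤stirling m 1≤m (ℕ∣.divides (suc b) e) d = go k ≡.refl
      where
      go : ∀ k′ → k′ ≡ k → ⊥
      go zero    ≡.refl = Primality.¬prime[1] p-prime
      go (suc a) ≡.refl = prime∤! k ℕₚ.≤-refl (≡.subst (p ℕ∣.∣_) (∣stirling-diagonal∣ k)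
        (ℤ∣.∣⇒∣ᵤ (ℤ∣.∣m+n∣m⇒∣n {m = stirling m k ℤ.- stirling k k}
          (≡.subst (+ p ∣_) (ℤΣ.solve 2 (λ x y → x ℤΣ.:= (x ℤΣ.:- y) ℤΣ.:+ y) ≡.refl (stirling m k) (stirling k k)) d)
          (≡.subst (λ l → + p ∣ stirling l k ℤ.- stirling k k) (≡.sym e) (stirling-residue a b)))))

    -- Periodicity reduces m to its remainder r with 0 < r < k, and `stirling r k` is zero above the
    -- diagonal.
    prime∣stirling : ∀ m → 1 ≤ m → ¬ k ℕ∣.∣ m → + p ∣ stirling m k
    prime∣stirling m 1≤m k∤m = go k ≡.refl
      where
      go : ∀ k′ → k′ ≡ k → + p ∣ stirling m k
      go zero    ≡.refl = ⊥-elim (Primality.¬prime[1] p-prime)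
      go (suc _) ≡.refl = residue (m D.% k) (m D./ k) (D.m%n<n m k) (D.m≡m%n+[m/n]*n m k)
        where
        import Data.Nat.DivMod as D
        residue : ∀ r q → r < k → m ≡ r ℕ.+ q ℕ.* k → + p ∣ stirling m k
        residue zero    q _   e = ⊥-elim (k∤m (ℕ∣.divides q e))
        residue (suc a) q a<k e = ≡.subst (+ p ∣_)
          (begin
            stirling l k ℤ.- stirling (suc a) k   ≡⟨ ≡.cong (λ z → stirling l k ℤ.- z) (stirling-above (suc a) k a<k) ⟩
            stirling l k ℤ.- + 0                  ≡⟨ ℤₚ.+-identityʳ (stirling l k) ⟩
            stirling l k                          ≡⟨ ≡.cong (λ i → stirling i k) e ⟨
            stirling m k ∎)
          (stirling-residue a q)
          where l = suc a ℕ.+ q ℕ.* k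

  product∣! : ∀ a b k → 1 ≤ a → a < b → b ≤ k → a ℕ.* b ℕ∣.∣ k !
  product∣! (suc a) (suc b) k _ (s≤s a<b) b≤k = ℕ∣.∣-trans
    (≡.subst (ℕ∣._∣ (suc b) !) (ℕₚ.*-comm (suc b) (suc a)) (ℕ∣.*-monoʳ-∣ (suc b) (ℕ∣.∣-trans (ℕ∣.m∣m*n (a !)) (ℕ∣.m≤n⇒m!∣n! a<b))))
    (ℕ∣.m≤n⇒m!∣n! b≤k)

  -- The only composite k + 1 that does not divide k! is 4, so column 3 has to be examined by hand.
  -- Two steps of the recursion reproduce these residues of columns 0 to 3, starting from m = 2;
  -- this is where evenness of the upper index enters.
  Mod4 : ℕ → Set
  Mod4 m = stirling m 0 ≡ + 0 × stirling m 1 ≡ ℤ.- + 1 ×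
    (∃ λ w → stirling m 2 ≡ + 4 ℤ.* w ℤ.+ + 2) × (∃ λ z → stirling m 3 ≡ + 4 ℤ.* z)

  mod4-step : ∀ m → Mod4 m → Mod4 (2 ℕ.+ m)
  mod4-step m (s₀ , s₁ , (w , s₂) , (z , s₃)) = ≡.refl , t₁ , (+ 4 ℤ.* w ℤ.+ + 3 , t₂) , (+ 9 ℤ.* z ℤ.- + 15 ℤ.* w ℤ.- + 9 , t₃)
    where
    c : ∀ {n} → ℤ → ℤΣ.Solver.Polynomial n
    c = ℤΣ.con
    r₁ : stirling (suc m) 1 ≡ ℤ.- + 1
    r₁ = ≡.cong₂ (λ a b → + 1 ℤ.* (a ℤ.- b)) s₁ s₀
    r₂ : stirling (suc m) 2 ≡ + 2 ℤ.* ((+ 4 ℤ.* w ℤ.+ + 2) ℤ.- ℤ.- + 1)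
    r₂ = ≡.cong₂ (λ a b → + 2 ℤ.* (a ℤ.- b)) s₂ s₁
    r₃ : stirling (suc m) 3 ≡ + 3 ℤ.* (+ 4 ℤ.* z ℤ.- (+ 4 ℤ.* w ℤ.+ + 2))
    r₃ = ≡.cong₂ (λ a b → + 3 ℤ.* (a ℤ.- b)) s₃ s₂
    t₁ : stirling (2 ℕ.+ m) 1 ≡ ℤ.- + 1
    t₁ = ≡.cong (λ a → + 1 ℤ.* (a ℤ.- + 0)) r₁
    t₂ : stirling (2 ℕ.+ m) 2 ≡ + 4 ℤ.* (+ 4 ℤ.* w ℤ.+ + 3) ℤ.+ + 2
    t₂ = ≡.trans (≡.cong₂ (λ a b → + 2 ℤ.* (a ℤ.- b)) r₂ r₁)
      (ℤΣ.solve 1 (λ w → c (+ 2) ℤΣ.:* (c (+ 2) ℤΣ.:* ((c (+ 4) ℤΣ.:* w ℤΣ.:+ c (+ 2)) ℤΣ.:- c (ℤ.- + 1)) ℤΣ.:- c (ℤ.- + 1))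
        ℤΣ.:= c (+ 4) ℤΣ.:* (c (+ 4) ℤΣ.:* w ℤΣ.:+ c (+ 3)) ℤΣ.:+ c (+ 2)) ≡.refl w)
    t₃ : stirling (2 ℕ.+ m) 3 ≡ + 4 ℤ.* (+ 9 ℤ.* z ℤ.- + 15 ℤ.* w ℤ.- + 9)
    t₃ = ≡.trans (≡.cong₂ (λ a b → + 3 ℤ.* (a ℤ.- b)) r₃ r₂)
      (ℤΣ.solve 2 (λ w z → c (+ 3) ℤΣ.:* (c (+ 3) ℤΣ.:* (c (+ 4) ℤΣ.:* z ℤΣ.:- (c (+ 4) ℤΣ.:* w ℤΣ.:+ c (+ 2))) ℤΣ.:- c (+ 2) ℤΣ.:* ((c (+ 4) ℤΣ.:* w ℤΣ.:+ c (+ 2)) ℤΣ.:- c (ℤ.- + 1)))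
        ℤΣ.:= c (+ 4) ℤΣ.:* (c (+ 9) ℤΣ.:* z ℤΣ.:- c (+ 15) ℤΣ.:* w ℤΣ.:- c (+ 9))) ≡.refl w z)

  mod4 : ∀ j → Mod4 (2 ℕ.* suc j)
  mod4 zero    = ≡.refl , ≡.refl , (+ 0 , ≡.refl) , (+ 0 , ≡.refl)
  mod4 (suc j) = ≡.subst Mod4 (≡.sym (ℕₚ.*-suc 2 (suc j))) (mod4-step (2 ℕ.* suc j) (mod4 j))

  -- Let q = k + 1 = e d be a proper factorisation. If e and d differ, both occur among the factors
  -- of k!, so q divides k!. If q = d² with d > 2, then d and 2 d are distinct and at most k, so d ·
  -- 2 d divides k!. There remains q = 4, covered by `mod4`.
  composite∣stirling : ∀ n k → 1 ≤ n → 1 ≤ k → ¬ Prime (suc k) → + suc k ∣ stirling (2 ℕ.* n) k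
  composite∣stirling (suc j) k@(suc _) _ _ ¬p with Primality.¬prime⇒composite ¬p
  ... | Primality.composite {d} d<q d∣q = go d∣q
    where
    q = suc k
    2≤d : 2 ≤ d
    2≤d = ℕ.nonTrivial⇒n>1 d
    via-! : q ℕ∣.∣ k ! → + q ∣ stirling (2 ℕ.* suc j) k
    via-! h = ℤ∣.∣-trans (ℤ∣.∣ᵤ⇒∣ h) (k!∣stirling (2 ℕ.* suc j) k)
    go : d ℕ∣.∣ q → + q ∣ stirling (2 ℕ.* suc j) k
    go (ℕ∣.divides e q≡ed) = factors (ℕₚ.<-cmp e d)
      where
      nontrivial-cofactor : ∀ e → q ≡ e ℕ.* d → 2 ≤ e
      nontrivial-cofactor 0 h = ⊥-elim (ℕₚ.0≢1+n (≡.sym h))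
      nontrivial-cofactor 1 h = ⊥-elim (ℕₚ.<-irrefl (≡.sym (≡.trans h (ℕₚ.*-identityˡ d))) d<q)
      nontrivial-cofactor (suc (suc _)) _ = s≤s (s≤s z≤n)
      2≤e : 2 ≤ e
      2≤e = nontrivial-cofactor e q≡ed
      e<q : e < q
      e<q = ≡.subst (e <_) (≡.sym q≡ed) (ℕₚ.m<m*n e d {{ℕ.>-nonZero (ℕₚ.≤-trans (s≤s z≤n) 2≤e)}} 2≤d)
      factors : Tri (e < d) (e ≡ d) (d < e) → + q ∣ stirling (2 ℕ.* suc j) k
      factors (tri< e<d _ _) = via-! (≡.subst (ℕ∣._∣ k !) (≡.sym q≡ed) (product∣! e d k (ℕₚ.≤-trans (s≤s z≤n) 2≤e) e<d (ℕₚ.≤-pred d<q)))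
      factors (tri> _ _ d<e) = via-! (≡.subst (ℕ∣._∣ k !) (≡.sym (≡.trans q≡ed (ℕₚ.*-comm e d))) (product∣! d e k (ℕₚ.≤-trans (s≤s z≤n) 2≤d) d<e (ℕₚ.≤-pred e<q)))
      factors (tri≈ _ ≡.refl _) with ℕₚ.m≤n⇒m<n∨m≡n 2≤d
      ... | inj₂ ≡.refl = square k (ℕₚ.suc-injective q≡ed)
        where
        square : ∀ k → k ≡ 3 → + suc k ∣ stirling (2 ℕ.* suc j) k
        square .3 ≡.refl = let (z , h) = proj₂ (proj₂ (proj₂ (mod4 j))) in divides z (≡.trans h (ℤₚ.*-comm (+ 4) z))
      ... | inj₁ 2<d = via-! (≡.subst (ℕ∣._∣ k !) (≡.sym q≡ed) (ℕ∣.∣-trans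
        (ℕ∣.*-monoʳ-∣ d (ℕ∣.n∣m*n 2))
        (product∣! d (2 ℕ.* d) k (ℕₚ.≤-trans (s≤s z≤n) 2≤d) d<2d (ℕₚ.≤-pred (≡.subst (2 ℕ.* d <_) (≡.sym q≡ed) (ℕₚ.*-monoˡ-< d 2<d))))))
        where
        instance d≢0 : ℕ.NonZero d
                 d≢0 = ℕ.>-nonZero (ℕₚ.≤-trans (s≤s z≤n) 2≤d)
        d<2d : d < 2 ℕ.* d
        d<2d = ≡.subst (d <_) (ℕₚ.*-comm d 2) (ℕₚ.m<m*n d 2 (s≤s (s≤s z≤n)))

open SignedSurjections

-- The von Staudt–Clausen theorem

module StirlingSum (K : CommutativeRing 0ℓ 0ℓ) (w : ℕ → CommutativeRing.Carrier K)
  (inverse : ∀ k → CommutativeRing._≈_ K (CommutativeRing._*_ K (RingDefs.ιℕ K (suc k)) (w k)) (CommutativeRing.1# K)) where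
  open IntegerScalars K
  open ScalarMaps K
  open Relation.Binary.Reasoning.Setoid setoid

  term : ℕ → ℕ → Carrier
  term m k = ι (stirling m k) * w k

  β : ℕ → Carrier
  β m = sumN (suc m) (term m)

  β-extend : ∀ m K → m < K → sumN K (term m) ≈ β m
  β-extend m K m<K = ≡.subst (λ K → sumN K (term m) ≈ β m) (ℕₚ.m∸n+n≡m m<K) (go (K ℕ.∸ suc m))
    where
    go : ∀ j → sumN (j ℕ.+ suc m) (term m) ≈ β m
    go zero    = refl
    go (suc j) = begin
      sumN (suc (j ℕ.+ suc m)) (term m)
        ≈⟨ sumN-last (j ℕ.+ suc m) (term m) ⟩
      sumN (j ℕ.+ suc m) (term m) + ι (stirling m (j ℕ.+ suc m)) * w (j ℕ.+ suc m)
        ≈⟨ +-cong (go j) (*-congʳ (reflexive (≡.cong ι (stirling-above m (j ℕ.+ suc m) (ℕₚ.m≤n+m (suc m) j))))) ⟩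
      β m + 0# * w (j ℕ.+ suc m)
        ≈⟨ trans (+-congˡ (zeroˡ _)) (+-identityʳ _) ⟩
      β m ∎

  telescope : ∀ n (f : ℕ → Carrier) → sumN n (λ k → f k - f (suc k)) ≈ f 0 - f n
  telescope zero    f = sym (-‿inverseʳ _)
  telescope (suc n) f = trans (+-congˡ (telescope n (λ k → f (suc k))))
    (solve 3 (λ a b c → (a :- b) :+ (b :- c) := a :- c) refl (f 0) (f 1) (f (suc n)))

  column : ∀ m k → w k * ι (ℤ.- stirling (suc m) (suc k)) ≈ ι (stirling m k) - ι (stirling m (suc k))
  column m k = begin
    w k * ι (ℤ.- (+ suc k ℤ.* (b ℤ.- a)))
      ≈⟨ *-congˡ (trans (ι-neg (+ suc k ℤ.* (b ℤ.- a))) (-‿cong (trans (ι-* (+ suc k) (b ℤ.- a)) (*-congˡ (trans (ι-+ b (ℤ.- a)) (+-congˡ (ι-neg a))))))) ⟩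
    w k * - (ιℕ (suc k) * (ι b - ι a))
      ≈⟨ solve 4 (λ w s a b → w :* (:- (s :* (b :- a))) := (s :* w) :* (a :- b)) refl (w k) (ιℕ (suc k)) (ι a) (ι b) ⟩
    (ιℕ (suc k) * w k) * (ι a - ι b)
      ≈⟨ trans (*-congʳ (inverse k)) (*-identityˡ _) ⟩
    ι a - ι b ∎
    where
    a = stirling m k
    b = stirling m (suc k)

  -- After the exchange of sums, index k contributes - s(m+2, k+1)/(k+1), where s is `stirling`. Its
  -- recursion cancels the factor k + 1 and leaves s(m+1, k) - s(m+1, k+1), so the sum over k
  -- telescopes between two zero entries.
  recurrence : ∀ m → sumN (suc (suc m)) (λ i → ι (+ (suc (suc m) C i)) * β i) ≈ 0#
  recurrence m = begin
    sumN N (λ i → ι (b i) * β i)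
      ≈⟨ sumN-cong N (λ i i<N → trans (*-congˡ (sym (β-extend i N i<N))) (sym (sumN-*ˡ N (ι (b i)) (term i)))) ⟩
    sumN N (λ i → sumN N (λ k → ι (b i) * term i k))
      ≈⟨ sumN-comm N N (λ i k → ι (b i) * term i k) ⟩
    sumN N (λ k → sumN N (λ i → ι (b i) * term i k))
      ≈⟨ sumN-cong N (λ k _ → gather k) ⟩
    sumN N (λ k → ι (stirling (suc m) k) - ι (stirling (suc m) (suc k)))
      ≈⟨ telescope N (λ k → ι (stirling (suc m) k)) ⟩
    0# - ι (stirling (suc m) N)
      ≈⟨ +-congˡ (-‿cong (reflexive (≡.cong ι (stirling-above (suc m) N ℕₚ.≤-refl)))) ⟩
    0# - 0#
      ≈⟨ -‿inverseʳ 0# ⟩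
    0# ∎
    where
    N = suc (suc m)
    b = λ i → + (N C i)
    gather : ∀ k → sumN N (λ i → ι (b i) * term i k) ≈ ι (stirling (suc m) k) - ι (stirling (suc m) (suc k))
    gather k = begin
      sumN N (λ i → ι (b i) * (ι (stirling i k) * w k))
        ≈⟨ sumN-cong N (λ i _ → trans (solve 3 (λ b s w → b :* (s :* w) := w :* (b :* s)) refl (ι (b i)) (ι (stirling i k)) (w k)) (*-congˡ (sym (ι-* (b i) (stirling i k))))) ⟩
      sumN N (λ i → w k * ι (b i ℤ.* stirling i k))
        ≈⟨ sumN-*ˡ N (w k) (λ i → ι (b i ℤ.* stirling i k)) ⟩
      w k * sumN N (λ i → ι (b i ℤ.* stirling i k))
        ≈⟨ *-congˡ (ι-sumN N (λ i → b i ℤ.* stirling i k)) ⟨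
      w k * ι (ℤΣ.sumN N (λ i → b i ℤ.* stirling i k))
        ≡⟨ ≡.cong (λ z → w k * ι z) (stirling-convolution N k) ⟩
      w k * ι (ℤ.- stirling N (suc k))
        ≈⟨ column (suc m) k ⟩
      ι (stirling (suc m) k) - ι (stirling (suc m) (suc k)) ∎

  -- The last coefficient of the recurrence is C(m+2, m+1) = m + 2, whose inverse is `w (suc m)`;
  -- the result has the form in which `bernUpTo` computes its next entry.
  isolate-last : ∀ m → β (suc m) ≈ - (w (suc m) * sumN (suc m) (λ i → ι (+ (suc (suc m) C i)) * β i))
  isolate-last m = begin
    β (suc m)
      ≈⟨ *-identityˡ _ ⟨
    1# * β (suc m)
      ≈⟨ *-congʳ (inverse (suc m)) ⟨
    (ιℕ N * w (suc m)) * β (suc m)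
      ≈⟨ solve 4 (λ n w b s → (n :* w) :* b := w :* (s :+ n :* b) :- w :* s) refl (ιℕ N) (w (suc m)) (β (suc m)) S ⟩
    w (suc m) * (S + ιℕ N * β (suc m)) - w (suc m) * S
      ≈⟨ +-congʳ (*-congˡ (+-congˡ (*-congʳ (reflexive (≡.cong ιℕ (≡.sym choose)))))) ⟩
    w (suc m) * (S + ιℕ (N C suc m) * β (suc m)) - w (suc m) * S
      ≈⟨ +-congʳ (*-congˡ (trans (sym (sumN-last (suc m) (λ i → ι (+ (N C i)) * β i))) (recurrence m))) ⟩
    w (suc m) * 0# - w (suc m) * S
      ≈⟨ solve 2 (λ w s → w :* con (+ 0) :- w :* s := :- (w :* s)) refl (w (suc m)) S ⟩
    - (w (suc m) * S) ∎
    where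
    N = suc (suc m)
    S = sumN (suc m) (λ i → ι (+ (N C i)) * β i)
    choose : N C suc m ≡ N
    choose = ≡.trans (nCk≡nC[n∸k] (ℕₚ.n≤1+n (suc m))) (≡.trans (≡.cong (N C_) (ℕₚ.m+n∸n≡m 1 (suc m))) (nC1≡n N))

recip : ℕ → ℚ
recip k = + 1 ℚ./ suc k

module B = StirlingSum ℚₚ.+-*-commutativeRing recip ι-inverse-ℚ
open B using (β)

sumℚ-zipWith : ∀ n (f : ℕ → ℚ → ℚ) g b → sumℚ (zipWith f (applyUpTo g n) (applyUpTo b n)) ≡ ℚΣ.sumN n (λ k → f (g k) (b k))
sumℚ-zipWith zero    f g b = ≡.refl
sumℚ-zipWith (suc n) f g b = ≡.cong (f (g 0) (b 0) ℚ.+_) (sumℚ-zipWith n f (λ k → g (suc k)) (λ k → b (suc k)))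

bernUpTo≡β : ∀ m → bernUpTo m ≡ applyUpTo β (suc m)
bernUpTo≡β zero    = ≡.refl
bernUpTo≡β (suc m) = ≡.trans
  (≡.cong₂ (λ bs b → bs ++ (b ∷ [])) (bernUpTo≡β m) (≡.trans
    (≡.cong (λ bs → ℚ.- (recip (suc m) ℚ.* sumℚ (zipWith f (upTo (suc m)) bs))) (bernUpTo≡β m))
    (≡.trans
      (≡.cong (λ s → ℚ.- (recip (suc m) ℚ.* s)) (≡.trans (sumℚ-zipWith (suc m) f (λ k → k) β)
        (ℚΣ.sumN-cong (suc m) (λ k _ → ≡.cong (ℚ._* β k) (≡.sym (ιℕ≡/1 (suc (suc m) C k)))))))
      (≡.sym (B.isolate-last m)))))
  (Listₚ.applyUpTo-∷ʳ β (suc m))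
  where
  f : ℕ → ℚ → ℚ
  f k b = (+ (suc (suc m) C k) ℚ./ 1) ℚ.* b

bernoulli≡β : ∀ m → bernoulli m ≡ β m
bernoulli≡β m = ≡.trans (≡.cong (lastOr ℚ.0ℚ) (bernUpTo≡β m)) (last-applyUpTo ℚ.0ℚ β m)
  where
  last-applyUpTo : ∀ d (f : ℕ → ℚ) m → lastOr d (applyUpTo f (suc m)) ≡ f m
  last-applyUpTo d f zero    = ≡.refl
  last-applyUpTo d f (suc m) = last-applyUpTo (f 0) (λ k → f (suc k)) m

∏ : ℕ → (ℕ → ℕ) → ℕ
∏ zero    f = 1
∏ (suc n) f = f 0 ℕ.* ∏ n (λ k → f (suc k))

∏-last : ∀ n f → ∏ (suc n) f ≡ ∏ n f ℕ.* f n
∏-last zero    f = ℕₚ.*-comm (f 0) 1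
∏-last (suc n) f = ≡.trans (≡.cong (f 0 ℕ.*_) (∏-last n (λ k → f (suc k)))) (≡.sym (ℕₚ.*-assoc (f 0) _ _))

1≤∏ : ∀ n {f} → (∀ k → 1 ≤ f k) → 1 ≤ ∏ n f
1≤∏ zero    h = s≤s z≤n
1≤∏ (suc n) h = ℕₚ.*-mono-≤ (h 0) (1≤∏ n (λ k → h (suc k)))

prime∣∏ : ∀ {p} → Prime p → ∀ n f → p ℕ∣.∣ ∏ n f → ∃ λ k → k < n × p ℕ∣.∣ f k
prime∣∏ p-prime zero    f d = ⊥-elim (Primality.¬prime[1] (≡.subst Prime (ℕ∣.∣1⇒≡1 d) p-prime))
prime∣∏ p-prime (suc n) f d with Primality.euclidsLemma (f 0) (∏ n (λ k → f (suc k))) p-prime d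
... | inj₁ p∣f0 = 0 , s≤s z≤n , p∣f0
... | inj₂ p∣∏  = let (k , k<n , p∣f) = prime∣∏ p-prime n (λ k → f (suc k)) p∣∏ in suc k , s≤s k<n , p∣f

ι≡/1 : ∀ i → ℚΣ.ι i ≡ i ℚ./ 1
ι≡/1 (+ n)    = ιℕ≡/1 n
ι≡/1 -[1+ n ] = ≡.cong ℚ.-_ (ιℕ≡/1 (suc n))

denominator-unique : ∀ q D N → 1 ≤ D → Coprime ℤ.∣ N ∣ D → q ℚ.* ℚΣ.ι (+ D) ≡ ℚΣ.ι N → ↧ₙ q ≡ D
denominator-unique q@(mkℚ a b-1 a⊥b) D N 1≤D N⊥D e = ℕ∣.∣-antisym b∣D D∣b
  where
  b = suc b-1
  cross : a ℤ.* + D ≡ N ℤ.* + b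
  cross with ℚᵘₚ.≃-trans (ℚᵘₚ.≃-sym (ℚᵘₚ.≃-trans (ℚₚ.toℚᵘ-homo-* q (+ D ℚ./ 1)) (ℚᵘₚ.*-congˡ {mkℚᵘ a b-1} (ℚₚ.toℚᵘ-fromℚᵘ (mkℚᵘ (+ D) 0)))))
         (ℚᵘₚ.≃-trans (ℚₚ.toℚᵘ-cong (≡.subst₂ (λ x y → q ℚ.* x ≡ y) (ι≡/1 (+ D)) (ι≡/1 N) e)) (ℚₚ.toℚᵘ-fromℚᵘ (mkℚᵘ N 0)))
  ... | *≡* h = ≡.trans (≡.sym (ℤₚ.*-identityʳ (a ℤ.* + D))) (≡.trans h (≡.cong (λ m → N ℤ.* + suc m) (ℕₚ.*-identityʳ b-1)))
  ∣cross∣ : ℤ.∣ a ∣ ℕ.* D ≡ ℤ.∣ N ∣ ℕ.* b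
  ∣cross∣ = ≡.trans (≡.sym (ℤₚ.abs-* a (+ D))) (≡.trans (≡.cong ℤ.∣_∣ cross) (ℤₚ.abs-* N (+ b)))
  b∣D : b ℕ∣.∣ D
  b∣D = coprime-divisor {n = ℤ.∣ a ∣} (Coprimality.sym (Coprimality.recompute a⊥b)) (ℕ∣.divides ℤ.∣ N ∣ ∣cross∣)
  D∣b : D ℕ∣.∣ b
  D∣b = coprime-divisor {n = ℤ.∣ N ∣} (Coprimality.sym N⊥D) (ℕ∣.divides ℤ.∣ a ∣ (≡.sym ∣cross∣))

-- The length of the rotation attached to k; length zero means that there is none.
size : ℕ → ℕ
size k with prime? (suc k)
... | yes _ = k
... | no  _ = 0

fixed : ℕ → ℕ → ℕ
fixed s m with s ℕ∣.∣? m
... | yes _ = s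
... | no  _ = 0

-- Equals k + 1 if k + 1 is prime and k divides m, and 1 otherwise. Written as one plus a number of
-- fixed points, it is already a periodic-point count.
denominator-factor : ℕ → ℕ → ℕ
denominator-factor m k = suc (fixed (size k) m)

fixed-0 : ∀ m → fixed 0 m ≡ 0
fixed-0 m with 0 ℕ∣.∣? m
... | yes _ = ≡.refl
... | no  _ = ≡.refl

nonprime∣stirling : ∀ n k → 1 ≤ n → ¬ Prime (suc k) → + suc k ∣ stirling (2 ℕ.* n) k
nonprime∣stirling n zero    1≤n _  = divides (stirling (2 ℕ.* n) 0) (≡.sym (ℤₚ.*-identityʳ _))
nonprime∣stirling n (suc k) 1≤n ¬p = composite∣stirling n (suc k) 1≤n (s≤s z≤n) ¬p

factor-cases : ∀ n k → 1 ≤ n →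
  (denominator-factor (2 ℕ.* n) k ≡ 1 × (+ suc k ∣ stirling (2 ℕ.* n) k)) ⊎
  (denominator-factor (2 ℕ.* n) k ≡ suc k × Prime (suc k) × ¬ (+ suc k ∣ stirling (2 ℕ.* n) k))
factor-cases n k 1≤n with prime? (suc k)
... | no ¬p = inj₁ (≡.cong suc (fixed-0 (2 ℕ.* n)) , nonprime∣stirling n k 1≤n ¬p)
... | yes p with k ℕ∣.∣? (2 ℕ.* n)
...   | yes k∣m = inj₂ (≡.refl , p , prime∤stirling k p (2 ℕ.* n) (ℕₚ.*-mono-≤ {1} {2} (s≤s z≤n) 1≤n) k∣m)
...   | no  k∤m = inj₁ (≡.refl , prime∣stirling k p (2 ℕ.* n) (ℕₚ.*-mono-≤ {1} {2} (s≤s z≤n) 1≤n) k∤m)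

module _ (n : ℕ) (1≤n : 1 ≤ n) where
  open ℚΣ using (ι; sumN)

  private
    m = 2 ℕ.* n
    φ = denominator-factor m

  -- A factor with index below K is 1 or at most K, hence smaller than the prime k + 1 unless it is
  -- 1, and positive.
  prime∤∏ : ∀ K k → K ≤ k → Prime (suc k) → ¬ suc k ℕ∣.∣ ∏ K φ
  prime∤∏ K k K≤k p d with prime∣∏ p K φ d
  ... | j , j<K , p∣φj with factor-cases n j 1≤n
  ...   | inj₁ (φj≡1 , _) = Primality.¬prime[1] (≡.subst Prime (ℕ∣.∣1⇒≡1 (≡.subst (suc k ℕ∣.∣_) φj≡1 p∣φj)) p)
  ...   | inj₂ (φj≡j+1 , _) = ℕₚ.<⇒≱ (ℕₚ.<-≤-trans j<K K≤k) (ℕₚ.≤-pred (ℕ∣.∣⇒≤ (≡.subst (suc k ℕ∣.∣_) φj≡j+1 p∣φj)))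


  -- The partial sums are kept in lowest terms N/D. An integral term z changes N by a multiple of D.
  -- A term t/q with q a prime dividing neither t nor D yields (N q + t D)/(D q): modulo divisors of
  -- D the numerator is N q, modulo q it is t D, so it stays coprime to D q.
  partial-sum : ∀ K → ∃ λ N → Coprime ℤ.∣ N ∣ (∏ K φ) × sumN K (B.term m) ℚ.* ι (+ ∏ K φ) ≡ ι N
  partial-sum zero    = + 0 , Coprimality.sym (Coprimality.1-coprimeTo 0) , ℚₚ.*-zeroˡ (ι (+ 1))
  partial-sum (suc k) = step (partial-sum k) (factor-cases n k 1≤n)
    where
    D = ∏ k φ
    S = sumN k (B.term m)
    t = stirling m k
    q = suc k
    open ≡.≡-Reasoning
    lift : ∀ {D′} → D ℕ.* φ k ≡ D′ → ∀ {N} → (S ℚ.+ B.term m k) ℚ.* ι (+ D′) ≡ ι N →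
      sumN (suc k) (B.term m) ℚ.* ι (+ ∏ (suc k) φ) ≡ ι N
    lift {D′} e {N} h = ≡.trans (≡.cong₂ (λ s D → s ℚ.* ι (+ D)) (ℚΣ.sumN-last k (B.term m)) (≡.trans (∏-last k φ) e)) h
    step : (∃ λ N → Coprime ℤ.∣ N ∣ D × S ℚ.* ι (+ D) ≡ ι N) →
      (φ k ≡ 1 × (+ q ∣ t)) ⊎ (φ k ≡ q × Prime q × ¬ (+ q ∣ t)) →
      ∃ λ N → Coprime ℤ.∣ N ∣ (∏ (suc k) φ) × sumN (suc k) (B.term m) ℚ.* ι (+ ∏ (suc k) φ) ≡ ι N
    step (N , N⊥D , SD≡N) (inj₁ (φ≡1 , divides z t≡zq)) = N ℤ.+ z ℤ.* + D ,
      ≡.subst (Coprime ℤ.∣ N ℤ.+ z ℤ.* + D ∣) (≡.sym (≡.trans (∏-last k φ) D*φ≡D)) coprime′ ,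
      lift D*φ≡D {N ℤ.+ z ℤ.* + D} (begin
        (S ℚ.+ ι t ℚ.* recip k) ℚ.* ι (+ D)
          ≡⟨ ≡.cong (λ x → (S ℚ.+ x) ℚ.* ι (+ D)) integral ⟩
        (S ℚ.+ ι z) ℚ.* ι (+ D)
          ≡⟨ ℚₚ.*-distribʳ-+ (ι (+ D)) S (ι z) ⟩
        S ℚ.* ι (+ D) ℚ.+ ι z ℚ.* ι (+ D)
          ≡⟨ ≡.cong₂ ℚ._+_ SD≡N (≡.sym (ℚΣ.ι-* z (+ D))) ⟩
        ι N ℚ.+ ι (z ℤ.* + D)
          ≡⟨ ℚΣ.ι-+ N (z ℤ.* + D) ⟨
        ι (N ℤ.+ z ℤ.* + D) ∎)
      where
      D*φ≡D : D ℕ.* φ k ≡ D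
      D*φ≡D = ≡.trans (≡.cong (D ℕ.*_) φ≡1) (ℕₚ.*-identityʳ D)
      integral : ι t ℚ.* recip k ≡ ι z
      integral = begin
        ι t ℚ.* recip k                    ≡⟨ ≡.cong (λ x → ι x ℚ.* recip k) t≡zq ⟩
        ι (z ℤ.* + q) ℚ.* recip k          ≡⟨ ≡.cong (ℚ._* recip k) (ℚΣ.ι-* z (+ q)) ⟩
        (ι z ℚ.* ι (+ q)) ℚ.* recip k      ≡⟨ ℚₚ.*-assoc (ι z) (ι (+ q)) (recip k) ⟩
        ι z ℚ.* (ι (+ q) ℚ.* recip k)      ≡⟨ ≡.cong (ι z ℚ.*_) (ι-inverse-ℚ k) ⟩
        ι z ℚ.* ℚ.1ℚ                       ≡⟨ ℚₚ.*-identityʳ (ι z) ⟩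
        ι z                                ∎
      coprime′ : Coprime ℤ.∣ N ℤ.+ z ℤ.* + D ∣ D
      coprime′ {d} (d∣N′ , d∣D) = N⊥D (ℤ∣.∣⇒∣ᵤ {+ d} {N} (ℤ∣.∣m+n∣n⇒∣m {+ d} {N} {z ℤ.* + D} (ℤ∣.∣ᵤ⇒∣ d∣N′) (ℤ∣.∣n⇒∣m*n z {+ D} (ℤ∣.∣ᵤ⇒∣ d∣D))) , d∣D)
    step (N , N⊥D , SD≡N) (inj₂ (φ≡q , q-prime , q∤t)) = N′ ,
      ≡.subst (Coprime ℤ.∣ N′ ∣) (≡.sym (≡.trans (∏-last k φ) D*φ≡Dq)) (coprime-* coprime-D coprime-q) ,
      lift D*φ≡Dq {N′} (begin
        (S ℚ.+ ι t ℚ.* recip k) ℚ.* ι (+ (D ℕ.* q))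
          ≡⟨ ≡.cong ((S ℚ.+ ι t ℚ.* recip k) ℚ.*_) (≡.trans (≡.cong ι (ℤₚ.pos-* D q)) (ℚΣ.ι-* (+ D) (+ q))) ⟩
        (S ℚ.+ ι t ℚ.* recip k) ℚ.* (ι (+ D) ℚ.* ι (+ q))
          ≡⟨ expand S (ι t) (recip k) (ι (+ D)) (ι (+ q)) ⟩
        (S ℚ.* ι (+ D)) ℚ.* ι (+ q) ℚ.+ (ι t ℚ.* ι (+ D)) ℚ.* (ι (+ q) ℚ.* recip k)
          ≡⟨ ≡.cong₂ (λ x y → x ℚ.* ι (+ q) ℚ.+ (ι t ℚ.* ι (+ D)) ℚ.* y) SD≡N (ι-inverse-ℚ k) ⟩
        ι N ℚ.* ι (+ q) ℚ.+ (ι t ℚ.* ι (+ D)) ℚ.* ℚ.1ℚ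
          ≡⟨ ≡.cong₂ ℚ._+_ (≡.sym (ℚΣ.ι-* N (+ q))) (≡.trans (ℚₚ.*-identityʳ (ι t ℚ.* ι (+ D))) (≡.sym (ℚΣ.ι-* t (+ D)))) ⟩
        ι (N ℤ.* + q) ℚ.+ ι (t ℤ.* + D)
          ≡⟨ ℚΣ.ι-+ (N ℤ.* + q) (t ℤ.* + D) ⟨
        ι N′ ∎)
      where
      N′ = N ℤ.* + q ℤ.+ t ℤ.* + D
      D*φ≡Dq : D ℕ.* φ k ≡ D ℕ.* q
      D*φ≡Dq = ≡.cong (D ℕ.*_) φ≡q
      expand : ∀ s t r d q → (s ℚ.+ t ℚ.* r) ℚ.* (d ℚ.* q) ≡ (s ℚ.* d) ℚ.* q ℚ.+ (t ℚ.* d) ℚ.* (q ℚ.* r)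
      expand = ℚΣ.solve 5 (λ s t r d q → (s ℚΣ.:+ t ℚΣ.:* r) ℚΣ.:* (d ℚΣ.:* q) ℚΣ.:= (s ℚΣ.:* d) ℚΣ.:* q ℚΣ.:+ (t ℚΣ.:* d) ℚΣ.:* (q ℚΣ.:* r)) ≡.refl
      q∤D : ¬ q ℕ∣.∣ D
      q∤D = prime∤∏ k k ℕₚ.≤-refl q-prime
      coprime-D : Coprime ℤ.∣ N′ ∣ D
      coprime-D {d} (d∣N′ , d∣D) = N⊥D (coprime-divisor {n = q} (λ (e∣d , e∣q) → ∤⇒coprime q q-prime q∤D (ℕ∣.∣-trans e∣d d∣D , e∣q)) d∣qN , d∣D)
        where
        d∣qN : d ℕ∣.∣ q ℕ.* ℤ.∣ N ∣
        d∣qN = ≡.subst (d ℕ∣.∣_) (≡.trans (ℤₚ.abs-* N (+ q)) (ℕₚ.*-comm ℤ.∣ N ∣ q))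
          (ℤ∣.∣⇒∣ᵤ {+ d} {N ℤ.* + q} (ℤ∣.∣m+n∣n⇒∣m {+ d} {N ℤ.* + q} {t ℤ.* + D} (ℤ∣.∣ᵤ⇒∣ d∣N′) (ℤ∣.∣n⇒∣m*n t {+ D} (ℤ∣.∣ᵤ⇒∣ d∣D))))
      coprime-q : Coprime ℤ.∣ N′ ∣ q
      coprime-q = ∤⇒coprime q q-prime q∤N′
        where
        q∤N′ : ¬ q ℕ∣.∣ ℤ.∣ N′ ∣
        q∤N′ q∣N′ with Primality.euclidsLemma ℤ.∣ t ∣ D q-prime (≡.subst (q ℕ∣.∣_) (ℤₚ.abs-* t (+ D))
          (ℤ∣.∣⇒∣ᵤ {+ q} {t ℤ.* + D} (ℤ∣.∣m+n∣m⇒∣n {+ q} {N ℤ.* + q} {t ℤ.* + D} (ℤ∣.∣ᵤ⇒∣ q∣N′) (ℤ∣.∣n⇒∣m*n N {+ q} ℤ∣.∣-refl))))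
        ... | inj₁ q∣t = q∤t (ℤ∣.∣ᵤ⇒∣ q∣t)
        ... | inj₂ q∣D = q∤D q∣D

  vonStaudtClausen : bernDenom n ≡ ∏ (suc m) φ
  vonStaudtClausen =
    let (N , N⊥D , SD≡N) = partial-sum (suc m)
    in denominator-unique (bernoulli m) (∏ (suc m) φ) N (1≤∏ (suc m) {φ} (λ k → s≤s z≤n)) N⊥D
         (≡.trans (≡.cong (ℚ._* ℚΣ.ι (+ ∏ (suc m) φ)) (bernoulli≡β m)) SD≡N)

-- Realising Bernoulli denominators

rotate : ∀ {s} → Fin s → Fin s
rotate {suc s} y = Fin.fromℕ< (ℕD.m%n<n (Fin.toℕ y ℕ.+ 2) (suc s))

toℕ-rotate^ : ∀ {s} n (y : Fin (suc s)) → Fin.toℕ (iter rotate n y) ≡ (Fin.toℕ y ℕ.+ n ℕ.* 2) ℕ.% suc s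
toℕ-rotate^ {s} zero    y = ≡.sym (≡.trans (≡.cong (ℕ._% suc s) (ℕₚ.+-identityʳ (Fin.toℕ y))) (ℕD.m<n⇒m%n≡m (Finₚ.toℕ<n y)))
toℕ-rotate^ {s} (suc n) y = begin
  Fin.toℕ (rotate (iter rotate n y))
    ≡⟨ Finₚ.toℕ-fromℕ< _ ⟩
  (Fin.toℕ (iter rotate n y) ℕ.+ 2) ℕ.% suc s
    ≡⟨ ≡.cong (λ x → (x ℕ.+ 2) ℕ.% suc s) (toℕ-rotate^ n y) ⟩
  (x ℕ.% suc s ℕ.+ 2) ℕ.% suc s
    ≡⟨ ℕD.%-distribˡ-+ (x ℕ.% suc s) 2 (suc s) ⟩
  ((x ℕ.% suc s) ℕ.% suc s ℕ.+ 2 ℕ.% suc s) ℕ.% suc s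
    ≡⟨ ≡.cong (λ r → (r ℕ.+ 2 ℕ.% suc s) ℕ.% suc s) (ℕD.m%n%n≡m%n x (suc s)) ⟩
  (x ℕ.% suc s ℕ.+ 2 ℕ.% suc s) ℕ.% suc s
    ≡⟨ ℕD.%-distribˡ-+ x 2 (suc s) ⟨
  (x ℕ.+ 2) ℕ.% suc s
    ≡⟨ ≡.cong (ℕ._% suc s) (≡.trans (ℕₚ.+-assoc (Fin.toℕ y) (n ℕ.* 2) 2) (≡.cong (Fin.toℕ y ℕ.+_) (ℕₚ.+-comm (n ℕ.* 2) 2))) ⟩
  (Fin.toℕ y ℕ.+ suc n ℕ.* 2) ℕ.% suc s ∎
  where
  open ≡.≡-Reasoning
  x = Fin.toℕ y ℕ.+ n ℕ.* 2

rotate-fixed⇒ : ∀ {s} n (y : Fin s) → iter rotate n y ≡ y → s ℕ∣.∣ 2 ℕ.* n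
rotate-fixed⇒ {suc s} n y e = ℕ∣.divides (x ℕ./ suc s) (ℕₚ.+-cancelˡ-≡ (Fin.toℕ y) (2 ℕ.* n) (x ℕ./ suc s ℕ.* suc s)
  (≡.trans (≡.cong (Fin.toℕ y ℕ.+_) (ℕₚ.*-comm 2 n)) (≡.trans (ℕD.m≡m%n+[m/n]*n x (suc s))
    (≡.cong (ℕ._+ x ℕ./ suc s ℕ.* suc s) (≡.trans (≡.sym (toℕ-rotate^ n y)) (≡.cong Fin.toℕ e))))))
  where x = Fin.toℕ y ℕ.+ n ℕ.* 2

rotate-fixed⇐ : ∀ {s} n (y : Fin s) → s ℕ∣.∣ 2 ℕ.* n → iter rotate n y ≡ y
rotate-fixed⇐ {suc s} n y (ℕ∣.divides q e) = Finₚ.toℕ-injective (≡.trans (toℕ-rotate^ n y) (≡.trans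
  (≡.cong (λ x → (Fin.toℕ y ℕ.+ x) ℕ.% suc s) (≡.trans (ℕₚ.*-comm n 2) e))
  (≡.trans (ℕD.[m+kn]%n≡m%n (Fin.toℕ y) q (suc s)) (ℕD.m<n⇒m%n≡m (Finₚ.toℕ<n y)))))

count-rotate : ∀ s n → Counted _≡_ (λ (y : Fin s) → iter rotate n y ≡ y) (fixed s (2 ℕ.* n))
count-rotate s n with s ℕ∣.∣? (2 ℕ.* n)
... | yes s∣2n = record { enum = λ y → y ; sound = λ y → rotate-fixed⇐ n y s∣2n ; injective = λ e → e ; index = λ y _ → y , ≡.refl }
... | no  s∤2n = record { enum = λ () ; sound = λ () ; injective = λ {} ; index = λ y e → ⊥-elim (s∤2n (rotate-fixed⇒ n y e)) }

module _ {Y : Set} (f : Y → Y) where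

  iter-just : ∀ n y → iter (Maybe.map f) n (just y) ≡ just (iter f n y)
  iter-just zero    y = ≡.refl
  iter-just (suc n) y = ≡.cong (Maybe.map f) (iter-just n y)

  iter-nothing : ∀ n → iter (Maybe.map f) n nothing ≡ nothing
  iter-nothing zero    = ≡.refl
  iter-nothing (suc n) = ≡.cong (Maybe.map f) (iter-nothing n)

  count-maybe : ∀ {N} n → Counted _≡_ (λ y → iter f n y ≡ y) N →
    Counted _≡_ (λ y → iter (Maybe.map f) n y ≡ y) (suc N)
  count-maybe {N} n counted = record { enum = enum′ ; sound = sound′ ; injective = injective′ ; index = index′ }
    where
    open Counted counted
    enum′ : Fin (suc N) → Maybe Y
    enum′ Fin.zero    = nothing
    enum′ (Fin.suc i) = just (enum i)
    sound′ : ∀ i → iter (Maybe.map f) n (enum′ i) ≡ enum′ i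
    sound′ Fin.zero    = iter-nothing n
    sound′ (Fin.suc i) = ≡.trans (iter-just n (enum i)) (≡.cong just (sound i))
    injective′ : ∀ {i j} → enum′ i ≡ enum′ j → i ≡ j
    injective′ {Fin.zero}  {Fin.zero}  _ = ≡.refl
    injective′ {Fin.suc i} {Fin.suc j} e = ≡.cong Fin.suc (injective (Maybeₚ.just-injective e))
    index′ : ∀ y → iter (Maybe.map f) n y ≡ y → Σ (Fin (suc N)) λ i → y ≡ enum′ i
    index′ nothing  _ = Fin.zero , ≡.refl
    index′ (just y) e =
      let (i , y≡) = index y (Maybeₚ.just-injective (≡.trans (≡.sym (iter-just n y)) e)) in Fin.suc i , ≡.cong just y≡

-- A sequence of points is periodic in the product system when every coordinate is; only finitely many coordinates have more than one choice.
count-product : (X : ℕ → Set) (P : ∀ k → X k → Set) (f : ℕ → ℕ) →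
  (∀ k → Counted _≡_ (P k) (f k)) → ∀ K → (∀ k → K ≤ k → f k ≡ 1) →
  Counted {∀ k → X k} (λ x y → ∀ k → x k ≡ y k) (λ x → ∀ k → P k (x k)) (∏ K f)
count-product X P f counted zero    tail≡1 = record
  { enum      = λ _ k → Counted.enum (counted k) (only k)
  ; sound     = λ _ k → Counted.sound (counted k) (only k)
  ; injective = λ { {Fin.zero} {Fin.zero} _ → ≡.refl }
  ; index     = λ x p → Fin.zero , λ k → ≡.trans (proj₂ (Counted.index (counted k) (x k) (p k)))
      (≡.cong (Counted.enum (counted k)) (unique (tail≡1 k z≤n) _ (only k)))
  }
  where
  only : ∀ k → Fin (f k)
  only k = ≡.subst Fin (≡.sym (tail≡1 k z≤n)) Fin.zero
  unique : ∀ {N} → N ≡ 1 → (i j : Fin N) → i ≡ j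
  unique ≡.refl Fin.zero Fin.zero = ≡.refl
count-product X P f counted (suc K) tail≡1 = count-pairs pair pair-sound pair-injective pair-index
  where
  module Head = Counted (counted 0)
  module Tail = Counted (count-product (λ k → X (suc k)) (λ k → P (suc k)) (λ k → f (suc k)) (λ k → counted (suc k)) K (λ k K≤k → tail≡1 (suc k) (s≤s K≤k)))
  pair : Fin (f 0) → Fin (∏ K (λ k → f (suc k))) → ∀ k → X k
  pair i j zero    = Head.enum i
  pair i j (suc k) = Tail.enum j k
  pair-sound : ∀ i j k → P k (pair i j k)
  pair-sound i j zero    = Head.sound i
  pair-sound i j (suc k) = Tail.sound j k
  pair-injective : ∀ i j i′ j′ → (∀ k → pair i j k ≡ pair i′ j′ k) → i ≡ i′ × j ≡ j′
  pair-injective i j i′ j′ h = Head.injective (h 0) , Tail.injective (λ k → h (suc k))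
  pair-index : ∀ x → (∀ k → P k (x k)) → Σ _ λ i → Σ _ λ j → ∀ k → x k ≡ pair i j k
  pair-index x p =
    let (i , x₀≡) = Head.index (x 0) (p 0)
        (j , xₜ≡) = Tail.index (λ k → x (suc k)) (λ k → p (suc k))
    in i , j , λ { zero → x₀≡ ; (suc k) → xₜ≡ k }

step : ∀ k → Maybe (Fin (size k)) → Maybe (Fin (size k))
step k = Maybe.map rotate

count-step : ∀ n k → Counted _≡_ (λ y → iter (step k) n y ≡ y) (denominator-factor (2 ℕ.* n) k)
count-step n k = count-maybe rotate n (count-rotate (size k) n)

factor-realisable : ∀ k → Realisable (λ n → denominator-factor (2 ℕ.* n) k)
factor-realisable k = realise _≡_ ≡.isEquivalence (step k) (≡.cong (step k)) (λ n → denominator-factor (2 ℕ.* n) k)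
  (λ n → count-step (suc n) k)

factor≡1 : ∀ m k → 1 ≤ m → m < k → denominator-factor m k ≡ 1
factor≡1 m k 1≤m m<k with prime? (suc k)
... | no _ = ≡.cong suc (fixed-0 m)
... | yes _ with k ℕ∣.∣? m
...   | no _    = ≡.refl
...   | yes k∣m = ⊥-elim (ℕₚ.<⇒≱ m<k (ℕ∣.∣⇒≤ {{ℕ.>-nonZero 1≤m}} k∣m))

1≤2n : ∀ {n} → 1 ≤ n → 1 ≤ 2 ℕ.* n
1≤2n = ℕₚ.*-mono-≤ {1} {2} (s≤s z≤n)

bernDenom-realisable : Realisable bernDenom
bernDenom-realisable = realisable-cong (λ n 1≤n → ≡.sym (vonStaudtClausen n 1≤n))
  (realise (λ x y → ∀ k → x k ≡ y k) pointwise (λ x k → step k (x k)) (λ h k → ≡.cong (step k) (h k)) product counted)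
  where
  Point : Set
  Point = ∀ k → Maybe (Fin (size k))
  product : ℕ → ℕ
  product n = ∏ (suc (2 ℕ.* n)) (denominator-factor (2 ℕ.* n))
  pointwise : IsEquivalence {A = Point} (λ x y → ∀ k → x k ≡ y k)
  pointwise = record { refl = λ _ → ≡.refl ; sym = λ h k → ≡.sym (h k) ; trans = λ h g k → ≡.trans (h k) (g k) }
  T : Point → Point
  T x k = step k (x k)
  iter-T : ∀ n x k → iter T n x k ≡ iter (step k) n (x k)
  iter-T zero    x k = ≡.refl
  iter-T (suc n) x k = ≡.cong (step k) (iter-T n x k)
  counted : ∀ n → Counted {Point} (λ x y → ∀ k → x k ≡ y k) (λ x → ∀ k → iter T (suc n) x k ≡ x k) (product (suc n))
  counted n = record
    { enum      = enum
    ; sound     = λ i k → ≡.trans (iter-T (suc n) (enum i) k) (sound i k)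
    ; injective = injective
    ; index     = λ x p → index x (λ k → ≡.trans (≡.sym (iter-T (suc n) x k)) (p k))
    }
    where
    open Counted (count-product (λ k → Maybe (Fin (size k))) (λ k y → iter (step k) (suc n) y ≡ y) _ (count-step (suc n))
      (suc (2 ℕ.* suc n)) (λ k m<k → factor≡1 (2 ℕ.* suc n) k (1≤2n (s≤s z≤n)) m<k))

module _ (k : ℕ) (p-prime : Prime (suc k)) where
  private p = suc k

  p-part-∤ : ∀ h → 1 ≤ h → ¬ p ℕ∣.∣ h → p-part p p-prime h ≡ 1
  p-part-∤ h 1≤h p∤h = ≡.cong (p ^_) (valuation-unique p p-prime 0 p∤h (≡.sym (ℕₚ.*-identityˡ h)) 1≤h)

  p-part-p : p-part p p-prime p ≡ p
  p-part-p = ≡.trans (≡.cong (p ^_) (valuation-unique p p-prime 1 {1} {p} p∤1 (≡.sym (≡.trans (ℕₚ.*-identityʳ (p ^ 1)) (ℕₚ.^-identityʳ p))) (s≤s z≤n))) (ℕₚ.^-identityʳ p)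
    where
    p∤1 : ¬ p ℕ∣.∣ 1
    p∤1 d = Primality.¬prime[1] (≡.subst Prime (ℕ∣.∣1⇒≡1 d) p-prime)

  module _ (n : ℕ) (1≤n : 1 ≤ n) where
    private φ = denominator-factor (2 ℕ.* n)

    p-part-factor-≢ : ∀ j → j ≢ k → p-part p p-prime (φ j) ≡ 1
    p-part-factor-≢ j j≢k = p-part-∤ (φ j) (s≤s z≤n) p∤φ
      where
      p∤φ : ¬ p ℕ∣.∣ φ j
      p∤φ d with factor-cases n j 1≤n
      ... | inj₁ (φ≡1 , _) = Primality.¬prime[1] (≡.subst Prime (ℕ∣.∣1⇒≡1 (≡.subst (p ℕ∣.∣_) φ≡1 d)) p-prime)
      ... | inj₂ (φ≡q , q-prime , _) with Primality.prime⇒irreducible q-prime (≡.subst (p ℕ∣.∣_) φ≡q d)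
      ...   | inj₁ p≡1 = Primality.¬prime[1] (≡.subst Prime p≡1 p-prime)
      ...   | inj₂ p≡q = j≢k (ℕₚ.suc-injective (≡.sym p≡q))

    p-part-factor-≡ : p-part p p-prime (φ k) ≡ φ k
    p-part-factor-≡ with factor-cases n k 1≤n
    ... | inj₁ (φ≡1 , _) = ≡.trans (≡.cong (p-part p p-prime) φ≡1) (≡.trans (p-part-1 p p-prime) (≡.sym φ≡1))
    ... | inj₂ (φ≡p , _) = ≡.trans (≡.cong (p-part p p-prime) φ≡p) (≡.trans p-part-p (≡.sym φ≡p))

    p-part-last : ∀ K → p-part p p-prime (∏ (suc K) φ) ≡ p-part p p-prime (∏ K φ) ℕ.* p-part p p-prime (φ K)
    p-part-last K = ≡.trans (≡.cong (p-part p p-prime) (∏-last K φ)) (p-part-* p p-prime (1≤∏ K {φ} (λ _ → s≤s z≤n)) (s≤s z≤n))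

    p-part-∏-below : ∀ K → K ≤ k → p-part p p-prime (∏ K φ) ≡ 1
    p-part-∏-below zero    _   = p-part-1 p p-prime
    p-part-∏-below (suc K) K<k = ≡.trans (p-part-last K)
      (≡.cong₂ ℕ._*_ (p-part-∏-below K (ℕₚ.<⇒≤ K<k)) (p-part-factor-≢ K (λ e → ℕₚ.<-irrefl e K<k)))

    p-part-∏-above : ∀ j → p-part p p-prime (∏ (j ℕ.+ suc k) φ) ≡ φ k
    p-part-∏-above zero    = ≡.trans (p-part-last k) (≡.trans
      (≡.cong₂ ℕ._*_ (p-part-∏-below k ℕₚ.≤-refl) p-part-factor-≡) (ℕₚ.*-identityˡ (φ k)))
    p-part-∏-above (suc j) = ≡.trans (p-part-last (j ℕ.+ suc k)) (≡.trans
      (≡.cong₂ ℕ._*_ (p-part-∏-above j) (p-part-factor-≢ (j ℕ.+ suc k) (λ e → ℕₚ.<-irrefl (≡.sym e) (ℕₚ.m≤n+m (suc k) j)))) (ℕₚ.*-identityʳ (φ k)))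

    -- The factors other than 1 are distinct primes, so only the factor with index k can contribute
    -- p = k + 1. The sequence of p-parts is therefore realised by the single system `step k`.
    p-part-bernDenom : p-part p p-prime (bernDenom n) ≡ φ k
    p-part-bernDenom = ≡.trans (≡.cong (p-part p p-prime) (vonStaudtClausen n 1≤n)) (by-size (ℕₚ.≤-total (suc k) (suc (2 ℕ.* n))))
      where
      by-size : suc k ≤ suc (2 ℕ.* n) ⊎ suc (2 ℕ.* n) ≤ suc k → p-part p p-prime (∏ (suc (2 ℕ.* n)) φ) ≡ φ k
      by-size (inj₁ k≤m) = ≡.subst (λ K → p-part p p-prime (∏ K φ) ≡ φ k) (ℕₚ.m∸n+n≡m k≤m) (p-part-∏-above (suc (2 ℕ.* n) ℕ.∸ suc k))
      by-size (inj₂ m≤k) with ℕₚ.m≤n⇒m<n∨m≡n m≤k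
      ... | inj₂ e = ≡.subst (λ K → p-part p p-prime (∏ K φ) ≡ φ k) (≡.sym e) (p-part-∏-above 0)
      -- Here k > 2 n, so index k lies beyond the product, and `φ k` is 1 because k cannot divide 2
      -- n.
      ... | inj₁ (s≤s m<k) = ≡.trans (p-part-∏-below (suc (2 ℕ.* n)) m<k) (≡.sym (factor≡1 (2 ℕ.* n) k (1≤2n 1≤n) m<k))

bernDenom-locally-realisable : EverywhereLocallyRealisable bernDenom
bernDenom-locally-realisable zero    p-prime = ⊥-elim (Primality.¬prime[0] p-prime)
bernDenom-locally-realisable (suc k) p-prime = (λ n → valuation (suc k) p-prime (bernDenom n)) ,
  (λ n _ → isPPart-valuation (suc k) p-prime (bernDenom n) (s≤s z≤n)) ,
  realisable-cong (λ n 1≤n → ≡.sym (p-part-bernDenom k p-prime n 1≤n)) (factor-realisable k)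

theorem1p4 : ((d : ℕ) → 1 ≤ d → (cs : Fin d → ℤ) →
    (R : CommutativeRing 0ℓ 0ℓ) →
    let open CommutativeRing R
        open RingDefs R
    in IsIntegralDomain → CharZero →
    (α : Fin d → Carrier) →
    ((x : Carrier) → evalMonic d cs x ≈ prodF d (λ i → x - α i)) →
    ((i : Fin d) → ¬ IsRootOfUnity (α i)) →
    (Δ : ℕ → ℕ) →
    ((n : ℕ) → 1 ≤ n →
    (ι (+ Δ n) ≈ prodF d (λ i → pow (α i) n - 1#))
    ⊎ (- ι (+ Δ n) ≈ prodF d (λ i → pow (α i) n - 1#))) →
    EverywhereLocallyRealisable Δ × Realisable Δ)
    × (EverywhereLocallyRealisable bernDenom × Realisable bernDenom)
theorem1p4 =
  (λ { (suc d) _ cs R dom char0 α split no-roots Δ Δ-product →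
       CompanionSystem.Δ-locally-realisable d cs R dom char0 α split no-roots Δ Δ-product ,
       CompanionSystem.Δ-realisable d cs R dom char0 α split no-roots Δ Δ-product }) ,
  (bernDenom-locally-realisable , bernDenom-realisable)
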